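{- Let $T$ be a finite tree, and let $S$ be the Seifert matrix of $T$ with respect to an arbitrary enumeration of its vertices. Then the generating function for the Euler characteristics of the Seifert cohomology satisfies $$\Delta(t)=\sum_{n}t^{n}\chi(SH^{\bullet}(T,n))=\det (tS-S^{T}),$$ where $\chi(SH^{\bullet}(T,n))=\sum_k(-1)^k\dim_{\mathbb{F}_2} SH^k(T,n)$ and $S^{T}$ denotes the transpose of $S$.
   Context: Let $T$ be a finite tree. A configuration $C$ on $T$ is a way of marking some vertices of $T$ by pluses and minuses and making some edges of $T$ red such that every vertex of $T$ is either marked by exactly one of the signs $+,-$ (and is then not an end of any red edge), or is unmarked and is the end of exactly one red edge. Let $Q(C)$ be the number of minuses of $C$, and let $E(C)$ be the sum of the number of minuses and the number of red edges. $SC(T)$ is the $\mathbb{F}_2$-vector space with basis the set of all configurations on $T$; $SC^{k}(T,n)$ is the subspace spanned by configurations with $Q(C)=k$, $E(C)=n$. Define a linear map $D:SC(T)\to SC(T)$ on basis elements: $D(C)$ is the sum, over all red edges $e$ of $C$, of the two configurations obtained from $C$ by making $e$ non-red and marking one of its ends by $+$ and the other by $-$ (in the two possible ways). Then $D^2=0$ and $D$ maps $SC^k(T,n)$ to $SC^{k+1}(T,n)$. The Seifert cohomology $SH^{\bullet}(T,n)$ is the cohomology of the complex $(SC^{\bullet}(T,n),D)$. Seifert matrix: given an enumeration of the vertices of $T$, it is the upper-triangular matrix $S=(s_{ij})$ with $s_{ii}=-1$; $s_{ij}=1$ if $i<j$ and the vertices $i$ and $j$ are adjacent in $T$; and $s_{ij}=0$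 otherwise. -}

module Defs where

open import Algebra.Bundles using (CommutativeRing; Ring; RawRing)
open import Algebra.Module.Bundles using (LeftModule)
import Algebra.Module.Properties.LeftModule as LeftModuleProperties
import Algebra.Properties.CommutativeMonoid.Sum as Sum
import Algebra.Properties.CommutativeSemigroup as CommutativeSemigroupProperties
open import Data.Bool.Base using (Bool; true; false; if_then_else_; _∧_; _xor_)
import Data.Bool.Properties as Bool
open import Data.Fin.Base using (Fin; zero; suc; toℕ; fromℕ; inject₁; punchIn)
open import Data.Fin.Permutation using (Permutation′; _⟨$⟩ʳ_)
import Data.Fin.Properties as Fin
open import Data.Fin.Subset using (Subset; ∣_∣) renaming (_∈_ to _∈ˢ_; _∉_ to _∉ˢ_; _-_ to _∖_)
import Data.Fin.Subset.Properties as Subset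
open import Data.Integer.Base as ℤ using (ℤ; 0ℤ; 1ℤ; -1ℤ)
open import Data.List.Base as List using (List; []; _∷_; _++_; concatMap; filter; allFin; cartesianProduct; cartesianProductWith; applyUpTo)
open import Data.List.Membership.Propositional using (_∈_)
import Data.List.Membership.Propositional.Properties as ∈ₚ
open import Data.List.Properties using (++-assoc)
open import Data.List.Relation.Unary.All as All using (All; []; _∷_)
import Data.List.Relation.Unary.All.Properties as Allₚ
open import Data.List.Relation.Unary.Any using (here; there; any?)
import Data.List.Relation.Unary.Any as Any
open import Data.Maybe.Base using (Maybe; just; nothing)
import Data.Maybe.Properties as Maybe
open import Data.Nat.Base using (ℕ; zero; suc; _+_; NonZero)
import Data.Nat.Properties as ℕ
open import Data.Product using (_×_; _,_; proj₁; proj₂; ∃; ∃!; Σ)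
open import Data.Sign.Base using (Sign; opposite)
import Data.Sign.Base as Sign
import Data.Sign.Properties as Sign
open import Data.Sum.Base using (_⊎_; inj₁; inj₂; [_,_]′)
open import Data.Vec.Base as Vec using (Vec; _[_]≔_; count)
import Data.Vec.Properties as Vec
import Data.Vec.Functional as Vector
open Vector using (Vector)
open import Function.Base using (_∘_; id)
open import Function.Definitions using (Injective)
open import Level using (0ℓ; _⊔_)
open import Relation.Binary.Construct.Closure.ReflexiveTransitive using (Star)
open import Relation.Binary.Core using (Rel)
open import Relation.Binary.Definitions as B using (DecidableEquality; Symmetric; Irreflexive)
open import Relation.Binary.PropositionalEquality
open import Relation.Nullary using (¬_; Dec; yes; no; does; contradiction; contradiction-irr)
open import Relation.Nullary.Decidable using (map′; _×-dec_; _⊎-dec_; _→-dec_; ¬?)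
open import Relation.Unary using (Pred; Decidable)

record Graph (n : ℕ) : Set₁ where
  infix 4 _~_ _~?_
  field
    _~_         : Rel (Fin n) 0ℓ
    _~?_        : B.Decidable _~_
    symmetric   : Symmetric _~_
    irreflexive : Irreflexive _≡_ _~_

module _ {n} (G : Graph n) where
  open Graph G

  -- c₀ ~ c₁ ~ ⋯ ~ c_{k+2} ~ c₀, all distinct
  IsCycle : ∀ {k} → Vector (Fin n) (3 + k) → Set
  IsCycle {k} c =
    Injective _≡_ _≡_ c ×
    (∀ i → c (inject₁ i) ~ c (suc i)) ×
    c (fromℕ (2 + k)) ~ c zero

  record IsTree : Set where
    field
      nonEmpty  : NonZero n
      connected : ∀ u v → Star _~_ u v
      acyclic   : ∀ {k} (c : Vector (Fin n) (3 + k)) → ¬ IsCycle c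

module _ {r ℓr m ℓm} {R : Ring r ℓr} (M : LeftModule R m ℓm) where
  open Ring R using (Carrier; _≈_; 0#)
  open LeftModule M
  open Sum +ᴹ-commutativeMonoid using (sum)

  combination : ∀ {d} → Vector Carrier d → Vector Carrierᴹ d → Carrierᴹ
  combination c b = sum (λ i → c i *ₗ b i)

  Independent : ∀ {d} → Vector Carrierᴹ d → Set _
  Independent b = ∀ c → combination c b ≈ᴹ 0ᴹ → ∀ i → c i ≈ 0#

  InSpan : ∀ {d} → Vector Carrierᴹ d → Carrierᴹ → Set _
  InSpan b v = ∃ λ c → combination c b ≈ᴹ v

  record IsBasis {d} (b : Vector Carrierᴹ d) : Set (r ⊔ ℓr ⊔ m ⊔ ℓm) where
    field
      independent : Independent b
      spanning    : ∀ v → InSpan b v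

  HasDimension : ℕ → Set _
  HasDimension d = ∃ λ (b : Vector Carrierᴹ d) → IsBasis b

𝔽₂ : CommutativeRing 0ℓ 0ℓ
𝔽₂ = Bool.xor-∧-commutativeRing

VectorSpace : Set₁
VectorSpace = LeftModule (CommutativeRing.ring 𝔽₂) 0ℓ 0ℓ

-- A basis is extracted from a finite list of vectors meeting every class of
-- _≈ᴹ_ by discarding those in the span of the later ones.
module _ (V : VectorSpace) where
  open LeftModule V
  open Sum +ᴹ-commutativeMonoid using (sum; sum-cong-≋)
  open LeftModuleProperties V using (inverseˡ-uniqueᴹ)

  private
    cong-combination : ∀ {d} {c c′ : Vector Bool d} (b : Vector Carrierᴹ d) →
                       (∀ i → c i ≡ c′ i) → combination V c b ≈ᴹ combination V c′ b
    cong-combination b eq = sum-cong-≋ (λ i → *ₗ-cong (eq i) ≈ᴹ-refl)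

    0-combination : ∀ {d} (b : Vector Carrierᴹ d) → combination V (λ _ → false) b ≈ᴹ 0ᴹ
    0-combination {zero}  b = ≈ᴹ-refl
    0-combination {suc d} b =
      ≈ᴹ-trans (+ᴹ-cong (*ₗ-zeroˡ _) (0-combination (b ∘ suc))) (+ᴹ-identityˡ _)

    x+x≈0 : ∀ x → x +ᴹ x ≈ᴹ 0ᴹ
    x+x≈0 x = ≈ᴹ-trans (+ᴹ-cong (≈ᴹ-sym (*ₗ-identityˡ x)) (≈ᴹ-sym (*ₗ-identityˡ x)))
             (≈ᴹ-trans (≈ᴹ-sym (*ₗ-distribʳ x true true)) (*ₗ-zeroˡ x))

    skip : ∀ {d} (b : Vector Carrierᴹ d) u {v} → InSpan V b v → InSpan V (u Vector.∷ b) v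
    skip b u (c , eq) = false Vector.∷ c ,
      ≈ᴹ-trans (+ᴹ-cong (*ₗ-zeroˡ u) eq) (+ᴹ-identityˡ _)

    head∈ : ∀ {d} (b : Vector Carrierᴹ d) u → InSpan V (u Vector.∷ b) u
    head∈ b u = true Vector.∷ (λ _ → false) ,
      ≈ᴹ-trans (+ᴹ-cong (*ₗ-identityˡ u) (0-combination b)) (+ᴹ-identityʳ u)

    extend : ∀ {d} (b : Vector Carrierᴹ d) u → Independent V b → ¬ InSpan V b u →
             Independent V (u Vector.∷ b)
    extend b u ind u∉ c eq = helper (c zero) refl
      where
      tail≈ = combination V (c ∘ suc) b
      helper : ∀ c₀ → c zero ≡ c₀ → ∀ i → c i ≡ false
      helper true  c₀≡ i = contradiction
        ( c ∘ suc
        , ≈ᴹ-trans (inverseˡ-uniqueᴹ _ _ (x+x≈0 tail≈))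
            (≈ᴹ-sym (inverseˡ-uniqueᴹ u tail≈
              (≈ᴹ-trans (+ᴹ-cong (≈ᴹ-trans (≈ᴹ-sym (*ₗ-identityˡ u)) (*ₗ-cong (sym c₀≡) ≈ᴹ-refl)) ≈ᴹ-refl) eq))))
        u∉
      helper false c₀≡ zero    = c₀≡
      helper false c₀≡ (suc i) = ind (c ∘ suc)
        (≈ᴹ-trans (≈ᴹ-sym (≈ᴹ-trans (+ᴹ-cong (≈ᴹ-trans (*ₗ-cong c₀≡ ≈ᴹ-refl) (*ₗ-zeroˡ u)) ≈ᴹ-refl) (+ᴹ-identityˡ _))) eq) i

  module _ (_≟ᴹ_ : B.Decidable _≈ᴹ_) where
    private
      inSpan? : ∀ {d} (b : Vector Carrierᴹ d) v → Dec (InSpan V b v)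
      inSpan? b v = map′
        (λ (p , eq) → Vec.lookup p , eq)
        (λ (c , eq) → Vec.tabulate c ,
          ≈ᴹ-trans (cong-combination b (Vec.lookup∘tabulate c)) eq)
        (Subset.anySubset? (λ p → combination V (Vec.lookup p) b ≟ᴹ v))

      sift : (vs : List Carrierᴹ) →
             ∃ λ d → Σ (Vector Carrierᴹ d) λ b → Independent V b × All (InSpan V b) vs
      sift []       = 0 , Vector.[] , (λ _ _ ()) , []
      sift (v ∷ vs) with sift vs
      ... | d , b , ind , all with inSpan? b v
      ... | yes v∈ = d , b , ind , v∈ ∷ all
      ... | no  v∉ = suc d , v Vector.∷ b , extend b v ind v∉ , head∈ b v ∷ All.map (skip b v) all

    finiteDimensional : (vs : List Carrierᴹ) → (∀ v → Any.Any (v ≈ᴹ_) vs) → ∃ (HasDimension V)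
    finiteDimensional vs meets with sift vs
    ... | d , b , ind , all = d , b , record
      { independent = ind
      ; spanning    = λ v → let (c , eq) , v≈ = All.lookupAny all (meets v) in
                            c , ≈ᴹ-trans eq (≈ᴹ-sym v≈)
      }

-- The 𝔽₂-vector space with basis X: finite formal sums of elements of X,
-- compared by the parity of the multiplicity of each basis element.

module FormalSum {X : Set} (_≟_ : DecidableEquality X) where

  -- the linear extension of φ
  parity : (X → Bool) → List X → Bool
  parity φ []      = false
  parity φ (c ∷ x) = φ c xor parity φ x

  coefficient : List X → X → Bool
  coefficient x c = parity (λ c′ → does (c′ ≟ c)) x

  infix 4 _≈_
  _≈_ : Rel (List X) 0ℓ
  x ≈ y = ∀ c → coefficient x c ≡ coefficient y c

  scale : Bool → List X → List X
  scale a x = if a then x else []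

  parity-++ : ∀ φ x y → parity φ (x ++ y) ≡ parity φ x xor parity φ y
  parity-++ φ []      y = refl
  parity-++ φ (c ∷ x) y =
    trans (cong (φ c xor_) (parity-++ φ x y)) (sym (Bool.xor-assoc (φ c) _ _))

  parity-concatMap : ∀ φ (f : X → List X) x →
                     parity φ (concatMap f x) ≡ parity (λ c → parity φ (f c)) x
  parity-concatMap φ f []      = refl
  parity-concatMap φ f (c ∷ x) =
    trans (parity-++ φ (f c) (concatMap f x)) (cong (parity φ (f c) xor_) (parity-concatMap φ f x))

  infix 4 _≋_
  _≋_ : Rel (List X) 0ℓ
  x ≋ y = ∀ φ → parity φ x ≡ parity φ y

  subSums : List X → List (List X)
  subSums []       = [] ∷ []
  subSums (c ∷ cs) = subSums cs ++ List.map (c ∷_) (subSums cs)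

  private
    add : ∀ {c cs x} → c ∈ cs → x ∈ subSums cs → ∃ λ y → y ∈ subSums cs × c ∷ x ≋ y
    add {cs = c₀ ∷ cs} c∈ x∈ with ∈ₚ.∈-++⁻ (subSums cs) x∈
    add {cs = c₀ ∷ cs} (here refl) _ | inj₁ x∈ =
      _ , ∈ₚ.∈-++⁺ʳ (subSums cs) (∈ₚ.∈-map⁺ (c₀ ∷_) x∈) , λ _ → refl
    add {cs = c₀ ∷ cs} (there c∈) _ | inj₁ x∈ =
      let y , y∈ , eq = add c∈ x∈ in y , ∈ₚ.∈-++⁺ˡ y∈ , eq
    add {c} {c₀ ∷ cs} c∈ _ | inj₂ x∈ with ∈ₚ.∈-map⁻ (c₀ ∷_) x∈
    add {c} {c₀ ∷ cs} (here refl) _ | inj₂ _ | x , x∈ , refl =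
      x , ∈ₚ.∈-++⁺ˡ x∈ , λ φ →
      trans (sym (Bool.xor-assoc (φ c) (φ c) (parity φ x))) (cong (_xor parity φ x) (Bool.xor-same (φ c)))
    add {c} {c₀ ∷ cs} (there c∈) _ | inj₂ _ | x , x∈ , refl =
      let y , y∈ , eq = add c∈ x∈ in
      c₀ ∷ y , ∈ₚ.∈-++⁺ʳ (subSums cs) (∈ₚ.∈-map⁺ (c₀ ∷_) y∈) , λ φ →
      trans (sym (Bool.xor-assoc (φ c) (φ c₀) _))
      (trans (cong (_xor parity φ x) (Bool.xor-comm (φ c) (φ c₀)))
      (trans (Bool.xor-assoc (φ c₀) (φ c) _) (cong (φ c₀ xor_) (eq φ))))

  represent : ∀ {cs} x → All (_∈ cs) x → ∃ λ y → y ∈ subSums cs × x ≋ y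
  represent {cs} [] [] = [] , []∈ cs , λ _ → refl
    where
    []∈ : ∀ cs → [] ∈ subSums cs
    []∈ []       = here refl
    []∈ (c ∷ cs) = ∈ₚ.∈-++⁺ˡ ([]∈ cs)
  represent (c ∷ x) (c∈ ∷ x∈) =
    let y , y∈ , eq  = represent x x∈
        z , z∈ , eq′ = add c∈ y∈ in
    z , z∈ , λ φ → trans (cong (φ c xor_) (eq φ)) (eq′ φ)

  subSums-All : ∀ {P : Pred X 0ℓ} {cs} → All P cs → All (All P) (subSums cs)
  subSums-All []       = [] ∷ []
  subSums-All (p ∷ ps) =
    Allₚ.++⁺ (subSums-All ps) (Allₚ.map⁺ (All.map (p ∷_) (subSums-All ps)))

-- Cohomology at the middle term of ⟨Q⟩ → ⟨P⟩ → ⟨X⟩, where ⟨P⟩ denotes the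
-- span of the basis elements satisfying P, and both maps are restrictions
-- of the linear extension D of D₀.

module Cohomology
  {X : Set} (_≟_ : DecidableEquality X) (D₀ : X → List X) {P Q : Pred X 0ℓ}
  where

  open FormalSum _≟_
  open CommutativeSemigroupProperties (CommutativeRing.+-commutativeSemigroup 𝔽₂)
    using (interchange)

  D : List X → List X
  D = concatMap D₀

  record Cocycle : Set where
    constructor cocycle
    field
      cochain : List X
      graded  : All P cochain
      closed  : D cochain ≈ []
  open Cocycle

  -- x - y is a coboundary; over 𝔽₂, x - y = x + y
  infix 4 _∼_
  _∼_ : Rel Cocycle 0ℓ
  x ∼ y = ∃ λ w → All Q w × D w ≈ cochain x ++ cochain y

  coeff-++ : ∀ x y c → coefficient (x ++ y) c ≡ coefficient x c xor coefficient y c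
  coeff-++ x y c = parity-++ _ x y

  coeff-D-++ : ∀ x y c → coefficient (D (x ++ y)) c ≡ coefficient (D x) c xor coefficient (D y) c
  coeff-D-++ x y c = trans (parity-concatMap _ D₀ (x ++ y)) (trans (parity-++ _ x y)
    (sym (cong₂ _xor_ (parity-concatMap _ D₀ x) (parity-concatMap _ D₀ y))))

  ≈⇒∼ : ∀ {x y} → cochain x ≈ cochain y → x ∼ y
  ≈⇒∼ {x} {y} eq = [] , [] , λ c → sym
    (trans (coeff-++ (cochain x) (cochain y) c)
    (trans (cong (_xor coefficient (cochain y) c) (eq c)) (Bool.xor-same (coefficient (cochain y) c))))

  ∼-refl : ∀ {x} → x ∼ x
  ∼-refl {x} = ≈⇒∼ {x} {x} λ _ → refl

  ∼-sym : ∀ {x y} → x ∼ y → y ∼ x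
  ∼-sym {x} {y} (w , gr , eq) = w , gr , λ c → trans (eq c)
    (trans (coeff-++ (cochain x) (cochain y) c)
    (trans (Bool.xor-comm (coefficient (cochain x) c) _) (sym (coeff-++ (cochain y) (cochain x) c))))

  ∼-trans : ∀ {x y z} → x ∼ y → y ∼ z → x ∼ z
  ∼-trans {x} {y} {z} (w , gr , eq) (w′ , gr′ , eq′) = w ++ w′ , Allₚ.++⁺ gr gr′ , λ c →
    let a = coefficient (cochain x) c
        b = coefficient (cochain y) c
        d = coefficient (cochain z) c in
    trans (coeff-D-++ w w′ c)
    (trans (cong₂ _xor_ (trans (eq c) (coeff-++ (cochain x) (cochain y) c))
                        (trans (eq′ c) (coeff-++ (cochain y) (cochain z) c)))
    (trans (Bool.xor-assoc a b (b xor d))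
    (trans (cong (a xor_) (trans (sym (Bool.xor-assoc b b d)) (cong (_xor d) (Bool.xor-same b))))
    (sym (coeff-++ (cochain x) (cochain z) c)))))

  infixl 6 _⊕_
  _⊕_ : Cocycle → Cocycle → Cocycle
  cochain (x ⊕ y) = cochain x ++ cochain y
  graded  (x ⊕ y) = Allₚ.++⁺ (graded x) (graded y)
  closed  (x ⊕ y) c = trans (coeff-D-++ (cochain x) (cochain y) c) (cong₂ _xor_ (closed x c) (closed y c))

  𝟘 : Cocycle
  𝟘 = cocycle [] [] (λ _ → refl)

  _•_ : Bool → Cocycle → Cocycle
  cochain (a • x) = scale a (cochain x)
  graded  (true  • x) = graded x
  graded  (false • x) = []
  closed  (true  • x) = closed x
  closed  (false • x) = λ _ → refl

  ⊕-cong : ∀ {x y u v} → x ∼ y → u ∼ v → x ⊕ u ∼ y ⊕ v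
  ⊕-cong {x} {y} {u} {v} (w , gr , eq) (w′ , gr′ , eq′) = w ++ w′ , Allₚ.++⁺ gr gr′ , λ c →
    let ⟦_⟧ = λ z → coefficient (cochain z) c in
    trans (coeff-D-++ w w′ c)
    (trans (cong₂ _xor_ (trans (eq c) (coeff-++ (cochain x) (cochain y) c))
                        (trans (eq′ c) (coeff-++ (cochain u) (cochain v) c)))
    (trans (interchange ⟦ x ⟧ ⟦ y ⟧ ⟦ u ⟧ ⟦ v ⟧)
    (sym (trans (coeff-++ (cochain x ++ cochain u) (cochain y ++ cochain v) c)
      (cong₂ _xor_ (coeff-++ (cochain x) (cochain u) c) (coeff-++ (cochain y) (cochain v) c))))))

  ⊕-comm : ∀ x y → x ⊕ y ∼ y ⊕ x
  ⊕-comm x y = ≈⇒∼ {x ⊕ y} {y ⊕ x} λ c →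
    trans (coeff-++ (cochain x) (cochain y) c)
    (trans (Bool.xor-comm (coefficient (cochain x) c) _) (sym (coeff-++ (cochain y) (cochain x) c)))

  ⊕-identityˡ : ∀ x → 𝟘 ⊕ x ∼ x
  ⊕-identityˡ x = ≈⇒∼ {𝟘 ⊕ x} {x} λ _ → refl

  ⊕-inverse : ∀ x → x ⊕ x ∼ 𝟘
  ⊕-inverse x = ≈⇒∼ {x ⊕ x} {𝟘} λ c →
    trans (coeff-++ (cochain x) (cochain x) c) (Bool.xor-same (coefficient (cochain x) c))

  •-cong : ∀ {a b x y} → a ≡ b → x ∼ y → a • x ∼ b • y
  •-cong {true}  refl eq = eq
  •-cong {false} {x = x} {y} refl _ = ≈⇒∼ {false • x} {false • y} λ _ → refl

  •-distribʳ : ∀ x a b → (a xor b) • x ∼ (a • x) ⊕ (b • x)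
  •-distribʳ x true  true  = ∼-sym {(true • x) ⊕ (true • x)} {false • x} (⊕-inverse x)
  •-distribʳ x true  false = ≈⇒∼ {true • x} {(true • x) ⊕ (false • x)} λ c →
    sym (trans (coeff-++ (cochain x) [] c) (Bool.xor-identityʳ _))
  •-distribʳ x false b = ≈⇒∼ {b • x} {(false • x) ⊕ (b • x)} λ _ → refl

  •-assoc : ∀ a b x → (a ∧ b) • x ∼ a • (b • x)
  •-assoc true  b x = ∼-refl {b • x}
  •-assoc false b x = ∼-refl {false • x}

  •-zeroʳ : ∀ a → a • 𝟘 ∼ 𝟘
  •-zeroʳ true  = ∼-refl {𝟘}
  •-zeroʳ false = ≈⇒∼ {false • 𝟘} {𝟘} λ _ → refl

  •-distribˡ : ∀ a x y → a • (x ⊕ y) ∼ (a • x) ⊕ (a • y)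
  •-distribˡ true  x y = ∼-refl {x ⊕ y}
  •-distribˡ false x y = ≈⇒∼ {false • (x ⊕ y)} {(false • x) ⊕ (false • y)} λ _ → refl

  space : VectorSpace
  space = record
    { Carrierᴹ = Cocycle
    ; _≈ᴹ_ = _∼_
    ; _+ᴹ_ = _⊕_
    ; _*ₗ_ = _•_
    ; 0ᴹ   = 𝟘
    ; -ᴹ_  = id
    ; isLeftModule = record
      { isLeftSemimodule = record
        { +ᴹ-isCommutativeMonoid = record
          { isMonoid = record
            { isSemigroup = record
              { isMagma = record
                { isEquivalence = record
                  { refl  = λ {x} → ∼-refl {x}
                  ; sym   = λ {x} {y} → ∼-sym {x} {y}
                  ; trans = λ {x} {y} {z} → ∼-trans {x} {y} {z}
                  }
                ; ∙-cong = λ {x} {y} {u} {v} → ⊕-cong {x} {y} {u} {v}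
                }
              ; assoc = λ x y z → ≈⇒∼ {(x ⊕ y) ⊕ z} {x ⊕ (y ⊕ z)} λ c →
                  cong (λ s → coefficient s c) (++-assoc (cochain x) (cochain y) (cochain z))
              }
            ; identity = ⊕-identityˡ , λ x →
                ∼-trans {x ⊕ 𝟘} {𝟘 ⊕ x} {x} (⊕-comm x 𝟘) (⊕-identityˡ x)
            }
          ; comm = ⊕-comm
          }
        ; isPreleftSemimodule = record
          { *ₗ-cong      = λ {a} {b} {x} {y} → •-cong {a} {b} {x} {y}
          ; *ₗ-zeroˡ     = λ x → ≈⇒∼ {false • x} {𝟘} λ _ → refl
          ; *ₗ-distribʳ  = •-distribʳ
          ; *ₗ-identityˡ = λ x → ≈⇒∼ {true • x} {x} λ _ → refl
          ; *ₗ-assoc     = •-assoc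
          ; *ₗ-zeroʳ     = •-zeroʳ
          ; *ₗ-distribˡ  = •-distribˡ
          }
        }
      ; -ᴹ‿cong    = id
      ; -ᴹ‿inverse = ⊕-inverse , ⊕-inverse
      }
    }

  module _ (P? : Decidable P) (Q? : Decidable Q) (cs : List X) (complete : ∀ c → c ∈ cs) where
    _≈?_ : B.Decidable _≈_
    x ≈? y = map′ (λ eq c → All.lookup eq (complete c)) (λ eq → All.tabulate λ {c} _ → eq c)
               (All.all? (λ c → coefficient x c Bool.≟ coefficient y c) cs)

    ≋⇒D≈ : ∀ {x y} → x ≋ y → D x ≈ D y
    ≋⇒D≈ {x} {y} eq c = trans (parity-concatMap _ D₀ x) (trans (eq _) (sym (parity-concatMap _ D₀ y)))

    sums : ∀ {R : Pred X 0ℓ} → Decidable R → List (List X)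
    sums R? = subSums (filter R? cs)

    sums-All : ∀ {R : Pred X 0ℓ} (R? : Decidable R) → All (All R) (sums R?)
    sums-All R? = subSums-All (Allₚ.all-filter R? cs)

    represent′ : ∀ {R : Pred X 0ℓ} (R? : Decidable R) x → All R x → ∃ λ y → y ∈ sums R? × x ≋ y
    represent′ R? x gr = represent x (All.map (∈ₚ.∈-filter⁺ R? (complete _)) gr)

    _∼?_ : B.Decidable _∼_
    x ∼? y = map′ found missed (any? (λ w → D w ≈? target) (sums Q?))
      where
      target = cochain x ++ cochain y
      found : Any.Any (λ w → D w ≈ target) (sums Q?) → x ∼ y
      found any = _ , proj₁ it , proj₂ it
        where it = All.lookupAny (sums-All Q?) any
      missed : x ∼ y → Any.Any (λ w → D w ≈ target) (sums Q?)
      missed (w , gr , eq) =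
        let w′ , w′∈ , w≋w′ = represent′ Q? w gr in
        Any.map (λ { refl c → trans (sym (≋⇒D≈ {w} {w′} w≋w′ c)) (eq c) }) w′∈

    cocycles : (xs : List (List X)) → All (All P) xs → List Cocycle
    cocycles []       []         = []
    cocycles (x ∷ xs) (gr ∷ grs) with D x ≈? []
    ... | yes cl = cocycle x gr cl ∷ cocycles xs grs
    ... | no  _  = cocycles xs grs

    cocycles-meets : ∀ v xs grs → Any.Any (cochain v ≋_) xs → Any.Any (v ∼_) (cocycles xs grs)
    cocycles-meets v (x ∷ xs) (gr ∷ grs) any with D x ≈? [] | any
    ... | yes cl | here eq   = here (≈⇒∼ {v} {cocycle x gr cl} λ c → eq _)
    ... | yes cl | there any = there (cocycles-meets v xs grs any)
    ... | no ¬cl | here eq   =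
      contradiction (λ c → trans (sym (≋⇒D≈ {cochain v} {x} eq c)) (closed v c)) ¬cl
    ... | no ¬cl | there any = cocycles-meets v xs grs any

    space-finiteDimensional : ∃ (HasDimension space)
    space-finiteDimensional =
      finiteDimensional space _∼?_ (cocycles (sums P?) (sums-All P?)) λ v →
        let y , y∈ , eq = represent′ P? (cochain v) (graded v) in
        cocycles-meets v (sums P?) (sums-All P?) (Any.map (λ { refl → eq }) y∈)

module _ {n} (G : Graph n) where
  open Graph G using (_~_; _~?_)

  -- each (undirected) edge is listed once, smaller end first
  edges : List (Fin n × Fin n)
  edges = filter (λ (u , v) → (u Fin.<? v) ×-dec (u ~? v)) (cartesianProduct (allFin n) (allFin n))

  Edge : Set
  Edge = Fin (List.length edges)

  end₁ end₂ : Edge → Fin n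
  end₁ e = proj₁ (List.lookup edges e)
  end₂ e = proj₂ (List.lookup edges e)

  IsEnd : Fin n → Edge → Set
  IsEnd v e = v ≡ end₁ e ⊎ v ≡ end₂ e

  Marks : Set
  Marks = Vec (Maybe Sign) n

  IsRedEndOf : Subset (List.length edges) → Fin n → Edge → Set
  IsRedEndOf red v e = e ∈ˢ red × IsEnd v e

  IsConfiguration : Marks → Subset (List.length edges) → Set
  IsConfiguration marks red = ∀ v →
    (∃ λ s → Vec.lookup marks v ≡ just s) × (∀ e → ¬ IsRedEndOf red v e)
    ⊎
    Vec.lookup marks v ≡ nothing × ∃! _≡_ (IsRedEndOf red v)

  record Configuration : Set where
    constructor configuration
    field
      marks  : Marks
      red    : Subset (List.length edges)
      .valid : IsConfiguration marks red
  open Configuration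

  isRedEndOf? : ∀ red v → Decidable (IsRedEndOf red v)
  isRedEndOf? red v e = (e Subset.∈? red) ×-dec ((v Fin.≟ end₁ e) ⊎-dec (v Fin.≟ end₂ e))

  ∃!? : ∀ {m} {P : Pred (Fin m) 0ℓ} → Decidable P → Dec (∃! _≡_ P)
  ∃!? P? = map′ (λ (x , px , u) → x , px , λ {y} → u y) (λ (x , px , u) → x , px , λ y → u {y})
    (Fin.any? λ x → P? x ×-dec Fin.all? λ y → P? y →-dec (x Fin.≟ y))

  isJust? : ∀ (m : Maybe Sign) → Dec (∃ λ s → m ≡ just s)
  isJust? (just s) = yes (s , refl)
  isJust? nothing  = no λ ()

  isConfiguration? : ∀ marks red → Dec (IsConfiguration marks red)
  isConfiguration? marks red = Fin.all? λ v →
    (isJust? (Vec.lookup marks v) ×-dec Fin.all? λ e → ¬? (isRedEndOf? red v e))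
    ⊎-dec
    (Maybe.≡-dec Sign._≟_ (Vec.lookup marks v) nothing ×-dec ∃!? (isRedEndOf? red v))

  _≟ᶜ_ : DecidableEquality Configuration
  configuration m r _ ≟ᶜ configuration m′ r′ _ = map′
    (λ { (refl , refl) → refl }) (λ { refl → refl , refl })
    (Vec.≡-dec (Maybe.≡-dec Sign._≟_) m m′ ×-dec Vec.≡-dec Bool._≟_ r r′)

  #minus : Configuration → ℕ
  #minus C = count (λ m → Maybe.≡-dec Sign._≟_ m (just Sign.-)) (marks C)

  #red : Configuration → ℕ
  #red C = ∣ red C ∣

  Q E : Configuration → ℕ
  Q C = #minus C
  E C = #minus C + #red C

  setEnds : Marks → Edge → Sign → Marks
  setEnds m e s = (m [ end₁ e ]≔ just s) [ end₂ e ]≔ just (opposite s)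

  x∉p-x : ∀ {k} (p : Subset k) x → x ∉ˢ (p ∖ x)
  x∉p-x (b Vec.∷ p) (suc x) (Vec.there x∈) = x∉p-x p x x∈

  setEnds-valid : ∀ {m r} → IsConfiguration m r → ∀ {e} → e ∈ˢ r → ∀ s →
                  IsConfiguration (setEnds m e s) (r ∖ e)
  setEnds-valid {m} {r} valid {e} e∈ s v = go (v Fin.≟ end₂ e) (v Fin.≟ end₁ e)
    where
    old∈ : ∀ {e′} → IsRedEndOf (r ∖ e) v e′ → IsRedEndOf r v e′
    old∈ (e′∈ , end) = Subset.p─q⊆p r _ e′∈ , end

    noRed : IsEnd v e → ∀ e′ → ¬ IsRedEndOf (r ∖ e) v e′
    noRed end e′ e′∈ with valid v
    ... | inj₁ (_ , none)           = none e (e∈ , end)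
    ... | inj₂ (_ , _ , _ , unique) = x∉p-x r e
      (subst (_∈ˢ (r ∖ e)) (trans (sym (unique (old∈ e′∈))) (unique (e∈ , end))) (proj₁ e′∈))

    go : Dec (v ≡ end₂ e) → Dec (v ≡ end₁ e) → _
    go (yes v≡) _ = inj₁
      ( (opposite s , trans (cong (Vec.lookup (setEnds m e s)) v≡) (Vec.lookup∘update (end₂ e) (m [ end₁ e ]≔ just s) _))
      , noRed (inj₂ v≡))
    go (no v≢) (yes v≡) = inj₁
      ( (s , trans (Vec.lookup∘update′ v≢ (m [ end₁ e ]≔ just s) _)
               (trans (cong (Vec.lookup (m [ end₁ e ]≔ just s)) v≡) (Vec.lookup∘update (end₁ e) m _)))
      , noRed (inj₁ v≡))
    go (no v≢₂) (no v≢₁) with valid v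
    ... | inj₁ ((s′ , eq) , none) = inj₁ ((s′ , trans unchanged eq) , λ e′ e′∈ → none e′ (old∈ e′∈))
      where unchanged = trans (Vec.lookup∘update′ v≢₂ (m [ end₁ e ]≔ just s) _) (Vec.lookup∘update′ v≢₁ m _)
    ... | inj₂ (eq , e₀ , (e₀∈ , end) , unique) = inj₂
      (trans unchanged eq , e₀ , (Subset.x∈p∧x≢y⇒x∈p-y e₀∈ e₀≢e , end) , λ {e′} e′∈ → unique (old∈ {e′} e′∈))
      where
      unchanged = trans (Vec.lookup∘update′ v≢₂ (m [ end₁ e ]≔ just s) _) (Vec.lookup∘update′ v≢₁ m _)
      e₀≢e : e₀ ≢ e
      e₀≢e refl = [ v≢₁ , v≢₂ ]′ end

  split : (C : Configuration) (e : Edge) → e ∈ˢ red C → Sign → Configuration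
  split (configuration m r valid) e e∈ s =
    configuration (setEnds m e s) (r ∖ e) (setEnds-valid {m} valid e∈ s)

  splits : Configuration → Edge → List Configuration
  splits C e with e Subset.∈? red C
  ... | yes e∈ = split C e e∈ Sign.+ ∷ split C e e∈ Sign.- ∷ []
  ... | no  _  = []

  D₀ : Configuration → List Configuration
  D₀ C = concatMap (splits C) (allFin _)

  vecs : ∀ {A : Set} → List A → ∀ k → List (Vec A k)
  vecs as zero    = Vec.[] ∷ []
  vecs as (suc k) = cartesianProductWith Vec._∷_ as (vecs as k)

  ∈-vecs : ∀ {A : Set} {as : List A} → (∀ a → a ∈ as) → ∀ {k} (v : Vec A k) → v ∈ vecs as k
  ∈-vecs all Vec.[]      = here refl
  ∈-vecs all (a Vec.∷ v) = ∈ₚ.∈-cartesianProductWith⁺ Vec._∷_ (all a) (∈-vecs all v)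

  ∈-signs : ∀ m → m ∈ (nothing ∷ just Sign.+ ∷ just Sign.- ∷ [])
  ∈-signs nothing         = here refl
  ∈-signs (just Sign.+) = there (here refl)
  ∈-signs (just Sign.-) = there (there (here refl))

  ∈-bools : ∀ b → b ∈ (false ∷ true ∷ [])
  ∈-bools false = here refl
  ∈-bools true  = there (here refl)

  fromPair : Marks × Subset (List.length edges) → List Configuration
  fromPair (m , r) with isConfiguration? m r
  ... | yes valid = configuration m r valid ∷ []
  ... | no  _     = []

  ∈-fromPair : ∀ m r .(valid : IsConfiguration m r) → configuration m r valid ∈ fromPair (m , r)
  ∈-fromPair m r valid with isConfiguration? m r
  ... | yes _  = here refl
  ... | no  ¬v = contradiction-irr valid ¬v

  configurations : List Configuration
  configurations = concatMap fromPair
    (cartesianProduct (vecs (nothing ∷ just Sign.+ ∷ just Sign.- ∷ []) n)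
                      (vecs (false ∷ true ∷ []) (List.length edges)))

  ∈-configurations : ∀ C → C ∈ configurations
  ∈-configurations (configuration m r valid) = ∈ₚ.∈-concatMap⁺ fromPair
    (Any.map (λ { refl → ∈-fromPair m r valid })
      (∈ₚ.∈-cartesianProduct⁺ (∈-vecs ∈-signs m) (∈-vecs ∈-bools r)))

  -- The span of InPreviousDegree k m is SCᵏ⁻¹(T,m), which is zero for k = 0.
  InDegree InPreviousDegree : ℕ → ℕ → Pred Configuration 0ℓ
  InDegree         k m C = Q C ≡ k × E C ≡ m
  InPreviousDegree k m C = suc (Q C) ≡ k × E C ≡ m

  SH : ℕ → ℕ → VectorSpace
  SH k m = Cohomology.space _≟ᶜ_ D₀ {InDegree k m} {InPreviousDegree k m}

  SH-finiteDimensional : ∀ k m → ∃ (HasDimension (SH k m))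
  SH-finiteDimensional k m = Cohomology.space-finiteDimensional _≟ᶜ_ D₀
    (λ C → (Q C ℕ.≟ k) ×-dec (E C ℕ.≟ m))
    (λ C → (suc (Q C) ℕ.≟ k) ×-dec (E C ℕ.≟ m))
    configurations ∈-configurations

  dimSH : ℕ → ℕ → ℕ
  dimSH k m = proj₁ (SH-finiteDimensional k m)

  -- Σₖ (-1)ᵏ dim SHᵏ(T,m); as Q C ≤ E C, the terms with k > m vanish
  χ : ℕ → ℤ
  χ m = List.foldr ℤ._+_ 0ℤ (applyUpTo (λ k → -1ℤ ℤ.^ k ℤ.* ℤ.+ dimSH k m) (suc m))

Matrix : ∀ {a} → Set a → ℕ → Set a
Matrix A n = Fin n → Fin n → A

_ᵀ : ∀ {a n} {A : Set a} → Matrix A n → Matrix A n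
(M ᵀ) i j = M j i

module Determinant {c ℓ} (R : RawRing c ℓ) where
  open RawRing R using (Carrier; _*_; -_; 1#; +-rawMonoid; rawSemiring)
  open import Algebra.Definitions.RawMonoid +-rawMonoid using (sum)
  open import Algebra.Definitions.RawSemiring rawSemiring using (_^_)

  minor : ∀ {n} → Matrix Carrier (suc n) → Fin (suc n) → Matrix Carrier n
  minor M j i k = M (suc i) (punchIn j k)

  -- expansion along the first row
  det : ∀ {n} → Matrix Carrier n → Carrier
  det {zero}  M = 1#
  det {suc n} M = sum λ j → ((- 1#) ^ toℕ j) * (M zero j * det (minor M j))

-- Σₘ tᵐ aₘ is represented by the sequence a, and a polynomial by a list of
-- coefficients, constant term first.
PowerSeries : Set
PowerSeries = ℕ → ℤ

Polynomial : Set
Polynomial = List ℤ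

toSeries : Polynomial → PowerSeries
toSeries []      m       = 0ℤ
toSeries (a ∷ p) zero    = a
toSeries (a ∷ p) (suc m) = toSeries p m

infix  8 -ᵖ_
infixl 6 _+ᵖ_
infixl 7 _*ᵖ_
_+ᵖ_ _*ᵖ_ : Polynomial → Polynomial → Polynomial
[]      +ᵖ q       = q
(a ∷ p) +ᵖ []      = a ∷ p
(a ∷ p) +ᵖ (b ∷ q) = a ℤ.+ b ∷ p +ᵖ q

[]      *ᵖ q = []
(a ∷ p) *ᵖ q = List.map (a ℤ.*_) q +ᵖ (0ℤ ∷ p *ᵖ q)

-ᵖ_ : Polynomial → Polynomial
-ᵖ p = List.map (λ a → ℤ.- a) p

ℤ[t] : RawRing 0ℓ 0ℓ
ℤ[t] = record
  { Carrier = Polynomial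
  ; _≈_ = λ p q → toSeries p ≗ toSeries q
  ; _+_ = _+ᵖ_
  ; _*_ = _*ᵖ_
  ; -_  = -ᵖ_
  ; 0#  = []
  ; 1#  = 1ℤ ∷ []
  }

open Determinant ℤ[t] public using (det)

const : ℤ → Polynomial
const a = a ∷ []

t : Polynomial
t = 0ℤ ∷ 1ℤ ∷ []

infixr 7 _∙ᴹ_
_∙ᴹ_ : ∀ {n} → Polynomial → Matrix ℤ n → Matrix Polynomial n
(p ∙ᴹ M) i j = p *ᵖ const (M i j)

infixl 6 _-ᴹ_
_-ᴹ_ : ∀ {n} → Matrix Polynomial n → Matrix ℤ n → Matrix Polynomial n
(M -ᴹ N) i j = M i j +ᵖ (-ᵖ const (N i j))

-- σ lists the vertices: the i-th one is σ ⟨$⟩ʳ i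
seifertMatrix : ∀ {n} → Graph n → Permutation′ n → Matrix ℤ n
seifertMatrix G σ i j =
  if does (i Fin.≟ j) then -1ℤ else
  if does ((i Fin.<? j) ×-dec ((σ ⟨$⟩ʳ i) ~? (σ ⟨$⟩ʳ j))) then 1ℤ else 0ℤ
  where open Graph G

generatingFunction : ∀ {n} → Graph n → PowerSeries
generatingFunction T m = χ T m

{-# OPTIONS --safe #-}

-- Both sides are the state sum Σ_C (-1)^Q(C) t^E(C) over all configurations.
--
-- For the cohomology this is the Euler characteristic argument: D² = 0, because the
-- splittings at two different red edges commute, and dim Cᵏ = rank Dᵏ + dim SHᵏ + rank Dᵏ⁻¹,
-- so the ranks cancel in the alternating sum.
--
-- For the determinant, group the configurations by their set of red edges: an uncovered
-- vertex contributes 1 - t and a red edge contributes t. If v is a leaf with neighbour w,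
-- expanding det M along row v and column v gives
--   det M = M_vv det (M - v) - M_vw M_wv det (M - v - w),
-- and M_vw M_wv = - t; this is the recursion of the state sum on the edge vw. Instead of
-- removing vertices, the rows and columns are replaced by those of a diagonal matrix, so
-- that the vertex set is fixed and the induction runs over the list of edges.
module Submission where

open import Algebra.Bundles using (CommutativeMonoid; CommutativeRing)
open import Algebra.Module.Bundles using (LeftModule)
import Algebra.Properties.CommutativeMonoid.Sum as MonoidSum
import Algebra.Properties.CommutativeSemigroup as CommutativeSemigroupProperties
import Algebra.Properties.Ring as RingProperties
import Algebra.Properties.Semiring.Exp as Exp
import Algebra.Properties.Semiring.Sum as SemiringSum
import Algebra.Solver.Ring.NaturalCoefficients.Default as SemiringSolver
open import Data.Bool.Base using (Bool; true; false; if_then_else_; _∧_; _∨_; _xor_)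
import Data.Bool.Properties as Bool
open import Data.Fin.Base using (Fin; zero; suc; toℕ; fromℕ; inject₁; punchIn; punchOut; _↑ˡ_; _↑ʳ_; combine;
  funToFin; finToFun) renaming (_<_ to _<ᶠ_)
open import Data.Fin.Permutation as Permutation using (Permutation′; _⟨$⟩ʳ_; _⟨$⟩ˡ_)
import Data.Fin.Properties as Fin
open import Data.Fin.Subset using (Subset; ∣_∣) renaming (_∈_ to _∈ˢ_; _∉_ to _∉ˢ_; _-_ to _∖_)
import Data.Fin.Subset.Properties as Subset
open import Data.Integer.Base as ℤ using (ℤ; 0ℤ; 1ℤ; -1ℤ)
import Data.Integer.Properties as ℤ
import Data.Integer.Solver as ℤ-Solver
open import Data.List.Base as List using (List; []; _∷_; _++_; concatMap; filter; length; lookup; allFin;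
  applyUpTo; cartesianProduct; cartesianProductWith)
open import Data.List.Membership.Propositional using (_∈_; _∉_; find; lose)
import Data.List.Membership.Propositional.Properties as ∈ₚ
import Data.List.Properties as List
open import Data.List.Relation.Binary.Permutation.Propositional as ↭ using (_↭_; ↭⇒↭ₛ)
import Data.List.Relation.Binary.Permutation.Propositional.Properties as ↭ₚ
import Data.List.Relation.Binary.Permutation.Setoid.Properties as ↭ₛ
open import Data.List.Relation.Unary.All as All using (All; []; _∷_)
import Data.List.Relation.Unary.All.Properties as Allₚ
open import Data.List.Relation.Unary.AllPairs as AllPairs using ([]; _∷_)
import Data.List.Relation.Unary.AllPairs.Properties as AllPairsₚ
open import Data.List.Relation.Unary.Any using (here; there; any?; index)
import Data.List.Relation.Unary.Any.Properties as Anyₚ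
open import Data.List.Relation.Unary.Linked using (Linked; [-]; _∷_)
open import Data.List.Relation.Unary.Unique.Propositional using (Unique)
import Data.List.Relation.Unary.Unique.Propositional.Properties as Unique
open import Data.Maybe.Base using (Maybe; just; nothing)
import Data.Maybe.Properties as Maybe
open import Data.Nat.Base as ℕ using (ℕ; zero; suc; _≤_; _<_; z≤n; s≤s)
import Data.Nat.Properties as ℕ
import Data.Nat.Solver as ℕ-Solver
open import Data.Product using (_×_; _,_; proj₁; proj₂; ∃; ∃!; ∃₂)
import Data.Product.Properties as Product
open import Data.Sign.Base as Sign using (Sign; opposite)
import Data.Sign.Properties as Sign
open import Data.Sum.Base as Sum using (_⊎_; inj₁; inj₂; [_,_]′)
open import Data.Vec.Base as Vec using (Vec; _[_]≔_; count)
open import Data.Vec.Functional as Vector using (Vector)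
import Data.Vec.Properties as Vec
open import Function.Base using (_∘_; id)
open import Function.Bundles using (module Injection; module Inverse)
open import Function.Definitions using (Injective)
open import Function.Properties.Inverse using (↔⇒↣)
open import Level using (0ℓ)
open import Relation.Binary.Definitions as B using (DecidableEquality; tri<; tri≈; tri>)
import Relation.Binary.PropositionalEquality as ≡
open import Relation.Binary.PropositionalEquality using (_≡_; _≢_; _≗_)
open import Relation.Nullary using (Dec; ¬_; does; yes; no; contradiction; recompute)
open import Relation.Nullary.Decidable using (map′; _⊎-dec_; _×-dec_; ¬?; dec-true; dec-false)
open import Relation.Unary using (Pred; Decidable; _⊆_)
open import Defs

-- The state sum `Z` carries initial red degrees `d`, because the induction needs it for a forest
-- some of whose vertices are already covered. Making an edge red raises `d` at its ends, and the
-- matrix follows by deleting the two vertices: `local 1`, which is 1, is the diagonal entry of a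
-- deleted row. If an end was covered before, the term is lost on both sides: the entry M_vw is
-- already zero, and `local` vanishes from 2 on. Independence of the enumeration comes from the fact
-- that M_vw and M_wv are `t` and -1 in some order and that only their product enters.
--
-- On the cohomological side `dimSH` is the size of one basis found by a search, so all that is
-- known of it is that a basis of this size exists. It is compared with the ranks through uniqueness
-- of dimension. Chains, cocycles and coboundaries are predicates on one space of formal sums, and a
-- basis of U/W is given by representatives in U, so that no quotient is formed.

-- Determinants

-- dual i k is the position of i in the complement of punchIn i k.
dual : ∀ {n} → Fin (2 ℕ.+ n) → Fin (1 ℕ.+ n) → Fin (1 ℕ.+ n)
dual         zero    k       = zero
dual         (suc i) zero    = i
dual {suc n} (suc i) (suc k) = suc (dual i k)

punchIn-dual : ∀ {n} (i : Fin (2 ℕ.+ n)) k → punchIn (punchIn i k) (dual i k) ≡ i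
punchIn-dual         zero    k       = ≡.refl
punchIn-dual         (suc i) zero    = ≡.refl
punchIn-dual {suc n} (suc i) (suc k) = ≡.cong suc (punchIn-dual i k)

-- The simplicial identity: both sides enumerate the complement of the indices `i` and
-- `punchIn i k`, removed in opposite orders.
punchIn-comm : ∀ {n} (i : Fin (2 ℕ.+ n)) k r →
               punchIn (punchIn i k) (punchIn (dual i k) r) ≡ punchIn i (punchIn k r)
punchIn-comm         zero    k       r       = ≡.refl
punchIn-comm         (suc i) zero    r       = ≡.refl
punchIn-comm {suc n} (suc i) (suc k) zero    = ≡.refl
punchIn-comm {suc n} (suc i) (suc k) (suc r) = ≡.cong suc (punchIn-comm i k r)

module LaplaceExpansion {c ℓ} (R : CommutativeRing c ℓ) where
  open CommutativeRing R hiding (zero)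
  open RingProperties ring using (-1*x≈-x; -‿involutive)
  open Exp semiring using (_^_; ^-homo-*)
  open SemiringSum semiring
  open Determinant rawRing using (minor) renaming (det to detᴿ)
  open import Relation.Binary.Reasoning.Setoid setoid
  open SemiringSolver commutativeSemiring using (solve; _:=_; _:*_)

  sign : ℕ → Carrier
  sign n = (- 1#) ^ n

  sign-+ : ∀ m n → sign (m ℕ.+ n) ≈ sign m * sign n
  sign-+ = ^-homo-* (- 1#)

  sign-2+ : ∀ n → sign (2 ℕ.+ n) ≈ sign n
  sign-2+ n = begin
    - 1# * (- 1# * sign n) ≈⟨ trans (-1*x≈-x _) (-‿cong (-1*x≈-x _)) ⟩
    - (- sign n)           ≈⟨ -‿involutive _ ⟩
    sign n                 ∎

  sign-n+n : ∀ n → sign (n ℕ.+ n) ≈ 1#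
  sign-n+n zero    = refl
  sign-n+n (suc n) = begin
    sign (suc n ℕ.+ suc n)     ≡⟨ ≡.cong (λ k → sign (suc k)) (ℕ.+-suc n n) ⟩
    sign (2 ℕ.+ (n ℕ.+ n))     ≈⟨ sign-2+ (n ℕ.+ n) ⟩
    sign (n ℕ.+ n)             ≈⟨ sign-n+n n ⟩
    1#                         ∎

  -- Of two indices, removing the smaller one first lowers the position of the larger one by 1, and
  -- the other order lowers nothing. The two orders of removal therefore give sums of positions of
  -- opposite parity.
  sign-dual : ∀ {n} (i : Fin (2 ℕ.+ n)) k →
              sign (toℕ (punchIn i k) ℕ.+ toℕ (dual i k)) ≈ sign (suc (toℕ i ℕ.+ toℕ k))
  sign-dual zero k = reflexive (≡.cong (λ m → sign (suc m)) (ℕ.+-identityʳ (toℕ k)))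
  sign-dual (suc i) zero = begin
    sign (toℕ i)                       ≈⟨ sign-2+ (toℕ i) ⟨
    sign (2 ℕ.+ toℕ i)                 ≡⟨ ≡.cong (λ m → sign (2 ℕ.+ m)) (ℕ.+-identityʳ (toℕ i)) ⟨
    sign (suc (suc (toℕ i ℕ.+ 0)))     ∎
  sign-dual {suc n} (suc i) (suc k) = begin
    sign (suc (a ℕ.+ suc b))               ≡⟨ ≡.cong (λ m → sign (suc m)) (ℕ.+-suc a b) ⟩
    sign (2 ℕ.+ (a ℕ.+ b))                 ≈⟨ sign-2+ (a ℕ.+ b) ⟩
    sign (a ℕ.+ b)                         ≈⟨ sign-dual i k ⟩
    sign (suc (toℕ i ℕ.+ toℕ k))           ≈⟨ sign-2+ (suc (toℕ i ℕ.+ toℕ k)) ⟨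
    sign (3 ℕ.+ (toℕ i ℕ.+ toℕ k))         ≡⟨ ≡.cong (λ m → sign (2 ℕ.+ m)) (ℕ.+-suc (toℕ i) (toℕ k)) ⟨
    sign (suc (suc (toℕ i ℕ.+ suc (toℕ k)))) ∎
    where
    a = toℕ (punchIn i k)
    b = toℕ (dual i k)

  -- Opaque, so that the summand can be inferred by unification.
  opaque
    ∑ : ∀ {n} → (Fin n → Carrier) → Carrier
    ∑ = sum

    det-suc : ∀ {n} (M : Matrix Carrier (suc n)) →
              detᴿ M ≈ ∑ λ j → sign (toℕ j) * (M zero j * detᴿ (minor M j))
    det-suc M = refl

    ∑-suc : ∀ {n} (f : Fin (suc n) → Carrier) → ∑ f ≈ f zero + ∑ (λ i → f (suc i))
    ∑-suc f = refl

    ∑-cong : ∀ {n} {f g : Fin n → Carrier} → (∀ i → f i ≈ g i) → ∑ f ≈ ∑ g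
    ∑-cong = sum-cong-≋

    *-distribˡ-∑ : ∀ {n} x (f : Fin n → Carrier) → x * ∑ f ≈ ∑ (λ i → x * f i)
    *-distribˡ-∑ = *-distribˡ-sum

    ∑-swap : ∀ {m n} (f : Fin m → Fin n → Carrier) →
             ∑ (λ i → ∑ λ j → f i j) ≈ ∑ (λ j → ∑ λ i → f i j)
    ∑-swap = ∑-comm

    ∑-zero : ∀ {n} (f : Fin n → Carrier) → (∀ i → f i ≈ 0#) → ∑ f ≈ 0#
    ∑-zero {n} f f≈0 = trans (sum-cong-≋ f≈0) (sum-replicate-zero n)

    ∑-punch : ∀ {n} (f : Fin (suc n) → Carrier) i → ∑ f ≈ f i + ∑ (λ k → f (punchIn i k))
    ∑-punch f i = sum-remove {i = i} f

  ∑-single : ∀ {n} (f : Fin n → Carrier) i → (∀ j → j ≢ i → f j ≈ 0#) → ∑ f ≈ f i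
  ∑-single {suc n} f i f≈0 = begin
    ∑ f                               ≈⟨ ∑-punch f i ⟩
    f i + ∑ (λ k → f (punchIn i k))   ≈⟨ +-congˡ (∑-zero _ λ k → f≈0 _ (Fin.punchInᵢ≢i i k)) ⟩
    f i + 0#                          ≈⟨ +-identityʳ _ ⟩
    f i                               ∎

  minorAt : ∀ {n} → Matrix Carrier (suc n) → Fin (suc n) → Fin (suc n) → Matrix Carrier n
  minorAt M i j r k = M (punchIn i r) (punchIn j k)

  det-cong : ∀ {n} {M N : Matrix Carrier n} → (∀ i j → M i j ≈ N i j) → detᴿ M ≈ detᴿ N
  det-cong {zero}  eq = refl
  det-cong {suc n} {M} {N} eq = begin
    detᴿ M ≈⟨ det-suc M ⟩
    ∑ (λ j → sign (toℕ j) * (M zero j * detᴿ (minor M j)))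
      ≈⟨ ∑-cong (λ j → *-congˡ (*-cong (eq zero j) (det-cong λ r k → eq (suc r) (punchIn j k)))) ⟩
    ∑ (λ j → sign (toℕ j) * (N zero j * detᴿ (minor N j))) ≈⟨ det-suc N ⟨
    detᴿ N ∎

  -- The corner entry gives the same term in both expansions. The other minors are expanded once
  -- more, those of the first row along the first column by induction, those of the first column
  -- along the first row by definition. This yields the same double sum in two orders of summation.
  det-column₀ : ∀ {n} (M : Matrix Carrier (suc n)) →
                detᴿ M ≈ ∑ λ i → sign (toℕ i) * (M i zero * detᴿ (minorAt M i zero))
  det-column₀ {zero}  M = trans (det-suc M) (∑-cong λ { zero → refl })
  det-column₀ {suc n} M = trans (trans (det-suc M) (∑-suc _)) (trans (+-congˡ (begin
    ∑ (λ j → sign (suc (toℕ j)) * (a j * detᴿ (minor M (suc j))))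
      ≈⟨ ∑-cong (λ j → trans
           (*-congˡ (*-congˡ {a j} (det-column₀ (minor M (suc j)))))
           (expand (sign (suc (toℕ j))) (a j) _)) ⟩
    ∑ (λ j → ∑ λ i → sign (suc (toℕ j)) * (a j * (sign (toℕ i) * (b i * m i j))))
      ≈⟨ ∑-swap (λ j i → sign (suc (toℕ j)) * (a j * (sign (toℕ i) * (b i * m i j)))) ⟩
    ∑ (λ i → ∑ λ j → sign (suc (toℕ j)) * (a j * (sign (toℕ i) * (b i * m i j))))
      ≈⟨ ∑-cong (λ i → ∑-cong λ j → solve 6
           (λ u s a s′ b m → (u :* s) :* (a :* (s′ :* (b :* m))) := (u :* s′) :* (b :* (s :* (a :* m))))
           refl (- 1#) (sign (toℕ j)) (a j) (sign (toℕ i)) (b i) (m i j)) ⟩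
    ∑ (λ i → ∑ λ j → sign (suc (toℕ i)) * (b i * (sign (toℕ j) * (a j * m i j))))
      ≈⟨ ∑-cong (λ i → trans
           (*-congˡ (*-congˡ {b i} (det-suc (minorAt M (suc i) zero))))
           (expand (sign (suc (toℕ i))) (b i) _)) ⟨
    ∑ (λ i → sign (suc (toℕ i)) * (b i * detᴿ (minorAt M (suc i) zero))) ∎)) (sym (∑-suc _)))
    where
    a = λ j → M zero (suc j)
    b = λ i → M (suc i) zero
    m = λ i j → detᴿ λ r k → M (suc (punchIn i r)) (suc (punchIn j k))
    expand : ∀ {k} x y (f : Fin k → Carrier) → x * (y * ∑ f) ≈ ∑ (λ i → x * (y * f i))
    expand x y f = trans (*-congˡ (*-distribˡ-∑ y f)) (*-distribˡ-∑ x _)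

  -- The defining expansion of the determinant of `M ᵀ` is the expansion of `M` along its first
  -- column.
  det-ᵀ : ∀ {n} (M : Matrix Carrier n) → detᴿ (M ᵀ) ≈ detᴿ M
  det-ᵀ {zero}  M = refl
  det-ᵀ {suc n} M = begin
    detᴿ (M ᵀ) ≈⟨ det-suc (M ᵀ) ⟩
    ∑ (λ j → sign (toℕ j) * (M j zero * detᴿ (minorAt M j zero ᵀ)))
      ≈⟨ ∑-cong (λ j → *-congˡ (*-congˡ (det-ᵀ (minorAt M j zero)))) ⟩
    ∑ (λ j → sign (toℕ j) * (M j zero * detᴿ (minorAt M j zero))) ≈⟨ det-column₀ M ⟨
    detᴿ M ∎

  -- Expand along the first column. The term of row `i` is the first term of the claim. In every
  -- other minor row `i` survives at position `dual i k`; the minor is expanded along it by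
  -- induction, and the double sum is collected by columns. The signs agree by `sign-dual`.
  det-row : ∀ {n} (M : Matrix Carrier (suc n)) i →
            detᴿ M ≈ ∑ λ j → sign (toℕ i ℕ.+ toℕ j) * (M i j * detᴿ (minorAt M i j))
  det-row {zero}  M zero = det-suc M
  det-row {suc n} M i = begin
    detᴿ M ≈⟨ det-column₀ M ⟩
    ∑ (λ k → sign (toℕ k) * (M k zero * detᴿ (minorAt M k zero)))
      ≈⟨ ∑-punch _ i ⟩
    sign (toℕ i) * (M i zero * detᴿ (minorAt M i zero)) +
    ∑ (λ k → sign (toℕ (punchIn i k)) * (b k * detᴿ (minorAt M (punchIn i k) zero)))
      ≈⟨ +-cong (reflexive (≡.cong (λ x → sign x * (M i zero * detᴿ (minorAt M i zero)))
          (≡.sym (ℕ.+-identityʳ (toℕ i))))) rest ⟩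
    sign (toℕ i ℕ.+ 0) * (M i zero * detᴿ (minorAt M i zero)) +
    ∑ (λ j → sign (toℕ i ℕ.+ suc (toℕ j)) * (a j * detᴿ (minorAt M i (suc j)))) ≈⟨ ∑-suc _ ⟨
    ∑ (λ j → sign (toℕ i ℕ.+ toℕ j) * (M i j * detᴿ (minorAt M i j))) ∎
    where
    a = λ j → M i (suc j)
    b = λ k → M (punchIn i k) zero
    m = λ k j → detᴿ λ r q → M (punchIn i (punchIn k r)) (suc (punchIn j q))
    expand : ∀ {k} x y (f : Fin k → Carrier) → x * (y * ∑ f) ≈ ∑ (λ i → x * (y * f i))
    expand x y f = trans (*-congˡ (*-distribˡ-∑ y f)) (*-distribˡ-∑ x _)

    signs : ∀ k j → sign (toℕ (punchIn i k)) * sign (toℕ (dual i k) ℕ.+ toℕ j) ≈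
                    sign (toℕ i ℕ.+ suc (toℕ j)) * sign (toℕ k)
    signs k j = begin
      sign p * sign (d ℕ.+ toℕ j)               ≈⟨ *-congˡ (sign-+ d (toℕ j)) ⟩
      sign p * (sign d * sign (toℕ j))          ≈⟨ *-assoc _ _ _ ⟨
      sign p * sign d * sign (toℕ j)            ≈⟨ *-congʳ (sign-+ p d) ⟨
      sign (p ℕ.+ d) * sign (toℕ j)             ≈⟨ *-congʳ (sign-dual i k) ⟩
      - 1# * sign (toℕ i ℕ.+ toℕ k) * sign (toℕ j) ≈⟨ *-congʳ (*-congˡ (sign-+ (toℕ i) (toℕ k))) ⟩
      - 1# * (sign (toℕ i) * sign (toℕ k)) * sign (toℕ j)
        ≈⟨ solve 4 (λ u x y z → u :* (x :* y) :* z := x :* (u :* z) :* y) refl (- 1#) (sign (toℕ i))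
            (sign (toℕ k)) (sign (toℕ j)) ⟩
      sign (toℕ i) * (- 1# * sign (toℕ j)) * sign (toℕ k) ≈⟨ *-congʳ (sign-+ (toℕ i) (suc (toℕ j))) ⟨
      sign (toℕ i ℕ.+ suc (toℕ j)) * sign (toℕ k) ∎
      where
      p = toℕ (punchIn i k)
      d = toℕ (dual i k)

    rest = begin
      ∑ (λ k → sign (toℕ (punchIn i k)) * (b k * detᴿ (minorAt M (punchIn i k) zero)))
        ≈⟨ ∑-cong (λ k → trans
             (*-congˡ (*-congˡ {b k} (trans (det-row (minorAt M (punchIn i k) zero) (dual i k))
               (∑-cong λ j → *-congˡ {sign (toℕ (dual i k) ℕ.+ toℕ j)} (*-cong
                 (reflexive (≡.cong (λ x → M x (suc j)) (punchIn-dual i k)))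
                 (det-cong λ r q → reflexive (≡.cong (λ x → M x (suc (punchIn j q))) (punchIn-comm i k r))))))))
             (expand (sign (toℕ (punchIn i k))) (b k) _)) ⟩
      ∑ (λ k → ∑ λ j → sign (toℕ (punchIn i k)) * (b k * (sign (toℕ (dual i k) ℕ.+ toℕ j) * (a j * m k j))))
        ≈⟨ ∑-cong (λ k → ∑-cong λ j → trans
             (solve 5 (λ s b s′ a m → s :* (b :* (s′ :* (a :* m))) := (s :* s′) :* (b :* (a :* m)))
               refl (sign (toℕ (punchIn i k))) (b k) (sign (toℕ (dual i k) ℕ.+ toℕ j)) (a j) (m k j))
             (*-congʳ (signs k j))) ⟩
      ∑ (λ k → ∑ λ j → (sign (toℕ i ℕ.+ suc (toℕ j)) * sign (toℕ k)) * (b k * (a j * m k j)))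
        ≈⟨ ∑-swap (λ k j → (sign (toℕ i ℕ.+ suc (toℕ j)) * sign (toℕ k)) * (b k * (a j * m k j))) ⟩
      ∑ (λ j → ∑ λ k → (sign (toℕ i ℕ.+ suc (toℕ j)) * sign (toℕ k)) * (b k * (a j * m k j)))
        ≈⟨ ∑-cong (λ j → ∑-cong λ k → solve 5
             (λ s s′ b a m → (s :* s′) :* (b :* (a :* m)) := s :* (a :* (s′ :* (b :* m))))
             refl (sign (toℕ i ℕ.+ suc (toℕ j))) (sign (toℕ k)) (b k) (a j) (m k j)) ⟩
      ∑ (λ j → ∑ λ k → sign (toℕ i ℕ.+ suc (toℕ j)) * (a j * (sign (toℕ k) * (b k * m k j))))
        ≈⟨ ∑-cong (λ j → trans
             (*-congˡ (*-congˡ {a j} (det-column₀ (minorAt M i (suc j)))))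
             (expand (sign (toℕ i ℕ.+ suc (toℕ j))) (a j) _)) ⟨
      ∑ (λ j → sign (toℕ i ℕ.+ suc (toℕ j)) * (a j * detᴿ (minorAt M i (suc j)))) ∎

  det-column : ∀ {n} (M : Matrix Carrier (suc n)) j →
               detᴿ M ≈ ∑ λ i → sign (toℕ i ℕ.+ toℕ j) * (M i j * detᴿ (minorAt M i j))
  det-column M j = begin
    detᴿ M     ≈⟨ det-ᵀ M ⟨
    detᴿ (M ᵀ) ≈⟨ det-row (M ᵀ) j ⟩
    ∑ (λ i → sign (toℕ j ℕ.+ toℕ i) * (M i j * detᴿ (minorAt (M ᵀ) j i)))
      ≈⟨ ∑-cong (λ i → *-cong (reflexive (≡.cong sign (ℕ.+-comm (toℕ j) (toℕ i))))
          (*-congˡ (det-ᵀ (minorAt M i j)))) ⟩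
    ∑ (λ i → sign (toℕ i ℕ.+ toℕ j) * (M i j * detᴿ (minorAt M i j))) ∎

  private
    zeroEntry : ∀ s {x} y → x ≈ 0# → s * (x * y) ≈ 0#
    zeroEntry s y x≈0 = trans (*-congˡ (trans (*-congʳ x≈0) (zeroˡ y))) (zeroʳ s)

    diagonalSign : ∀ {n} (i : Fin n) x → sign (toℕ i ℕ.+ toℕ i) * x ≈ x
    diagonalSign i x = trans (*-congʳ (sign-n+n (toℕ i))) (*-identityˡ x)

  det-diagonalRow : ∀ {n} (M : Matrix Carrier (suc n)) i → (∀ j → j ≢ i → M i j ≈ 0#) →
                    detᴿ M ≈ M i i * detᴿ (minorAt M i i)
  det-diagonalRow M i M≈0 = begin
    detᴿ M ≈⟨ det-row M i ⟩
    ∑ (λ j → sign (toℕ i ℕ.+ toℕ j) * (M i j * detᴿ (minorAt M i j)))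
      ≈⟨ ∑-single _ i (λ j j≢i → zeroEntry _ _ (M≈0 j j≢i)) ⟩
    sign (toℕ i ℕ.+ toℕ i) * (M i i * detᴿ (minorAt M i i)) ≈⟨ diagonalSign i _ ⟩
    M i i * detᴿ (minorAt M i i) ∎

  -- Row `v` contributes only its entries at `v` and `w`. In the minor at (v, w) the old column `v`
  -- has become column `dual v w′`, and its only possibly nonzero entry is `M w v`. The two signs
  -- multiply to -1, since the same two indices are removed in opposite orders.
  det-pendant-punchIn : ∀ {n} (M : Matrix Carrier (2 ℕ.+ n)) v w′ → let w = punchIn v w′ in
    (∀ j → j ≢ v → j ≢ w → M v j ≈ 0#) → (∀ i → i ≢ v → i ≢ w → M i v ≈ 0#) →
    detᴿ M ≈ M v v * detᴿ (minorAt M v v) + (- (M v w * M w v)) * detᴿ (minorAt (minorAt M v v) w′ w′)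
  det-pendant-punchIn M v w′ row column = begin
    detᴿ M ≈⟨ det-row M v ⟩
    ∑ F ≈⟨ ∑-punch F v ⟩
    F v + ∑ (λ k → F (punchIn v k))
      ≈⟨ +-cong (diagonalSign v _) (∑-single _ w′ λ k k≢w′ →
           zeroEntry _ _ (row _ (Fin.punchInᵢ≢i v k) (λ eq → k≢w′ (Fin.punchIn-injective v k w′ eq)))) ⟩
    M v v * detᴿ (minorAt M v v) + F w ≈⟨ +-congˡ off-diagonal ⟩
    M v v * detᴿ (minorAt M v v) + (- (M v w * M w v)) * X ∎
    where
    w = punchIn v w′
    v′ = dual v w′
    X = detᴿ (minorAt (minorAt M v v) w′ w′)
    F = λ j → sign (toℕ v ℕ.+ toℕ j) * (M v j * detᴿ (minorAt M v j))
    N = minorAt M v w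

    signs : sign (toℕ v ℕ.+ toℕ w) * sign (toℕ w′ ℕ.+ toℕ v′) ≈ - 1#
    signs = begin
      sign (toℕ v ℕ.+ toℕ w) * sign (toℕ w′ ℕ.+ toℕ v′)
        ≈⟨ *-cong (sign-+ (toℕ v) (toℕ w)) (sign-+ (toℕ w′) (toℕ v′)) ⟩
      (sign (toℕ v) * sign (toℕ w)) * (sign (toℕ w′) * sign (toℕ v′))
        ≈⟨ solve 4 (λ a b c d → (a :* b) :* (c :* d) := (b :* d) :* (a :* c)) refl (sign (toℕ v))
            (sign (toℕ w)) (sign (toℕ w′)) (sign (toℕ v′)) ⟩
      (sign (toℕ w) * sign (toℕ v′)) * (sign (toℕ v) * sign (toℕ w′))
        ≈⟨ *-cong (sym (sign-+ (toℕ w) (toℕ v′))) (sym (sign-+ (toℕ v) (toℕ w′))) ⟩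
      sign (toℕ w ℕ.+ toℕ v′) * sign (toℕ v ℕ.+ toℕ w′) ≈⟨ *-congʳ (sign-dual v w′) ⟩
      - 1# * sign (toℕ v ℕ.+ toℕ w′) * sign (toℕ v ℕ.+ toℕ w′) ≈⟨ *-assoc _ _ _ ⟩
      - 1# * (sign (toℕ v ℕ.+ toℕ w′) * sign (toℕ v ℕ.+ toℕ w′))
        ≈⟨ *-congˡ (trans (sym (sign-+ (toℕ v ℕ.+ toℕ w′) _)) (sign-n+n (toℕ v ℕ.+ toℕ w′))) ⟩
      - 1# * 1# ≈⟨ *-identityʳ _ ⟩
      - 1# ∎

    det-N : detᴿ N ≈ sign (toℕ w′ ℕ.+ toℕ v′) * (M w v * X)
    det-N = begin
      detᴿ N ≈⟨ det-column N v′ ⟩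
      ∑ (λ i → sign (toℕ i ℕ.+ toℕ v′) * (N i v′ * detᴿ (minorAt N i v′)))
        ≈⟨ ∑-single _ w′ (λ i i≢w′ → zeroEntry _ _ (trans
             (reflexive (≡.cong (M (punchIn v i)) (punchIn-dual v w′)))
             (column _ (Fin.punchInᵢ≢i v i) (λ eq → i≢w′ (Fin.punchIn-injective v i w′ eq))))) ⟩
      sign (toℕ w′ ℕ.+ toℕ v′) * (N w′ v′ * detᴿ (minorAt N w′ v′))
        ≈⟨ *-congˡ (*-cong
             (reflexive (≡.cong (M w) (punchIn-dual v w′)))
             (det-cong λ r k → reflexive (≡.cong (M (punchIn v (punchIn w′ r))) (punchIn-comm v w′ k)))) ⟩
      sign (toℕ w′ ℕ.+ toℕ v′) * (M w v * X) ∎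

    off-diagonal : F w ≈ (- (M v w * M w v)) * X
    off-diagonal = begin
      sign (toℕ v ℕ.+ toℕ w) * (M v w * detᴿ N) ≈⟨ *-congˡ (*-congˡ det-N) ⟩
      sign (toℕ v ℕ.+ toℕ w) * (M v w * (sign (toℕ w′ ℕ.+ toℕ v′) * (M w v * X)))
        ≈⟨ solve 5 (λ s a s′ b x → s :* (a :* (s′ :* (b :* x))) := (s :* s′) :* (a :* b) :* x) refl
            (sign (toℕ v ℕ.+ toℕ w)) (M v w) (sign (toℕ w′ ℕ.+ toℕ v′)) (M w v) X ⟩
      sign (toℕ v ℕ.+ toℕ w) * sign (toℕ w′ ℕ.+ toℕ v′) * (M v w * M w v) * X
        ≈⟨ *-congʳ (trans (*-congʳ signs) (-1*x≈-x _)) ⟩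
      (- (M v w * M w v)) * X ∎

  -- The `xor` spares the diagonal entry at `v`, so `detach v M` is the direct sum of that entry and
  -- the minor; in `delete v M` the entry becomes 1 as well. Both keep the size of the matrix.
  detach delete : ∀ {n} → Fin n → Matrix Carrier n → Matrix Carrier n
  detach v M i j = if does (i Fin.≟ v) xor does (j Fin.≟ v) then 0# else M i j
  delete v M i j =
    if does (i Fin.≟ v) ∨ does (j Fin.≟ v) then (if does (i Fin.≟ j) then 1# else 0#) else M i j

  det-detach : ∀ {n} (M : Matrix Carrier (suc n)) v → detᴿ (detach v M) ≈ M v v * detᴿ (minorAt M v v)
  det-detach M v = begin
    detᴿ (detach v M) ≈⟨ det-diagonalRow (detach v M) v off ⟩
    detach v M v v * detᴿ (minorAt (detach v M) v v) ≈⟨ *-cong diagonal (det-cong rest) ⟩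
    M v v * detᴿ (minorAt M v v) ∎
    where
    diagonal : detach v M v v ≈ M v v
    diagonal with v Fin.≟ v
    ... | yes _  = refl
    ... | no v≢v = contradiction ≡.refl v≢v
    off : ∀ j → j ≢ v → detach v M v j ≈ 0#
    off j j≢v with v Fin.≟ v | j Fin.≟ v
    ... | no v≢v | _       = contradiction ≡.refl v≢v
    ... | yes _  | yes j≡v = contradiction j≡v j≢v
    ... | yes _  | no _    = refl
    rest : ∀ r k → minorAt (detach v M) v v r k ≈ minorAt M v v r k
    rest r k with punchIn v r Fin.≟ v | punchIn v k Fin.≟ v
    ... | yes eq | _      = contradiction eq (Fin.punchInᵢ≢i v r)
    ... | no _   | yes eq = contradiction eq (Fin.punchInᵢ≢i v k)
    ... | no _   | no _   = refl

  det-delete : ∀ {n} (M : Matrix Carrier (suc n)) v → detᴿ (delete v M) ≈ detᴿ (minorAt M v v)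
  det-delete M v = begin
    detᴿ (delete v M) ≈⟨ det-diagonalRow (delete v M) v off ⟩
    delete v M v v * detᴿ (minorAt (delete v M) v v) ≈⟨ *-cong diagonal (det-cong rest) ⟩
    1# * detᴿ (minorAt M v v) ≈⟨ *-identityˡ _ ⟩
    detᴿ (minorAt M v v) ∎
    where
    diagonal : delete v M v v ≈ 1#
    diagonal with v Fin.≟ v
    ... | yes _  = refl
    ... | no v≢v = contradiction ≡.refl v≢v
    off : ∀ j → j ≢ v → delete v M v j ≈ 0#
    off j j≢v with v Fin.≟ v | v Fin.≟ j
    ... | no v≢v | _       = contradiction ≡.refl v≢v
    ... | yes _  | yes v≡j = contradiction (≡.sym v≡j) j≢v
    ... | yes _  | no _    = refl
    rest : ∀ r k → minorAt (delete v M) v v r k ≈ minorAt M v v r k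
    rest r k with punchIn v r Fin.≟ v | punchIn v k Fin.≟ v
    ... | yes eq | _      = contradiction eq (Fin.punchInᵢ≢i v r)
    ... | no _   | yes eq = contradiction eq (Fin.punchInᵢ≢i v k)
    ... | no _   | no _   = refl

  private
    -- After row and column `w` are removed, the unit row of `v` sits at position `dual v w′`.
    -- Removing it leaves the minor for the order w, v, which `punchIn-comm` identifies with the one
    -- for the order v, w′.
    deleted : ∀ {n} (M : Matrix Carrier (2 ℕ.+ n)) v w′ →
              detᴿ (delete (punchIn v w′) (delete v M)) ≈ detᴿ (minorAt (minorAt M v v) w′ w′)
    deleted M v w′ = begin
      detᴿ (delete w (delete v M)) ≈⟨ det-delete (delete v M) w ⟩
      detᴿ (minorAt (delete v M) w w) ≈⟨ det-diagonalRow (minorAt (delete v M) w w) v′ off ⟩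
      minorAt (delete v M) w w v′ v′ * detᴿ (minorAt (minorAt (delete v M) w w) v′ v′)
        ≈⟨ *-cong diagonal (det-cong rest) ⟩
      1# * detᴿ (minorAt (minorAt M v v) w′ w′) ≈⟨ *-identityˡ _ ⟩
      detᴿ (minorAt (minorAt M v v) w′ w′) ∎
      where
      w = punchIn v w′
      v′ = dual v w′
      diagonal : minorAt (delete v M) w w v′ v′ ≈ 1#
      diagonal rewrite punchIn-dual v w′ with v Fin.≟ v
      ... | yes _  = refl
      ... | no v≢v = contradiction ≡.refl v≢v
      off : ∀ j → j ≢ v′ → minorAt (delete v M) w w v′ j ≈ 0#
      off j j≢v′ with punchIn w v′ Fin.≟ v | punchIn w v′ Fin.≟ punchIn w j
      ... | no ≢v | _      = contradiction (punchIn-dual v w′) ≢v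
      ... | yes _ | yes eq = contradiction (≡.sym (Fin.punchIn-injective w v′ j eq)) j≢v′
      ... | yes _ | no _   = refl
      rest : ∀ r k → minorAt (minorAt (delete v M) w w) v′ v′ r k ≈ minorAt (minorAt M v v) w′ w′ r k
      rest r k rewrite punchIn-comm v w′ r | punchIn-comm v w′ k
        with punchIn v (punchIn w′ r) Fin.≟ v | punchIn v (punchIn w′ k) Fin.≟ v
      ... | yes eq | _      = contradiction eq (Fin.punchInᵢ≢i v (punchIn w′ r))
      ... | no _   | yes eq = contradiction eq (Fin.punchInᵢ≢i v (punchIn w′ k))
      ... | no _   | no _   = refl

  det-pendant : ∀ {n} (M : Matrix Carrier n) {v w} → v ≢ w →
    (∀ j → j ≢ v → j ≢ w → M v j ≈ 0#) → (∀ i → i ≢ v → i ≢ w → M i v ≈ 0#) →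
    detᴿ M ≈ detᴿ (detach v M) + (- (M v w * M w v)) * detᴿ (delete w (delete v M))
  det-pendant {suc zero} M {zero} {zero} v≢w = contradiction ≡.refl v≢w
  det-pendant {suc (suc n)} M {v} {w} v≢w
    with w′ ← punchOut v≢w | ≡.refl ← Fin.punchIn-punchOut v≢w = λ row column → begin
    detᴿ M ≈⟨ det-pendant-punchIn M v w′ row column ⟩
    M v v * detᴿ (minorAt M v v) + (- (M v w * M w v)) * detᴿ (minorAt (minorAt M v v) w′ w′)
      ≈⟨ +-cong (det-detach M v) (*-congˡ (deleted M v w′)) ⟨
    detᴿ (detach v M) + (- (M v w * M w v)) * detᴿ (delete w (delete v M)) ∎

-- State sums over subsets of edges

Incident : ∀ {n} → Fin n → Fin n × Fin n → Set
Incident v (a , b) = v ≡ a ⊎ v ≡ b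

incident? : ∀ {n} (v : Fin n) e → Dec (Incident v e)
incident? v (a , b) = (v Fin.≟ a) ⊎-dec (v Fin.≟ b)

Joined : ∀ {n} → List (Fin n × Fin n) → Fin n → Fin n → Set
Joined es v w = (v , w) ∈ es ⊎ (w , v) ∈ es

-- A forest is emptied by repeatedly removing the edge at a leaf v.
data Peelable {n} : List (Fin n × Fin n) → Set where
  []   : Peelable []
  peel : ∀ {es es′ v w} → v ≢ w → es ↭ (v , w) ∷ es′ ⊎ es ↭ (w , v) ∷ es′ →
         All (λ e → ¬ Incident v e) es′ → Peelable es′ → Peelable es

mapEnds : ∀ {m n} → (Fin m → Fin n) → Fin m × Fin m → Fin n × Fin n
mapEnds f (a , b) = f a , f b

Peelable-map : ∀ {m n} {f : Fin m → Fin n} → Injective _≡_ _≡_ f →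
               ∀ {es} → Peelable es → Peelable (List.map (mapEnds f) es)
Peelable-map inj [] = []
Peelable-map inj (peel v≢w es↭ free p) = peel
  (v≢w ∘ inj)
  (Sum.map (↭ₚ.map⁺ _) (↭ₚ.map⁺ _) es↭)
  (Allₚ.map⁺ (All.map (λ ∉e → ∉e ∘ Sum.map inj inj) free))
  (Peelable-map inj p)

-- Here `d` counts the red edges at each vertex; the new count is the one after `e` has become red.
bump : ∀ {n} → Fin n × Fin n → (Fin n → ℕ) → Fin n → ℕ
bump e d v = if does (incident? v e) then suc (d v) else d v

bump-incident : ∀ {n} {e} (d : Fin n → ℕ) {v} → Incident v e → bump e d v ≡ suc (d v)
bump-incident {e = e} d {v} v∈e rewrite dec-true (incident? v e) v∈e = ≡.refl

bump-free : ∀ {n} {e} (d : Fin n → ℕ) {v} → ¬ Incident v e → bump e d v ≡ d v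
bump-free {e = e} d {v} v∉e rewrite dec-false (incident? v e) v∉e = ≡.refl

bump-cong : ∀ {n} {e} {d d′ : Fin n → ℕ} → d ≗ d′ → bump e d ≗ bump e d′
bump-cong {e = e} d≗d′ v with does (incident? v e)
... | true  = ≡.cong suc (d≗d′ v)
... | false = d≗d′ v

bump-comm : ∀ {n} e e′ (d : Fin n → ℕ) → bump e (bump e′ d) ≗ bump e′ (bump e d)
bump-comm e e′ d v with does (incident? v e) | does (incident? v e′)
... | true  | true  = ≡.refl
... | true  | false = ≡.refl
... | false | true  = ≡.refl
... | false | false = ≡.refl

bump-swap : ∀ {n} a b (d : Fin n → ℕ) → bump (a , b) d ≗ bump (b , a) d
bump-swap a b d v with does (v Fin.≟ a) | does (v Fin.≟ b)
... | true  | true  = ≡.refl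
... | true  | false = ≡.refl
... | false | true  = ≡.refl
... | false | false = ≡.refl

bump-increasing : ∀ {n} e (d : Fin n → ℕ) v → d v ≤ bump e d v
bump-increasing e d v with does (incident? v e)
... | true  = ℕ.n≤1+n (d v)
... | false = ℕ.≤-refl

bump-map : ∀ {m n} {f : Fin m → Fin n} → Injective _≡_ _≡_ f → ∀ e (d : Fin n → ℕ) v →
           bump (mapEnds f e) d (f v) ≡ bump e (d ∘ f) v
bump-map {f = f} inj e d v with incident? v e
... | yes v∈e = ≡.trans (bump-incident d (Sum.map (≡.cong f) (≡.cong f) v∈e))
    (≡.sym (bump-incident (d ∘ f) v∈e))
... | no  v∉e = ≡.trans (bump-free d (v∉e ∘ Sum.map inj inj)) (≡.sym (bump-free (d ∘ f) v∉e))

module MatchingSum {c ℓ} (R : CommutativeRing c ℓ) (t : CommutativeRing.Carrier R) where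
  open CommutativeRing R hiding (zero)
  open RingProperties ring using (-‿involutive; -0#≈0#)
  open LaplaceExpansion R
  open Determinant rawRing using () renaming (det to detᴿ)
  open MonoidSum *-commutativeMonoid
  open import Relation.Binary.Reasoning.Setoid setoid
  open SemiringSolver commutativeSemiring using (solve; _:=_; _:*_; _:+_)

  opaque
    ∏ : ∀ {n} → (Fin n → Carrier) → Carrier
    ∏ = sum

    ∏-empty : (f : Fin 0 → Carrier) → ∏ f ≈ 1#
    ∏-empty f = refl

    ∏-suc : ∀ {n} (f : Fin (suc n) → Carrier) → ∏ f ≈ f zero * ∏ (f ∘ suc)
    ∏-suc f = refl

    ∏-cong : ∀ {n} {f g : Fin n → Carrier} → (∀ i → f i ≈ g i) → ∏ f ≈ ∏ g
    ∏-cong = sum-cong-≋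

    ∏-permute : ∀ {n} (f : Fin n → Carrier) (σ : Permutation′ n) → ∏ f ≈ ∏ (λ i → f (σ ⟨$⟩ʳ i))
    ∏-permute = sum-permute

  ∏-zero : ∀ {n} (f : Fin n → Carrier) i → f i ≈ 0# → ∏ f ≈ 0#
  ∏-zero f zero    f≈0 = trans (∏-suc f) (trans (*-congʳ f≈0) (zeroˡ _))
  ∏-zero f (suc i) f≈0 = trans (∏-suc f) (trans (*-congˡ (∏-zero (f ∘ suc) i f≈0)) (zeroʳ _))

  -- The contribution of a vertex in terms of its red degree: an uncovered vertex carries + or −.
  local : ℕ → Carrier
  local 0             = 1# - t
  local 1             = 1#
  local (suc (suc _)) = 0#

  -- The sum of t^|r| ∏ᵥ local (d v + degree of v in r) over all r ⊆ es
  Z : ∀ {n} → List (Fin n × Fin n) → (Fin n → ℕ) → Carrier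
  Z []       d = ∏ (λ v → local (d v))
  Z (e ∷ es) d = Z es d + t * Z es (bump e d)

  Z-cong : ∀ {n} es {d d′ : Fin n → ℕ} → d ≗ d′ → Z es d ≈ Z es d′
  Z-cong []       d≗d′ = ∏-cong λ v → reflexive (≡.cong local (d≗d′ v))
  Z-cong (e ∷ es) d≗d′ = +-cong (Z-cong es d≗d′) (*-congˡ (Z-cong es (bump-cong d≗d′)))

  Z-↭ : ∀ {n} {es es′ : List (Fin n × Fin n)} → es ↭ es′ → ∀ d → Z es d ≈ Z es′ d
  Z-↭ ↭.refl            d = refl
  Z-↭ (↭.prep e p)      d = +-cong (Z-↭ p d) (*-congˡ (Z-↭ p (bump e d)))
  Z-↭ (↭.trans p q)     d = trans (Z-↭ p d) (Z-↭ q d)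
  Z-↭ {es = e ∷ e′ ∷ es} {_ ∷ _ ∷ es′} (↭.swap e e′ p) d = begin
    (Z es d + t * Z es (bump e′ d)) + t * (Z es (bump e d) + t * Z es (bump e′ (bump e d)))
      ≈⟨ solve 5 (λ t a b c x → (a :+ t :* b) :+ t :* (c :+ t :* x) := (a :+ t :* c) :+ t :* (b :+ t :* x))
           refl t (Z es d) (Z es (bump e′ d)) (Z es (bump e d)) (Z es (bump e′ (bump e d))) ⟩
    (Z es d + t * Z es (bump e d)) + t * (Z es (bump e′ d) + t * Z es (bump e′ (bump e d)))
      ≈⟨ +-cong (+-cong (Z-↭ p _) (*-congˡ (Z-↭ p _)))
           (*-congˡ (+-cong (Z-↭ p _) (*-congˡ (trans (Z-cong es (bump-comm e′ e d)) (Z-↭ p _))))) ⟩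
    (Z es′ d + t * Z es′ (bump e d)) + t * (Z es′ (bump e′ d) + t * Z es′ (bump e (bump e′ d))) ∎

  -- Red degrees only grow along the recursion, so every vertex product at its end contains a
  -- vanishing factor `local (d v)`.
  Z-saturated : ∀ {n} es (d : Fin n → ℕ) v → 2 ≤ d v → Z es d ≈ 0#
  Z-saturated [] d v 2≤d = ∏-zero _ v (vanish 2≤d)
    where
    vanish : ∀ {k} → 2 ≤ k → local k ≈ 0#
    vanish (s≤s (s≤s _)) = refl
  Z-saturated (e ∷ es) d v 2≤d = begin
    Z es d + t * Z es (bump e d)
      ≈⟨ +-cong (Z-saturated es d v 2≤d)
           (*-congˡ (Z-saturated es (bump e d) v (ℕ.≤-trans 2≤d (bump-increasing e d v)))) ⟩
    0# + t * 0# ≈⟨ trans (+-identityˡ _) (zeroʳ t) ⟩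
    0#          ∎

  -- Labels enter only through the final product over all vertices, which is invariant under
  -- permutation.
  Z-relabel : ∀ {n} (σ : Permutation′ n) es d →
              Z (List.map (mapEnds (σ ⟨$⟩ʳ_)) es) d ≈ Z es (λ v → d (σ ⟨$⟩ʳ v))
  Z-relabel σ []       d = ∏-permute _ σ
  Z-relabel σ (e ∷ es) d = +-cong (Z-relabel σ es d) (*-congˡ (trans
    (Z-relabel σ es _)
    (Z-cong es (bump-map (Injection.injective (↔⇒↣ σ)) e d))))

  det-diagonal : ∀ {n} {M : Matrix Carrier n} → (∀ {i j} → i ≢ j → M i j ≈ 0#) →
                 detᴿ M ≈ ∏ (λ i → M i i)
  det-diagonal {zero}      off = sym (∏-empty _)
  det-diagonal {suc n} {M} off = begin
    detᴿ M ≈⟨ det-diagonalRow M zero (λ j j≢0 → off (j≢0 ∘ ≡.sym)) ⟩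
    M zero zero * detᴿ (minorAt M zero zero)
      ≈⟨ *-congˡ (det-diagonal λ i≢j → off (i≢j ∘ Fin.suc-injective)) ⟩
    M zero zero * ∏ (λ i → M (suc i) (suc i)) ≈⟨ ∏-suc _ ⟨
    ∏ (λ i → M i i) ∎

  -- Vertices of positive degree have been deleted from the matrix.
  record Compatible {n} (M : Matrix Carrier n) (es : List (Fin n × Fin n)) (d : Fin n → ℕ) : Set ℓ where
    field
      diagonal : ∀ v → M v v ≈ local (d v)
      -- Only the product is prescribed: which of the two entries is `t` and which is -1 depends on
      -- the enumeration of the vertices.
      joined   : ∀ {v w} → Joined es v w → d v ≡ 0 → d w ≡ 0 → M v w * M w v ≈ - t
      separate : ∀ {v w} → v ≢ w → ¬ (Joined es v w × d v ≡ 0 × d w ≡ 0) → M v w ≈ 0#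
  open Compatible

  private
    module _ {n} (M : Matrix Carrier n) {v : Fin n} where
      detach-diagonal : ∀ i → detach v M i i ≡ M i i
      detach-diagonal i with does (i Fin.≟ v)
      ... | true  = ≡.refl
      ... | false = ≡.refl

      detach-other : ∀ {i j} → i ≢ v → j ≢ v → detach v M i j ≡ M i j
      detach-other {i} {j} i≢v j≢v
        rewrite dec-false (i Fin.≟ v) i≢v | dec-false (j Fin.≟ v) j≢v = ≡.refl

      detach-row : ∀ {j} → j ≢ v → detach v M v j ≡ 0#
      detach-row {j} j≢v
        rewrite dec-true (v Fin.≟ v) ≡.refl | dec-false (j Fin.≟ v) j≢v = ≡.refl

      detach-column : ∀ {i} → i ≢ v → detach v M i v ≡ 0#
      detach-column {i} i≢v
        rewrite dec-true (v Fin.≟ v) ≡.refl | dec-false (i Fin.≟ v) i≢v = ≡.refl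

      delete-diagonal : delete v M v v ≡ 1#
      delete-diagonal rewrite dec-true (v Fin.≟ v) ≡.refl = ≡.refl

      delete-other : ∀ {i j} → i ≢ v → j ≢ v → delete v M i j ≡ M i j
      delete-other {i} {j} i≢v j≢v
        rewrite dec-false (i Fin.≟ v) i≢v | dec-false (j Fin.≟ v) j≢v = ≡.refl

      delete-row : ∀ {j} → v ≢ j → delete v M v j ≡ 0#
      delete-row {j} v≢j
        rewrite dec-true (v Fin.≟ v) ≡.refl | dec-false (v Fin.≟ j) v≢j = ≡.refl

      delete-column : ∀ {i} → i ≢ v → delete v M i v ≡ 0#
      delete-column {i} i≢v
        rewrite dec-true (v Fin.≟ v) ≡.refl | dec-false (i Fin.≟ v) i≢v = ≡.refl

  module _ {n} {es′ : List (Fin n × Fin n)} {v w : Fin n} (v≢w : v ≢ w)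
           (free : All (λ e → ¬ Incident v e) es′) where

    private
      free-joined : ∀ {a} → ¬ Joined es′ v a
      free-joined (inj₁ e∈) = All.lookup free e∈ (inj₁ ≡.refl)
      free-joined (inj₂ e∈) = All.lookup free e∈ (inj₂ ≡.refl)

      joined-sym : ∀ {es : List (Fin n × Fin n)} {a b} → Joined es a b → Joined es b a
      joined-sym (inj₁ e∈) = inj₂ e∈
      joined-sym (inj₂ e∈) = inj₁ e∈

      joined-≢ : ∀ {a b} → Joined es′ a b → a ≢ v × b ≢ v
      joined-≢ j = (λ { ≡.refl → free-joined j }) , (λ { ≡.refl → free-joined (joined-sym {es′} j) })

    -- Together `lift` and `lower` say that `es` consists of `es′` and the edge between `v` and `w`,
    -- up to order and orientation.
    module _ {M : Matrix Carrier n} {es} {d : Fin n → ℕ}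
             (compatible : Compatible M es d)
             (lift  : ∀ {a b} → Joined es′ a b → Joined es a b)
             (lower : ∀ {a b} → Joined es a b → a ≡ v × b ≡ w ⊎ a ≡ w × b ≡ v ⊎ Joined es′ a b)
             where

      row-v : ∀ j → j ≢ v → j ≢ w → M v j ≈ 0#
      row-v j j≢v j≢w = separate compatible (j≢v ∘ ≡.sym) λ (vj , _) → case (lower vj)
        where
        case : ¬ (v ≡ v × j ≡ w ⊎ v ≡ w × j ≡ v ⊎ Joined es′ v j)
        case (inj₁ (_ , j≡w))        = j≢w j≡w
        case (inj₂ (inj₁ (_ , j≡v))) = j≢v j≡v
        case (inj₂ (inj₂ vj))        = free-joined vj

      column-v : ∀ i → i ≢ v → i ≢ w → M i v ≈ 0#
      column-v i i≢v i≢w = separate compatible i≢v λ (iv , _) → case (lower iv)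
        where
        case : ¬ (i ≡ v × v ≡ w ⊎ i ≡ w × v ≡ v ⊎ Joined es′ i v)
        case (inj₁ (i≡v , _))        = i≢v i≡v
        case (inj₂ (inj₁ (i≡w , _))) = i≢w i≡w
        case (inj₂ (inj₂ iv))        = proj₂ (joined-≢ iv) ≡.refl

      -- The case in which the edge vw is not red: `v` keeps its diagonal entry and has no further
      -- edge in `es′`, so zeros are what compatibility asks for in the rest of its row and column.
      detach-compatible : Compatible (detach v M) es′ d
      diagonal detach-compatible i = trans (reflexive (detach-diagonal M i)) (diagonal compatible i)
      joined detach-compatible {a} {b} ab a0 b0 = trans
        (reflexive (≡.cong₂ _*_ (detach-other M a≢v b≢v) (detach-other M b≢v a≢v)))
        (joined compatible (lift ab) a0 b0)
        where
        a≢v = proj₁ (joined-≢ ab)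
        b≢v = proj₂ (joined-≢ ab)
      separate detach-compatible {a} {b} a≢b ¬ab = go (a Fin.≟ v) (b Fin.≟ v)
        where
        go : Dec (a ≡ v) → Dec (b ≡ v) → detach v M a b ≈ 0#
        go (yes ≡.refl) (yes ≡.refl) = contradiction ≡.refl a≢b
        go (yes ≡.refl) (no b≢v)     = reflexive (detach-row M b≢v)
        go (no a≢v)     (yes ≡.refl) = reflexive (detach-column M a≢v)
        go (no a≢v)     (no b≢v)     = trans (reflexive (detach-other M a≢v b≢v))
          (separate compatible a≢b λ (ab , zeros) → case (lower ab) zeros)
          where
          case : a ≡ v × b ≡ w ⊎ a ≡ w × b ≡ v ⊎ Joined es′ a b → ¬ (d a ≡ 0 × d b ≡ 0)
          case (inj₁ (a≡v , _))        zeros = a≢v a≡v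
          case (inj₂ (inj₁ (_ , b≡v))) zeros = b≢v b≡v
          case (inj₂ (inj₂ ab))        zeros = ¬ab (ab , zeros)

      private
        N : Matrix Carrier n
        N = delete w (delete v M)

        N-other : ∀ {a b} → ¬ Incident a (v , w) → ¬ Incident b (v , w) → N a b ≈ M a b
        N-other a∉ b∉ = reflexive (≡.trans
          (delete-other (delete v M) (a∉ ∘ inj₂) (b∉ ∘ inj₂))
          (delete-other M (a∉ ∘ inj₁) (b∉ ∘ inj₁)))

        N-row : ∀ {a b} → Incident a (v , w) → a ≢ b → N a b ≈ 0#
        N-row {_} {b} (inj₂ ≡.refl) w≢b = reflexive (delete-row (delete v M) w≢b)
        N-row {_} {b} (inj₁ ≡.refl) v≢b = go (b Fin.≟ w)
          where
          go : Dec (b ≡ w) → N v b ≈ 0#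
          go (yes ≡.refl) = reflexive (delete-column (delete v M) v≢w)
          go (no  b≢w)    = reflexive (≡.trans (delete-other (delete v M) v≢w b≢w) (delete-row M v≢b))

        N-column : ∀ {a b} → Incident b (v , w) → a ≢ b → N a b ≈ 0#
        N-column {a} (inj₂ ≡.refl) a≢w = reflexive (delete-column (delete v M) a≢w)
        N-column {a} (inj₁ ≡.refl) a≢v = go (a Fin.≟ w)
          where
          go : Dec (a ≡ w) → N a v ≈ 0#
          go (yes ≡.refl) = reflexive (delete-row (delete v M) a≢v)
          go (no  a≢w)    = reflexive (≡.trans (delete-other (delete v M) a≢w v≢w) (delete-column M a≢v))

        N-diagonal : ∀ {a} → Incident a (v , w) → N a a ≈ 1#
        N-diagonal (inj₁ ≡.refl) = reflexive (≡.trans (delete-other (delete v M) v≢w v≢w)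
            (delete-diagonal M {v}))
        N-diagonal (inj₂ ≡.refl) = reflexive (delete-diagonal (delete v M) {w})

      unbumped : ∀ {a} → bump (v , w) d a ≡ 0 → ¬ Incident a (v , w) × d a ≡ 0
      unbumped {a} eq with incident? a (v , w)
      ... | yes a∈ = contradiction (≡.trans (≡.sym (bump-incident d a∈)) eq) λ ()
      ... | no  a∉ = a∉ , ≡.trans (≡.sym (bump-free d a∉)) eq

      -- The case in which the edge vw is red: both ends get degree 1, and `local 1` is the diagonal
      -- entry of the unit rows put in their place. Their positive degree also makes `separate`
      -- demand zeros off the diagonal, and releases them from `joined`.
      delete-compatible : d v ≡ 0 → d w ≡ 0 → Compatible (delete w (delete v M)) es′ (bump (v , w) d)
      diagonal (delete-compatible v0 w0) i = go (incident? i (v , w))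
        where
        zeros : Incident i (v , w) → d i ≡ 0
        zeros (inj₁ ≡.refl) = v0
        zeros (inj₂ ≡.refl) = w0
        go : Dec (Incident i (v , w)) → N i i ≈ local (bump (v , w) d i)
        go (yes i∈) = trans (N-diagonal i∈)
          (reflexive (≡.cong local (≡.sym (≡.trans (bump-incident d i∈) (≡.cong suc (zeros i∈))))))
        go (no i∉) = trans (N-other i∉ i∉)
          (trans (diagonal compatible i) (reflexive (≡.cong local (≡.sym (bump-free d i∉)))))
      joined (delete-compatible v0 w0) ab a0 b0 =
        let a∉ , a0′ = unbumped a0
            b∉ , b0′ = unbumped b0 in
        trans (*-cong (N-other a∉ b∉) (N-other b∉ a∉)) (joined compatible (lift ab) a0′ b0′)
      separate (delete-compatible v0 w0) {a} {b} a≢b ¬ab = go (incident? a (v , w)) (incident? b (v , w))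
        where
        go : Dec (Incident a (v , w)) → Dec (Incident b (v , w)) → N a b ≈ 0#
        go (yes a∈) _        = N-row a∈ a≢b
        go (no _)   (yes b∈) = N-column b∈ a≢b
        go (no a∉)  (no b∉)  = trans (N-other a∉ b∉)
          (separate compatible a≢b λ (ab , a0 , b0) → case (lower ab)
            (≡.trans (bump-free d a∉) a0 , ≡.trans (bump-free d b∉) b0))
          where
          case : a ≡ v × b ≡ w ⊎ a ≡ w × b ≡ v ⊎ Joined es′ a b →
                 ¬ (bump (v , w) d a ≡ 0 × bump (v , w) d b ≡ 0)
          case (inj₁ (a≡v , _))        zeros = a∉ (inj₁ a≡v)
          case (inj₂ (inj₁ (_ , b≡v))) zeros = b∉ (inj₁ b≡v)
          case (inj₂ (inj₂ ab))        zeros = ¬ab (ab , zeros)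

  -- Induction along the peeling: `det-pendant` at the leaf matches the recursion of `Z` on the leaf
  -- edge, `detach` being the term without that edge and `delete` the term with it.
  det≈Z : ∀ {n} {es} → Peelable es → ∀ {M : Matrix Carrier n} {d} → Compatible M es d →
          (∀ v → d v ≤ 1) → detᴿ M ≈ Z es d
  det≈Z [] compatible d≤1 = trans
    (det-diagonal λ i≢j → separate compatible i≢j λ { (inj₁ () , _) ; (inj₂ () , _) })
    (∏-cong (diagonal compatible))
  det≈Z {n} {es} (peel {es′ = es′} {v} {w} v≢w es↭ free p) {M} {d} compatible d≤1 = begin
    detᴿ M
      ≈⟨ det-pendant M v≢w (row-v v≢w free compatible lift lower) (column-v v≢w free compatible lift lower) ⟩
    detᴿ (detach v M) + - (M v w * M w v) * detᴿ (delete w (delete v M))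
      ≈⟨ +-cong (det≈Z p (detach-compatible v≢w free compatible lift lower) d≤1) deletion ⟩
    Z es′ d + t * Z es′ (bump (v , w) d) ≈⟨ reorder es↭ ⟨
    Z es d ∎
    where
    lift : ∀ {a b} → Joined es′ a b → Joined es a b
    lift = Sum.map back back
      where
      back : ∀ {e} → e ∈ es′ → e ∈ es
      back e∈ = [ (λ q → ↭ₚ.∈-resp-↭ (↭.↭-sym q) (there e∈))
                , (λ q → ↭ₚ.∈-resp-↭ (↭.↭-sym q) (there e∈)) ]′ es↭

    lower : ∀ {a b} → Joined es a b → a ≡ v × b ≡ w ⊎ a ≡ w × b ≡ v ⊎ Joined es′ a b
    lower j = [ first j , second j ]′ es↭
      where
      first : ∀ {a b} → Joined es a b → es ↭ (v , w) ∷ es′ → a ≡ v × b ≡ w ⊎ a ≡ w × b ≡ v ⊎ Joined es′ a b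
      first (inj₁ e∈) q with ↭ₚ.∈-resp-↭ q e∈
      ... | here ≡.refl = inj₁ (≡.refl , ≡.refl)
      ... | there e∈′   = inj₂ (inj₂ (inj₁ e∈′))
      first (inj₂ e∈) q with ↭ₚ.∈-resp-↭ q e∈
      ... | here ≡.refl = inj₂ (inj₁ (≡.refl , ≡.refl))
      ... | there e∈′   = inj₂ (inj₂ (inj₂ e∈′))
      second : ∀ {a b} → Joined es a b → es ↭ (w , v) ∷ es′ → a ≡ v × b ≡ w ⊎ a ≡ w × b ≡ v ⊎ Joined es′ a b
      second (inj₁ e∈) q with ↭ₚ.∈-resp-↭ q e∈
      ... | here ≡.refl = inj₂ (inj₁ (≡.refl , ≡.refl))
      ... | there e∈′   = inj₂ (inj₂ (inj₁ e∈′))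
      second (inj₂ e∈) q with ↭ₚ.∈-resp-↭ q e∈
      ... | here ≡.refl = inj₁ (≡.refl , ≡.refl)
      ... | there e∈′   = inj₂ (inj₂ (inj₂ e∈′))

    vw : Joined es v w
    vw = Sum.map (λ q → ↭ₚ.∈-resp-↭ (↭.↭-sym q) (here ≡.refl)) (λ q → ↭ₚ.∈-resp-↭ (↭.↭-sym q) (here ≡.refl)) es↭

    reorder : es ↭ (v , w) ∷ es′ ⊎ es ↭ (w , v) ∷ es′ → Z es d ≈ Z es′ d + t * Z es′ (bump (v , w) d)
    reorder (inj₁ q) = Z-↭ q d
    reorder (inj₂ q) = trans (Z-↭ q d) (+-congˡ (*-congˡ (Z-cong es′ (bump-swap w v d))))

    -- A covered end excludes vw from the red edges. The right side vanishes because a degree rises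
    -- to at least 2, the left side because compatibility has already made `M v w` zero.
    saturated : ∀ u → Incident u (v , w) → d u ≢ 0 →
                - (M v w * M w v) * detᴿ (delete w (delete v M)) ≈ t * Z es′ (bump (v , w) d)
    saturated u u∈ du≢0 = begin
      - (M v w * M w v) * detᴿ (delete w (delete v M))
        ≈⟨ *-congʳ (-‿cong (trans (*-congʳ (separate compatible v≢w λ (_ , v0 , w0) → du≢0
            (zeros u∈ v0 w0))) (zeroˡ _))) ⟩
      - 0# * detᴿ (delete w (delete v M)) ≈⟨ trans (*-congʳ -0#≈0#) (zeroˡ _) ⟩
      0# ≈⟨ trans (*-congˡ (Z-saturated es′ _ u 2≤)) (zeroʳ t) ⟨
      t * Z es′ (bump (v , w) d) ∎
      where
      zeros : Incident u (v , w) → d v ≡ 0 → d w ≡ 0 → d u ≡ 0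
      zeros (inj₁ ≡.refl) v0 w0 = v0
      zeros (inj₂ ≡.refl) v0 w0 = w0
      2≤ : 2 ≤ bump (v , w) d u
      2≤ = ≡.subst (2 ≤_) (≡.sym (bump-incident d u∈)) (s≤s (ℕ.n≢0⇒n>0 du≢0))

    deletion : - (M v w * M w v) * detᴿ (delete w (delete v M)) ≈ t * Z es′ (bump (v , w) d)
    deletion with d v ℕ.≟ 0 | d w ℕ.≟ 0
    ... | no v≢0 | _      = saturated v (inj₁ ≡.refl) v≢0
    ... | yes _  | no w≢0 = saturated w (inj₂ ≡.refl) w≢0
    ... | yes v0 | yes w0 = *-cong
      (trans (-‿cong (joined compatible vw v0 w0)) (-‿involutive t))
      (det≈Z p (delete-compatible v≢w free compatible lift lower v0 w0) bounded)
      where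
      bounded : ∀ u → bump (v , w) d u ≤ 1
      bounded u = go (incident? u (v , w))
        where
        go : Dec (Incident u (v , w)) → bump (v , w) d u ≤ 1
        go (yes (inj₁ ≡.refl)) = ℕ.≤-reflexive (≡.trans (bump-incident d (inj₁ ≡.refl)) (≡.cong suc v0))
        go (yes (inj₂ ≡.refl)) = ℕ.≤-reflexive (≡.trans (bump-incident d (inj₂ ≡.refl)) (≡.cong suc w0))
        go (no u∉)             = ≡.subst (_≤ 1) (≡.sym (bump-free d u∉)) (d≤1 u)

-- Summation over configurations

-- The initial degrees `d` are an accumulator, so that the recursion runs in parallel with that of
-- `Z`.
degreeIn : ∀ {n} (es : List (Fin n × Fin n)) → Subset (length es) → (Fin n → ℕ) → Fin n → ℕ
degreeIn []       Vec.[]             d = d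
degreeIn (e ∷ es) (true  Vec.∷ r) d = degreeIn es r (bump e d)
degreeIn (e ∷ es) (false Vec.∷ r) d = degreeIn es r d

module _ {n} (v : Fin n) where
  RedEnd : (es : List (Fin n × Fin n)) → Subset (length es) → Fin (length es) → Set
  RedEnd es r e = e ∈ˢ r × Incident v (lookup es e)

  -- The three cases for the number of red edges at `v`, each with the evidence that validity of a
  -- configuration asks for or that refutes it. Here `d` is the degree brought in from outside `es`,
  -- and `k` the total.
  data RedEnds (es : List (Fin n × Fin n)) (r : Subset (length es)) (d k : ℕ) : Set where
    no-ends : (∀ e → ¬ RedEnd es r e) → k ≡ d → RedEnds es r d k
    one-end  : ∃! _≡_ (RedEnd es r) → k ≡ suc d → RedEnds es r d k
    many-ends : ∀ {e e′} → RedEnd es r e → RedEnd es r e′ → e ≢ e′ → 2 ℕ.+ d ≤ k → RedEnds es r d k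

  redEnds : ∀ es r d → RedEnds es r (d v) (degreeIn es r d v)
  redEnds []       Vec.[]             d = no-ends (λ ()) ≡.refl
  redEnds (e ∷ es) (false Vec.∷ r) d with redEnds es r d
  ... | no-ends ∉e eq = no-ends (λ { (suc i) (Vec.there i∈ , v∈) → ∉e i (i∈ , v∈) }) eq
  ... | one-end (i , (i∈ , v∈) , unique) eq = one-end
    (suc i , (Vec.there i∈ , v∈) , λ { {suc j} (Vec.there j∈ , v∈′) → ≡.cong suc (unique (j∈ , v∈′)) }) eq
  ... | many-ends (i∈ , v∈) (j∈ , v∈′) i≢j le =
    many-ends (Vec.there i∈ , v∈) (Vec.there j∈ , v∈′) (i≢j ∘ Fin.suc-injective) le
  redEnds (e ∷ es) (true Vec.∷ r) d with incident? v e | redEnds es r (bump e d)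
  ... | yes v∈e | no-ends ∉e eq = one-end
    (zero , (Vec.here , v∈e) , λ { {zero}  _ → ≡.refl
                                  ; {suc j} (Vec.there j∈ , v∈) → contradiction (j∈ , v∈) (∉e j) })
    (≡.trans eq (bump-incident d v∈e))
  ... | yes v∈e | one-end (i , (i∈ , v∈) , _) eq =
    many-ends (Vec.here , v∈e) (Vec.there i∈ , v∈) (λ ())
      (ℕ.≤-reflexive (≡.sym (≡.trans eq (≡.cong suc (bump-incident d v∈e)))))
  ... | yes v∈e | many-ends (i∈ , v∈) (j∈ , v∈′) i≢j le =
    many-ends (Vec.there i∈ , v∈) (Vec.there j∈ , v∈′) (i≢j ∘ Fin.suc-injective)
      (ℕ.≤-trans (ℕ.+-monoʳ-≤ 2 (≡.subst (d v ≤_) (≡.sym (bump-incident d v∈e)) (ℕ.n≤1+n (d v)))) le)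
  ... | no v∉e | no-ends ∉e eq = no-ends
    (λ { zero (_ , v∈e) → v∉e v∈e ; (suc i) (Vec.there i∈ , v∈) → ∉e i (i∈ , v∈) })
    (≡.trans eq (bump-free d v∉e))
  ... | no v∉e | one-end (i , (i∈ , v∈) , unique) eq = one-end
    (suc i , (Vec.there i∈ , v∈) , λ { {zero} (_ , v∈e) → contradiction v∈e v∉e
                                     ; {suc j} (Vec.there j∈ , v∈′) → ≡.cong suc (unique (j∈ , v∈′)) })
    (≡.trans eq (≡.cong suc (bump-free d v∉e)))
  ... | no v∉e | many-ends (i∈ , v∈) (j∈ , v∈′) i≢j le =
    many-ends (Vec.there i∈ , v∈) (Vec.there j∈ , v∈′) (i≢j ∘ Fin.suc-injective)
      (≡.subst (λ k → 2 ℕ.+ k ≤ degreeIn es r (bump e d) v) (bump-free d v∉e) le)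

module ConfigurationSum {c ℓ} (R : CommutativeRing c ℓ) (t : CommutativeRing.Carrier R) where
  open CommutativeRing R hiding (zero)
  open Exp semiring using (_^_)
  open MatchingSum R t
  open import Relation.Binary.Reasoning.Setoid setoid
  open CommutativeSemigroupProperties +-commutativeSemigroup using (interchange)

  ∑ˡ : ∀ {A : Set} → (A → Carrier) → List A → Carrier
  ∑ˡ φ []       = 0#
  ∑ˡ φ (x ∷ xs) = φ x + ∑ˡ φ xs

  module _ {A : Set} where
    ∑ˡ-cong : ∀ {φ ψ : A → Carrier} → (∀ x → φ x ≈ ψ x) → ∀ xs → ∑ˡ φ xs ≈ ∑ˡ ψ xs
    ∑ˡ-cong eq []       = refl
    ∑ˡ-cong eq (x ∷ xs) = +-cong (eq x) (∑ˡ-cong eq xs)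

    ∑ˡ-++ : ∀ (φ : A → Carrier) xs ys → ∑ˡ φ (xs ++ ys) ≈ ∑ˡ φ xs + ∑ˡ φ ys
    ∑ˡ-++ φ []       ys = sym (+-identityˡ _)
    ∑ˡ-++ φ (x ∷ xs) ys = trans (+-congˡ (∑ˡ-++ φ xs ys)) (sym (+-assoc _ _ _))

    ∑ˡ-concatMap : ∀ {B : Set} (φ : A → Carrier) (f : B → List A) xs →
                   ∑ˡ φ (concatMap f xs) ≈ ∑ˡ (λ x → ∑ˡ φ (f x)) xs
    ∑ˡ-concatMap φ f []       = refl
    ∑ˡ-concatMap φ f (x ∷ xs) = trans (∑ˡ-++ φ (f x) _) (+-congˡ (∑ˡ-concatMap φ f xs))

    ∑ˡ-map : ∀ {B : Set} (φ : A → Carrier) (f : B → A) xs → ∑ˡ φ (List.map f xs) ≈ ∑ˡ (φ ∘ f) xs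
    ∑ˡ-map φ f []       = refl
    ∑ˡ-map φ f (x ∷ xs) = +-congˡ (∑ˡ-map φ f xs)

    ∑ˡ-cartesianProductWith : ∀ {B C : Set} (φ : A → Carrier) (f : B → C → A) xs ys →
      ∑ˡ φ (cartesianProductWith f xs ys) ≈ ∑ˡ (λ x → ∑ˡ (λ y → φ (f x y)) ys) xs
    ∑ˡ-cartesianProductWith φ f []       ys = refl
    ∑ˡ-cartesianProductWith φ f (x ∷ xs) ys = trans (∑ˡ-++ φ (List.map (f x) ys) _)
      (+-cong (∑ˡ-map φ (f x) ys) (∑ˡ-cartesianProductWith φ f xs ys))

    *-distribˡ-∑ˡ : ∀ a (φ : A → Carrier) xs → a * ∑ˡ φ xs ≈ ∑ˡ (λ x → a * φ x) xs
    *-distribˡ-∑ˡ a φ []       = zeroʳ a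
    *-distribˡ-∑ˡ a φ (x ∷ xs) = trans (distribˡ a _ _) (+-congˡ (*-distribˡ-∑ˡ a φ xs))

    *-distribʳ-∑ˡ : ∀ a (φ : A → Carrier) xs → ∑ˡ φ xs * a ≈ ∑ˡ (λ x → φ x * a) xs
    *-distribʳ-∑ˡ a φ []       = zeroˡ a
    *-distribʳ-∑ˡ a φ (x ∷ xs) = trans (distribʳ a _ _) (+-congˡ (*-distribʳ-∑ˡ a φ xs))

    ∑ˡ-zero : ∀ (xs : List A) → ∑ˡ (λ _ → 0#) xs ≈ 0#
    ∑ˡ-zero []       = refl
    ∑ˡ-zero (x ∷ xs) = trans (+-identityˡ _) (∑ˡ-zero xs)

    ∑ˡ-+ : ∀ (φ ψ : A → Carrier) xs → ∑ˡ (λ x → φ x + ψ x) xs ≈ ∑ˡ φ xs + ∑ˡ ψ xs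
    ∑ˡ-+ φ ψ []       = sym (+-identityˡ _)
    ∑ˡ-+ φ ψ (x ∷ xs) = trans (+-congˡ (∑ˡ-+ φ ψ xs)) (interchange _ _ _ _)

  ∑ˡ-swap : ∀ {A B : Set} (f : A → B → Carrier) xs ys →
            ∑ˡ (λ x → ∑ˡ (f x) ys) xs ≈ ∑ˡ (λ y → ∑ˡ (λ x → f x y) xs) ys
  ∑ˡ-swap f []       ys = sym (∑ˡ-zero ys)
  ∑ˡ-swap f (x ∷ xs) ys = trans (+-congˡ (∑ˡ-swap f xs ys)) (sym (∑ˡ-+ (f x) _ ys))

  -- A minus counts once in `Q` and once in `E`, which gives (-1)t.
  markWeight : Maybe Sign → Carrier
  markWeight (just Sign.-) = - t
  markWeight _             = 1#

  -- Zero when the mark is incompatible with the red degree, so that a product over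
  -- the vertices vanishes off the valid configurations.
  share : ℕ → Maybe Sign → Carrier
  share 0 (just Sign.+) = 1#
  share 0 (just Sign.-) = - t
  share 1 nothing       = 1#
  share _ _             = 0#

  signs : List (Maybe Sign)
  signs = nothing ∷ just Sign.+ ∷ just Sign.- ∷ []

  -- An uncovered vertex may carry `+`, of weight 1, or `-`, of weight `- t`; a vertex with one red
  -- edge must be unmarked. This is the origin of `local`.
  ∑-share : ∀ k → ∑ˡ (share k) signs ≈ local k
  ∑-share 0             = trans (+-identityˡ _) (+-congˡ (+-identityʳ _))
  ∑-share 1             = trans (+-congˡ (trans (+-identityˡ _) (+-identityˡ _))) (+-identityʳ _)
  ∑-share (suc (suc k)) = trans (+-identityˡ _) (trans (+-identityˡ _) (+-identityˡ _))

  module _ {n} (G : Graph n) where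

    -- Distributivity: expanding a product of sums amounts to choosing a mark at each vertex
    -- independently.
    ∑-∏ : ∀ {k} (F : Fin k → Maybe Sign → Carrier) →
          ∑ˡ (λ m → ∏ (λ v → F v (Vec.lookup m v))) (vecs G signs k) ≈ ∏ (λ v → ∑ˡ (F v) signs)
    ∑-∏ {zero}  F = trans (+-identityʳ _) (trans (∏-empty _) (sym (∏-empty _)))
    ∑-∏ {suc k} F = begin
      ∑ˡ (λ m → ∏ (λ v → F v (Vec.lookup m v))) (cartesianProductWith Vec._∷_ signs (vecs G signs k))
        ≈⟨ ∑ˡ-cartesianProductWith _ Vec._∷_ signs (vecs G signs k) ⟩
      ∑ˡ (λ a → ∑ˡ (λ m → ∏ (λ v → F v (Vec.lookup (a Vec.∷ m) v))) (vecs G signs k)) signs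
        ≈⟨ ∑ˡ-cong (λ a → trans
             (∑ˡ-cong (λ m → ∏-suc (λ v → F v (Vec.lookup (a Vec.∷ m) v))) (vecs G signs k))
             (sym (*-distribˡ-∑ˡ (F zero a) _ (vecs G signs k)))) signs ⟩
      ∑ˡ (λ a → F zero a * ∑ˡ (λ m → ∏ (λ v → F (suc v) (Vec.lookup m v))) (vecs G signs k)) signs
        ≈⟨ *-distribʳ-∑ˡ _ (F zero) signs ⟨
      ∑ˡ (F zero) signs * ∑ˡ (λ m → ∏ (λ v → F (suc v) (Vec.lookup m v))) (vecs G signs k)
        ≈⟨ *-congˡ (∑-∏ (F ∘ suc)) ⟩
      ∑ˡ (F zero) signs * ∏ (λ v → ∑ˡ (F (suc v)) signs) ≈⟨ ∏-suc _ ⟨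
      ∏ (λ v → ∑ˡ (F v) signs) ∎

    bools : List Bool
    bools = false ∷ true ∷ []

    -- The two summands in the recursion of `Z` are the subsets without and with the first edge; the
    -- factor `t` counts the chosen ones.
    Z-subsets : ∀ {n} (es : List (Fin n × Fin n)) d →
                Z es d ≈ ∑ˡ (λ r → t ^ ∣ r ∣ * ∏ (λ v → local (degreeIn es r d v))) (vecs G bools (length es))
    Z-subsets []       d = sym (trans (+-identityʳ _) (*-identityˡ _))
    Z-subsets (e ∷ es) d = begin
      Z es d + t * Z es (bump e d)
        ≈⟨ +-cong (Z-subsets es d) (trans (*-congˡ (Z-subsets es (bump e d))) (*-distribˡ-∑ˡ t _ rs)) ⟩
      ∑ˡ (term d) rs + ∑ˡ (λ r → t * term (bump e d) r) rs
        ≈⟨ +-congˡ (trans (∑ˡ-cong (λ r → sym (*-assoc t _ _)) rs) (sym (+-identityʳ _))) ⟩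
      ∑ˡ (term d) rs + (∑ˡ (λ r → (t * t ^ ∣ r ∣) * ∏ (λ v → local (degreeIn es r (bump e d) v))) rs + 0#)
        ≈⟨ ∑ˡ-cartesianProductWith _ Vec._∷_ bools rs ⟨
      ∑ˡ (λ r → t ^ ∣ r ∣ * ∏ (λ v → local (degreeIn (e ∷ es) r d v))) (vecs G bools (suc (length es))) ∎
      where
      rs = vecs G bools (length es)
      term = λ d r → t ^ ∣ r ∣ * ∏ (λ v → local (degreeIn es r d v))

    private
      redDegree : Subset (length (edges G)) → Fin n → ℕ
      redDegree r = degreeIn (edges G) r (λ _ → 0)

    ValidAt : Marks G → Subset (length (edges G)) → Fin n → Set
    ValidAt m r v =
      (∃ λ s → Vec.lookup m v ≡ just s) × (∀ e → ¬ IsRedEndOf G r v e)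
      ⊎
      Vec.lookup m v ≡ nothing × ∃! _≡_ (IsRedEndOf G r v)

    private
      -- Decides validity at a single vertex and evaluates `share` at the same time. The mark is
      -- passed as a variable `a` with an equation, so that matching on it leaves the validity
      -- condition untouched.
      shareAt : ∀ m r v → RedEnds v (edges G) r 0 (redDegree r v) → ∀ a → Vec.lookup m v ≡ a →
                ValidAt m r v × share (redDegree r v) a ≈ markWeight a ⊎
                ¬ ValidAt m r v × share (redDegree r v) a ≈ 0#
      shareAt m r v (no-ends ∉e eq) (just Sign.+) m≡ rewrite eq = inj₁ (inj₁ ((_ , m≡) , ∉e) , refl)
      shareAt m r v (no-ends ∉e eq) (just Sign.-) m≡ rewrite eq = inj₁ (inj₁ ((_ , m≡) , ∉e) , refl)
      shareAt m r v (no-ends ∉e eq) nothing m≡ rewrite eq = inj₂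
        ( (λ { (inj₁ ((_ , m≡′) , _)) → contradiction (≡.trans (≡.sym m≡) m≡′) (λ ())
             ; (inj₂ (_ , e , v∈e , _)) → ∉e e v∈e })
        , refl)
      shareAt m r v (one-end e! eq) nothing m≡ rewrite eq = inj₁ (inj₂ (m≡ , e!) , refl)
      shareAt m r v (one-end (e , v∈e , _) eq) (just s) m≡ rewrite eq = inj₂
        ( (λ { (inj₁ (_ , ∉e)) → ∉e e v∈e
             ; (inj₂ (m≡′ , _)) → contradiction (≡.trans (≡.sym m≡) m≡′) (λ ()) })
        , refl)
      shareAt m r v (many-ends {e} {e′} v∈e v∈e′ e≢e′ 2≤k) a m≡ = inj₂
        ( (λ { (inj₁ (_ , ∉e)) → ∉e e v∈e
             ; (inj₂ (_ , _ , _ , unique)) → e≢e′ (≡.trans (≡.sym (unique v∈e)) (unique v∈e′)) })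
        , vanish 2≤k a)
        where
        vanish : ∀ {k} → 2 ≤ k → ∀ a → share k a ≈ 0#
        vanish (s≤s (s≤s _)) nothing         = refl
        vanish (s≤s (s≤s _)) (just Sign.+) = refl
        vanish (s≤s (s≤s _)) (just Sign.-) = refl

    weight : Configuration G → Carrier
    weight C = t ^ ∣ red ∣ * ∏ (λ v → markWeight (Vec.lookup marks v))
      where open Configuration C

    ∑-fromPair : ∀ m r → ∑ˡ weight (fromPair G (m , r)) ≈
                         t ^ ∣ r ∣ * ∏ (λ v → share (redDegree r v) (Vec.lookup m v))
    ∑-fromPair m r with isConfiguration? G m r
    ... | yes valid = trans (+-identityʳ _) (*-congˡ
        (∏-cong λ v → sym (equal v (shareAt m r v (redEnds v (edges G) r _) _ ≡.refl))))
      where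
      equal : ∀ v {x y} → ValidAt m r v × x ≈ y ⊎ ¬ ValidAt m r v × x ≈ 0# → x ≈ y
      equal v (inj₁ (_ , eq))  = eq
      equal v (inj₂ (¬at , _)) = contradiction (valid v) ¬at
    ... | no ¬valid = sym (trans (*-congˡ vanish) (zeroʳ _))
      where
      at : ∀ v → ValidAt m r v × share (redDegree r v) (Vec.lookup m v) ≈ markWeight (Vec.lookup m v) ⊎
                 ¬ ValidAt m r v × share (redDegree r v) (Vec.lookup m v) ≈ 0#
      at v = shareAt m r v (redEnds v (edges G) r _) _ ≡.refl
      decide : ∀ v → Dec (ValidAt m r v)
      decide v with at v
      ... | inj₁ (yes-v , _) = yes yes-v
      ... | inj₂ (no-v , _)  = no no-v
      -- An invalid pair is invalid at some particular vertex, because there are finitely many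
      -- vertices and validity is decidable at each; the factor of that vertex is zero.
      vanish : ∏ (λ v → share (redDegree r v) (Vec.lookup m v)) ≈ 0#
      vanish with Fin.¬∀⟶∃¬ n (ValidAt m r) decide ¬valid
      ... | v , ¬at with at v
      ... | inj₁ (at-v , _) = contradiction at-v ¬at
      ... | inj₂ (_ , eq)   = ∏-zero _ v eq

    -- Once invalid pairs have weight zero, the marks range freely over the vertices for each fixed
    -- red set, and the sum over them factorises.
    ∑-configurations : ∑ˡ weight (configurations G) ≈ Z (edges G) (λ _ → 0)
    ∑-configurations = begin
      ∑ˡ weight (configurations G)
        ≈⟨ ∑ˡ-concatMap weight (fromPair G) (cartesianProduct ms rs) ⟩
      ∑ˡ (λ x → ∑ˡ weight (fromPair G x)) (cartesianProduct ms rs)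
        ≈⟨ ∑ˡ-cartesianProductWith _ _,_ ms rs ⟩
      ∑ˡ (λ m → ∑ˡ (λ r → ∑ˡ weight (fromPair G (m , r))) rs) ms
        ≈⟨ ∑ˡ-cong (λ m → ∑ˡ-cong (∑-fromPair m) rs) ms ⟩
      ∑ˡ (λ m → ∑ˡ (λ r → t ^ ∣ r ∣ * ∏ (λ v → share (redDegree r v) (Vec.lookup m v))) rs) ms
        ≈⟨ ∑ˡ-swap _ ms rs ⟩
      ∑ˡ (λ r → ∑ˡ (λ m → t ^ ∣ r ∣ * ∏ (λ v → share (redDegree r v) (Vec.lookup m v))) ms) rs
        ≈⟨ ∑ˡ-cong (λ r → trans (sym (*-distribˡ-∑ˡ (t ^ ∣ r ∣) _ ms))
             (*-congˡ (trans (∑-∏ (λ v → share (redDegree r v))) (∏-cong λ v → ∑-share (redDegree r v))))) rs ⟩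
      ∑ˡ (λ r → t ^ ∣ r ∣ * ∏ (λ v → local (redDegree r v))) rs
        ≈⟨ Z-subsets (edges G) (λ _ → 0) ⟨
      Z (edges G) (λ _ → 0) ∎
      where
      ms = vecs G signs n
      rs = vecs G bools (length (edges G))

-- Linear algebra over 𝔽₂

module RelativeDimension (V : VectorSpace) where
  open LeftModule V
  open MonoidSum +ᴹ-commutativeMonoid using (sum-cong-≋; ∑-distrib-+)
  open import Relation.Binary.Reasoning.Setoid ≈ᴹ-setoid

  opaque
    comb : ∀ {d} → Vector Bool d → Vector Carrierᴹ d → Carrierᴹ
    comb = combination V

    comb-def : ∀ {d} (c : Vector Bool d) b → comb c b ≡ combination V c b
    comb-def c b = ≡.refl

    comb-empty : (c : Vector Bool 0) (b : Vector Carrierᴹ 0) → comb c b ≈ᴹ 0ᴹ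
    comb-empty c b = ≈ᴹ-refl

    comb-suc : ∀ {d} (c : Vector Bool (suc d)) b →
               comb c b ≈ᴹ c zero *ₗ b zero +ᴹ comb (c ∘ suc) (b ∘ suc)
    comb-suc c b = ≈ᴹ-refl

    comb-cong : ∀ {d} {c c′ : Vector Bool d} {b b′} → c ≗ c′ → (∀ i → b i ≈ᴹ b′ i) → comb c b ≈ᴹ comb c′ b′
    comb-cong c≗c′ b≈b′ = sum-cong-≋ λ i → *ₗ-cong (c≗c′ i) (b≈b′ i)

    comb-xor : ∀ {d} (c c′ : Vector Bool d) b → comb (λ i → c i xor c′ i) b ≈ᴹ comb c b +ᴹ comb c′ b
    comb-xor c c′ b = ≈ᴹ-trans
      (sum-cong-≋ λ i → *ₗ-distribʳ (b i) (c i) (c′ i))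
      (∑-distrib-+ (λ i → c i *ₗ b i) (λ i → c′ i *ₗ b i))

  comb-false : ∀ {d} {c : Vector Bool d} {b} → (∀ i → c i ≡ false) → comb c b ≈ᴹ 0ᴹ
  comb-false {zero}          c≗0 = comb-empty _ _
  comb-false {suc d} {c} {b} c≗0 = begin
    comb c b ≈⟨ comb-suc c b ⟩
    c zero *ₗ b zero +ᴹ comb (c ∘ suc) (b ∘ suc)
      ≈⟨ +ᴹ-cong (≈ᴹ-trans (*ₗ-cong (c≗0 zero) ≈ᴹ-refl) (*ₗ-zeroˡ _)) (comb-false (c≗0 ∘ suc)) ⟩
    0ᴹ +ᴹ 0ᴹ ≈⟨ +ᴹ-identityˡ _ ⟩
    0ᴹ ∎

  x+x≈0 : ∀ x → x +ᴹ x ≈ᴹ 0ᴹ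
  x+x≈0 x = begin
    x +ᴹ x                   ≈⟨ +ᴹ-cong (*ₗ-identityˡ x) (*ₗ-identityˡ x) ⟨
    true *ₗ x +ᴹ true *ₗ x   ≈⟨ *ₗ-distribʳ x true true ⟨
    false *ₗ x               ≈⟨ *ₗ-zeroˡ x ⟩
    0ᴹ                       ∎

  x+y+y≈x : ∀ x y → (x +ᴹ y) +ᴹ y ≈ᴹ x
  x+y+y≈x x y = ≈ᴹ-trans (+ᴹ-assoc x y y) (≈ᴹ-trans (+ᴹ-cong ≈ᴹ-refl (x+x≈0 y)) (+ᴹ-identityʳ x))

  open CommutativeSemigroupProperties
    (CommutativeMonoid.commutativeSemigroup +ᴹ-commutativeMonoid) using (interchange)

  record IsSubspace (W : Pred Carrierᴹ 0ℓ) : Set where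
    field
      resp : ∀ {x y} → x ≈ᴹ y → W x → W y
      zero∈ : W 0ᴹ
      add  : ∀ {x y} → W x → W y → W (x +ᴹ y)

    scale∈ : ∀ a {x} → W x → W (a *ₗ x)
    scale∈ true  x∈ = resp (≈ᴹ-sym (*ₗ-identityˡ _)) x∈
    scale∈ false x∈ = resp (≈ᴹ-sym (*ₗ-zeroˡ _)) zero∈

    comb∈ : ∀ {d} (c : Vector Bool d) {b} → (∀ i → W (b i)) → W (comb c b)
    comb∈ {zero}  c b∈ = resp (≈ᴹ-sym (comb-empty _ _)) zero∈
    comb∈ {suc d} c b∈ = resp (≈ᴹ-sym (comb-suc c _))
        (add (scale∈ (c zero) (b∈ zero)) (comb∈ (c ∘ suc) (b∈ ∘ suc)))

  open IsSubspace

  Zero : Pred Carrierᴹ 0ℓ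
  Zero x = x ≈ᴹ 0ᴹ

  Zero-isSubspace : IsSubspace Zero
  Zero-isSubspace = record
    { resp  = λ x≈y x≈0 → ≈ᴹ-trans (≈ᴹ-sym x≈y) x≈0
    ; zero∈ = ≈ᴹ-refl
    ; add   = λ x≈0 y≈0 → ≈ᴹ-trans (+ᴹ-cong x≈0 y≈0) (+ᴹ-identityˡ 0ᴹ)
    }

  Zero⊆ : ∀ {W} → IsSubspace W → Zero ⊆ W
  Zero⊆ W-sub x≈0 = resp W-sub (≈ᴹ-sym x≈0) (zero∈ W-sub)

  -- A basis of the quotient U/W, represented by vectors of U. Over 𝔽₂ addition is subtraction, so
  -- `spanning` says that `u` is congruent modulo W to a combination.
  record RelativeBasis (U W : Pred Carrierᴹ 0ℓ) (d : ℕ) : Set where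
    field
      vector      : Vector Carrierᴹ d
      inside      : ∀ i → U (vector i)
      independent : ∀ c → W (comb c vector) → ∀ i → c i ≡ false
      spanning    : ∀ {u} → U u → ∃ λ c → W (u +ᴹ comb c vector)
  open RelativeBasis

  -- Coordinates embed 𝔽₂ᵈ into 𝔽₂ᵉ, and counting gives 2ᵈ ≤ 2ᵉ.
  dimension-≤ : ∀ {U W d e} → IsSubspace U → IsSubspace W →
                RelativeBasis U W d → RelativeBasis U W e → d ≤ e
  dimension-≤ {U} {W} {d} {e} U-sub W-sub b b′ =
    ℕ.≮⇒≥ λ e<d → ℕ.<⇒≱ (ℕ.^-monoʳ-< 2 (ℕ.s≤s (ℕ.s≤s ℕ.z≤n)) e<d) (Fin.injective⇒≤ g-injective)
    where
    open Inverse Fin.2↔Bool using (to; from; strictlyInverseˡ; strictlyInverseʳ)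
    f : Vector Bool d → Vector Bool e
    f c = proj₁ (spanning b′ (comb∈ U-sub c (inside b)))

    f-spec : ∀ c → W (comb c (vector b) +ᴹ comb (f c) (vector b′))
    f-spec c = proj₂ (spanning b′ (comb∈ U-sub c (inside b)))

    xor-false : ∀ x y → x xor y ≡ false → x ≡ y
    xor-false true  true  _ = ≡.refl
    xor-false false false _ = ≡.refl

    -- If the coordinates with respect to `b′` agree, adding the two congruences cancels them. The
    -- combination of `vector b` with coefficients `c i xor c′ i` then lies in W, and independence
    -- applies.
    f-injective : ∀ c c′ → f c ≗ f c′ → c ≗ c′
    f-injective c c′ eq i = xor-false (c i) (c′ i) (independent b (λ i → c i xor c′ i)
      (resp W-sub (begin
        (x +ᴹ y) +ᴹ (x′ +ᴹ y′) ≈⟨ interchange x y x′ y′ ⟩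
        (x +ᴹ x′) +ᴹ (y +ᴹ y′) ≈⟨ +ᴹ-cong ≈ᴹ-refl (+ᴹ-cong (comb-cong eq λ _ → ≈ᴹ-refl) ≈ᴹ-refl) ⟩
        (x +ᴹ x′) +ᴹ (y′ +ᴹ y′) ≈⟨ ≈ᴹ-trans (+ᴹ-cong ≈ᴹ-refl (x+x≈0 y′)) (+ᴹ-identityʳ _) ⟩
        x +ᴹ x′ ≈⟨ comb-xor c c′ (vector b) ⟨
        comb (λ i → c i xor c′ i) (vector b) ∎)
        (add W-sub (f-spec c) (f-spec c′))) i)
      where
      x  = comb c (vector b)
      x′ = comb c′ (vector b)
      y  = comb (f c) (vector b′)
      y′ = comb (f c′) (vector b′)

    g : Fin (2 ℕ.^ d) → Fin (2 ℕ.^ e)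
    g k = funToFin (from ∘ f (to ∘ finToFun k))

    g-injective : ∀ {k k′} → g k ≡ g k′ → k ≡ k′
    g-injective {k} {k′} eq = ≡.trans (≡.sym (Fin.funToFin-finToFin {d} k))
      (≡.trans (funToFin-cong same) (Fin.funToFin-finToFin {d} k′))
      where
      funToFin-cong : ∀ {m n} {h h′ : Fin m → Fin n} → h ≗ h′ → funToFin h ≡ funToFin h′
      funToFin-cong {zero}  eq = ≡.refl
      funToFin-cong {suc m} eq = ≡.cong₂ combine (eq zero) (funToFin-cong (eq ∘ suc))
      digits : ∀ (h h′ : Fin e → Fin 2) → funToFin h ≡ funToFin h′ → h ≗ h′
      digits h h′ eq i = ≡.trans (≡.sym (Fin.finToFun-funToFin h i))
        (≡.trans (≡.cong (λ k → finToFun k i) eq) (Fin.finToFun-funToFin h′ i))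
      from-injective : ∀ x y → from x ≡ from y → x ≡ y
      from-injective x y eq = ≡.trans (≡.sym (strictlyInverseˡ x)) (≡.trans (≡.cong to eq) (strictlyInverseˡ y))
      to-injective : ∀ x y → to x ≡ to y → x ≡ y
      to-injective x y eq = ≡.trans (≡.sym (strictlyInverseʳ x)) (≡.trans (≡.cong from eq) (strictlyInverseʳ y))
      same : finToFun {2} {d} k ≗ finToFun k′
      same i = to-injective _ _ (f-injective (to ∘ finToFun k) (to ∘ finToFun k′)
        (λ j → from-injective _ _ (digits _ _ eq j)) i)

  dimension-unique : ∀ {U W d e} → IsSubspace U → IsSubspace W →
                     RelativeBasis U W d → RelativeBasis U W e → d ≡ e
  dimension-unique U-sub W-sub b b′ =
    ℕ.≤-antisym (dimension-≤ U-sub W-sub b b′) (dimension-≤ U-sub W-sub b′ b)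

  private
    join : ∀ {A : Set} {d e} → Vector A d → Vector A e → Vector A (d ℕ.+ e)
    join {d = zero}  b b′ = b′
    join {d = suc d} b b′ = b zero Vector.∷ join (b ∘ suc) b′

    join-left : ∀ {A : Set} {d e} (b : Vector A d) (b′ : Vector A e) i → join b b′ (i ↑ˡ e) ≡ b i
    join-left b b′ zero    = ≡.refl
    join-left b b′ (suc i) = join-left (b ∘ suc) b′ i

    join-right : ∀ {A : Set} {d e} (b : Vector A d) (b′ : Vector A e) i → join b b′ (d ↑ʳ i) ≡ b′ i
    join-right {d = zero}  b b′ i = ≡.refl
    join-right {d = suc d} b b′ i = join-right (b ∘ suc) b′ i

    join-All : ∀ {A : Set} {P : Pred A 0ℓ} {d e} {b : Vector A d} {b′ : Vector A e} →
               (∀ i → P (b i)) → (∀ i → P (b′ i)) → ∀ i → P (join b b′ i)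
    join-All {d = zero}  p p′ i       = p′ i
    join-All {d = suc d} p p′ zero    = p zero
    join-All {P = P} {suc d} {b = b} {b′} p p′ (suc i) = join-All {P = P} {b = b ∘ suc} {b′} (p ∘ suc) p′ i

    split-All : ∀ {A : Set} {P : Pred A 0ℓ} d {e} {c : Vector A (d ℕ.+ e)} →
                (∀ i → P (c (i ↑ˡ e))) → (∀ i → P (c (d ↑ʳ i))) → ∀ i → P (c i)
    split-All zero    p p′ i       = p′ i
    split-All (suc d) p p′ zero    = p zero
    split-All {P = P} (suc d) {c = c} p p′ (suc i) = split-All {P = P} d {c = c ∘ suc} (p ∘ suc) p′ i

    comb-join : ∀ {d e} (c : Vector Bool (d ℕ.+ e)) (b : Vector Carrierᴹ d) (b′ : Vector Carrierᴹ e) →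
                comb c (join b b′) ≈ᴹ comb (c ∘ (_↑ˡ e)) b +ᴹ comb (c ∘ (d ↑ʳ_)) b′
    comb-join {zero}      c b b′ = ≈ᴹ-sym (≈ᴹ-trans (+ᴹ-cong (comb-empty _ b) ≈ᴹ-refl) (+ᴹ-identityˡ _))
    comb-join {suc d} {e} c b b′ = begin
      comb c (join b b′) ≈⟨ comb-suc c _ ⟩
      c zero *ₗ b zero +ᴹ comb (c ∘ suc) (join (b ∘ suc) b′)
        ≈⟨ +ᴹ-cong ≈ᴹ-refl (comb-join (c ∘ suc) (b ∘ suc) b′) ⟩
      c zero *ₗ b zero +ᴹ (comb (c ∘ suc ∘ (_↑ˡ e)) (b ∘ suc) +ᴹ comb (c ∘ (suc d ↑ʳ_)) b′) ≈⟨ +ᴹ-assoc _ _ _ ⟨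
      (c zero *ₗ b zero +ᴹ comb (c ∘ suc ∘ (_↑ˡ e)) (b ∘ suc)) +ᴹ comb (c ∘ (suc d ↑ʳ_)) b′
        ≈⟨ +ᴹ-cong (comb-suc (c ∘ (_↑ˡ e)) b) ≈ᴹ-refl ⟨
      comb (c ∘ (_↑ˡ e)) b +ᴹ comb (c ∘ (suc d ↑ʳ_)) b′ ∎

  -- Dimensions add along X ⊆ W ⊆ U: representatives of a basis of U/W are followed by
  -- representatives of a basis of W/X.
  tower : ∀ {U W X d e} → IsSubspace W → IsSubspace X → W ⊆ U → X ⊆ W →
          RelativeBasis U W d → RelativeBasis W X e → RelativeBasis U X (d ℕ.+ e)
  tower {U} {W} {X} {d} {e} W-sub X-sub W⊆U X⊆W b b′ = record
    { vector      = join (vector b) (vector b′)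
    ; inside      = join-All {P = U} {b = vector b} {vector b′} (inside b) (W⊆U ∘ inside b′)
    ; independent = λ c c∈ →
        let split  = resp X-sub (comb-join c (vector b) (vector b′)) c∈
            right∈ = comb∈ W-sub (c ∘ (d ↑ʳ_)) (inside b′)
            -- The second half of the combination lies in W, hence so does the first; its
            -- coefficients vanish, and only the second half is left modulo X.
            left   = independent b (c ∘ (_↑ˡ e))
                       (resp W-sub (x+y+y≈x _ _) (add W-sub (X⊆W split) right∈))
            right  = independent b′ (c ∘ (d ↑ʳ_))
                       (resp X-sub (≈ᴹ-trans (+ᴹ-cong (comb-false left) ≈ᴹ-refl) (+ᴹ-identityˡ _)) split)
        in split-All {P = _≡ false} d {c = c} left right
    ; spanning    = λ {u} u∈ →
        let c  , ∈W = spanning b u∈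
            c′ , ∈X = spanning b′ ∈W
        in join c c′ , resp X-sub (begin
          (u +ᴹ comb c (vector b)) +ᴹ comb c′ (vector b′) ≈⟨ +ᴹ-assoc _ _ _ ⟩
          u +ᴹ (comb c (vector b) +ᴹ comb c′ (vector b′))
            ≈⟨ +ᴹ-cong ≈ᴹ-refl (+ᴹ-cong (comb-cong (join-left c c′) λ _ → ≈ᴹ-refl)
                (comb-cong (join-right c c′) λ _ → ≈ᴹ-refl)) ⟨
          u +ᴹ (comb (join c c′ ∘ (_↑ˡ e)) (vector b) +ᴹ comb (join c c′ ∘ (d ↑ʳ_)) (vector b′))
            ≈⟨ +ᴹ-cong ≈ᴹ-refl (comb-join (join c c′) (vector b) (vector b′)) ⟨
          u +ᴹ comb (join c c′) (join (vector b) (vector b′)) ∎) ∈X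
    }

  Image Kernel : (Carrierᴹ → Carrierᴹ) → Pred Carrierᴹ 0ℓ → Pred Carrierᴹ 0ℓ
  Image  f U y = ∃ λ x → U x × f x ≈ᴹ y
  Kernel f U x = U x × f x ≈ᴹ 0ᴹ

  module _ {f : Carrierᴹ → Carrierᴹ}
           (f-cong : ∀ {x y} → x ≈ᴹ y → f x ≈ᴹ f y)
           (f-zero : f 0ᴹ ≈ᴹ 0ᴹ)
           (f-add  : ∀ x y → f (x +ᴹ y) ≈ᴹ f x +ᴹ f y) where

    f-scale : ∀ a x → f (a *ₗ x) ≈ᴹ a *ₗ f x
    f-scale true  x = ≈ᴹ-trans (f-cong (*ₗ-identityˡ x)) (≈ᴹ-sym (*ₗ-identityˡ _))
    f-scale false x = ≈ᴹ-trans (f-cong (*ₗ-zeroˡ x)) (≈ᴹ-trans f-zero (≈ᴹ-sym (*ₗ-zeroˡ _)))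

    f-comb : ∀ {d} (c : Vector Bool d) b → f (comb c b) ≈ᴹ comb c (f ∘ b)
    f-comb {zero}  c b = ≈ᴹ-trans (f-cong (comb-empty c b)) (≈ᴹ-trans f-zero (≈ᴹ-sym (comb-empty c _)))
    f-comb {suc d} c b = begin
      f (comb c b) ≈⟨ f-cong (comb-suc c b) ⟩
      f (c zero *ₗ b zero +ᴹ comb (c ∘ suc) (b ∘ suc)) ≈⟨ f-add _ _ ⟩
      f (c zero *ₗ b zero) +ᴹ f (comb (c ∘ suc) (b ∘ suc))
        ≈⟨ +ᴹ-cong (f-scale (c zero) (b zero)) (f-comb (c ∘ suc) (b ∘ suc)) ⟩
      c zero *ₗ f (b zero) +ᴹ comb (c ∘ suc) (f ∘ b ∘ suc) ≈⟨ comb-suc c (f ∘ b) ⟨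
      comb c (f ∘ b) ∎

    -- The isomorphism of U modulo the kernel with the image: chosen preimages of a basis of the
    -- image represent a basis of the quotient.
    coimage : ∀ {U d} → IsSubspace U → RelativeBasis (Image f U) Zero d → RelativeBasis U (Kernel f U) d
    coimage {U} {d} U-sub b = record
      { vector      = w
      ; inside      = λ i → proj₁ (proj₂ (inside b i))
      ; independent = λ c (_ , fc≈0) → independent b c (≈ᴹ-trans (≈ᴹ-sym (f-w c)) fc≈0)
      ; spanning    = λ {u} u∈ →
          let c , eq = spanning b (u , u∈ , ≈ᴹ-refl) in
          c , add U-sub u∈ (comb∈ U-sub c (λ i → proj₁ (proj₂ (inside b i)))) , (begin
            f (u +ᴹ comb c w)        ≈⟨ f-add _ _ ⟩
            f u +ᴹ f (comb c w)      ≈⟨ +ᴹ-cong ≈ᴹ-refl (f-w c) ⟩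
            f u +ᴹ comb c (vector b) ≈⟨ eq ⟩
            0ᴹ                       ∎)
      }
      where
      w : Vector Carrierᴹ d
      w i = proj₁ (inside b i)
      f-w : ∀ c → f (comb c w) ≈ᴹ comb c (vector b)
      f-w c = ≈ᴹ-trans (f-comb c w) (comb-cong (λ _ → ≡.refl) λ i → proj₂ (proj₂ (inside b i)))

  module _ (_≟ᴹ_ : B.Decidable _≈ᴹ_) where
    Spanned : ∀ {d} → Vector Carrierᴹ d → Pred Carrierᴹ 0ℓ
    Spanned b x = ∃ λ c → x +ᴹ comb c b ≈ᴹ 0ᴹ

    private
      spanned? : ∀ {d} (b : Vector Carrierᴹ d) x → Dec (Spanned b x)
      spanned? b x = map′
        (λ (p , eq) → Vec.lookup p , eq)
        (λ (c , eq) → Vec.tabulate c ,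
          ≈ᴹ-trans (+ᴹ-cong ≈ᴹ-refl (comb-cong (Vec.lookup∘tabulate c) λ _ → ≈ᴹ-refl)) eq)
        (Subset.anySubset? (λ p → (x +ᴹ comb (Vec.lookup p) b) ≟ᴹ 0ᴹ))

      spanned-isSubspace : ∀ {d} (b : Vector Carrierᴹ d) → IsSubspace (Spanned b)
      spanned-isSubspace b = record
        { resp  = λ x≈y (c , eq) → c , ≈ᴹ-trans (+ᴹ-cong (≈ᴹ-sym x≈y) ≈ᴹ-refl) eq
        ; zero∈ = (λ _ → false) , ≈ᴹ-trans (+ᴹ-identityˡ _) (comb-false λ _ → ≡.refl)
        ; add   = λ {x} {y} (c , eq) (c′ , eq′) → (λ i → c i xor c′ i) , (begin
            (x +ᴹ y) +ᴹ comb (λ i → c i xor c′ i) b ≈⟨ +ᴹ-cong ≈ᴹ-refl (comb-xor c c′ b) ⟩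
            (x +ᴹ y) +ᴹ (comb c b +ᴹ comb c′ b)     ≈⟨ interchange x y _ _ ⟩
            (x +ᴹ comb c b) +ᴹ (y +ᴹ comb c′ b)     ≈⟨ +ᴹ-cong eq eq′ ⟩
            0ᴹ +ᴹ 0ᴹ                                ≈⟨ +ᴹ-identityˡ 0ᴹ ⟩
            0ᴹ                                      ∎)
        }

      extend : ∀ {d} (b : Vector Carrierᴹ d) u → (∀ c → comb c b ≈ᴹ 0ᴹ → ∀ i → c i ≡ false) →
               ¬ Spanned b u → ∀ c → comb c (u Vector.∷ b) ≈ᴹ 0ᴹ → ∀ i → c i ≡ false
      extend b u ind u∉ c eq = go (c zero) ≡.refl
        where
        eq′ : c zero *ₗ u +ᴹ comb (c ∘ suc) b ≈ᴹ 0ᴹ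
        eq′ = ≈ᴹ-trans (≈ᴹ-sym (comb-suc c (u Vector.∷ b))) eq
        go : ∀ c₀ → c zero ≡ c₀ → ∀ i → c i ≡ false
        go true  c₀≡ i = contradiction
          (c ∘ suc , ≈ᴹ-trans (+ᴹ-cong (≈ᴹ-sym (≈ᴹ-trans (*ₗ-cong c₀≡ ≈ᴹ-refl) (*ₗ-identityˡ u))) ≈ᴹ-refl)
              eq′) u∉
        go false c₀≡ zero    = c₀≡
        go false c₀≡ (suc i) = ind (c ∘ suc) (begin
          comb (c ∘ suc) b                     ≈⟨ +ᴹ-identityˡ _ ⟨
          0ᴹ +ᴹ comb (c ∘ suc) b
            ≈⟨ +ᴹ-cong (≈ᴹ-trans (*ₗ-cong c₀≡ ≈ᴹ-refl) (*ₗ-zeroˡ u)) ≈ᴹ-refl ⟨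
          c zero *ₗ u +ᴹ comb (c ∘ suc) b      ≈⟨ eq′ ⟩
          0ᴹ                                   ∎) i

      skip : ∀ {d} (b : Vector Carrierᴹ d) u {x} → Spanned b x → Spanned (u Vector.∷ b) x
      skip b u (c , eq) = false Vector.∷ c , ≈ᴹ-trans (+ᴹ-cong ≈ᴹ-refl
        (≈ᴹ-trans (comb-suc _ _) (≈ᴹ-trans (+ᴹ-cong (*ₗ-zeroˡ u) ≈ᴹ-refl) (+ᴹ-identityˡ _)))) eq

      here∈ : ∀ {d} (b : Vector Carrierᴹ d) u → Spanned (u Vector.∷ b) u
      here∈ b u = true Vector.∷ (λ _ → false) , ≈ᴹ-trans (+ᴹ-cong ≈ᴹ-refl
        (≈ᴹ-trans (comb-suc _ _) (≈ᴹ-trans (+ᴹ-cong (*ₗ-identityˡ u) (comb-false λ _ → ≡.refl))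
            (+ᴹ-identityʳ u)))) (x+x≈0 u)

      sift : ∀ {U : Pred Carrierᴹ 0ℓ} {gs} → All U gs →
             ∃ λ d → ∃ λ (b : Vector Carrierᴹ d) → (∀ i → U (b i)) ×
             (∀ c → comb c b ≈ᴹ 0ᴹ → ∀ i → c i ≡ false) × All (Spanned b) gs
      sift [] = 0 , Vector.[] , (λ ()) , (λ _ _ ()) , []
      sift {gs = g ∷ gs} (g∈ ∷ gs∈) with sift gs∈
      ... | d , b , b∈ , ind , all with spanned? b g
      ... | yes s = d , b , b∈ , ind , s ∷ all
      ... | no ¬s = suc d , g Vector.∷ b , (λ { zero → g∈ ; (suc i) → b∈ i })
                  , extend b g ind ¬s , here∈ b g ∷ All.map (skip b g) all

    -- The second hypothesis expresses that U is contained in the span of `gs`, as minimality among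
    -- the subspaces containing `gs`. It is applied to the span of the vectors that survive the
    -- sifting.
    basis-of-span : ∀ {U gs} → All U gs →
                    (∀ {W} → IsSubspace W → All W gs → U ⊆ W) → ∃ (RelativeBasis U Zero)
    basis-of-span gs∈ least with sift gs∈
    ... | d , b , b∈ , ind , all = d , record
      { vector      = b
      ; inside      = b∈
      ; independent = ind
      ; spanning    = least (spanned-isSubspace b) all
      }

open ≡ using (refl; sym; trans; cong; cong₂; subst; subst₂; setoid; module ≡-Reasoning)

-- Euler characteristic of a graded complex

module _ {X : Set} (_≟_ : DecidableEquality X) where
  open FormalSum _≟_
  open CommutativeSemigroupProperties (CommutativeRing.+-commutativeSemigroup 𝔽₂) using (interchange)

  private
    ++-coefficient : ∀ x y c → coefficient (x ++ y) c ≡ coefficient x c xor coefficient y c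
    ++-coefficient x y c = parity-++ _ x y

    ++-cong : ∀ {x y u v} → x ≈ y → u ≈ v → x ++ u ≈ y ++ v
    ++-cong {x} {y} {u} {v} x≈y u≈v c = trans (++-coefficient x u c)
      (trans (cong₂ _xor_ (x≈y c) (u≈v c)) (sym (++-coefficient y v c)))

    ++-comm : ∀ x y → x ++ y ≈ y ++ x
    ++-comm x y c = trans (++-coefficient x y c)
      (trans (Bool.xor-comm (coefficient x c) _) (sym (++-coefficient y x c)))

    ++-inverse : ∀ x → x ++ x ≈ []
    ++-inverse x c = trans (++-coefficient x x c) (Bool.xor-same (coefficient x c))

    scale-cong : ∀ {a b x y} → a ≡ b → x ≈ y → scale a x ≈ scale b y
    scale-cong {true}  refl x≈y = x≈y
    scale-cong {false} refl x≈y = λ _ → refl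

    scale-distribʳ : ∀ x a b → scale (a xor b) x ≈ scale a x ++ scale b x
    scale-distribʳ x true  true  = λ c → sym (++-inverse x c)
    scale-distribʳ x true  false = λ c → cong (λ y → coefficient y c) (sym (List.++-identityʳ x))
    scale-distribʳ x false b     = λ _ → refl

  formalSums : VectorSpace
  formalSums = record
    { Carrierᴹ = List X
    ; _≈ᴹ_ = _≈_
    ; _+ᴹ_ = _++_
    ; _*ₗ_ = scale
    ; 0ᴹ   = []
    ; -ᴹ_  = id
    ; isLeftModule = record
      { isLeftSemimodule = record
        { +ᴹ-isCommutativeMonoid = record
          { isMonoid = record
            { isSemigroup = record
              { isMagma = record
                { isEquivalence = record
                  { refl  = λ _ → refl
                  ; sym   = λ eq c → sym (eq c)
                  ; trans = λ eq eq′ c → trans (eq c) (eq′ c)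
                  }
                ; ∙-cong = λ {x} {y} {u} {v} → ++-cong {x} {y} {u} {v}
                }
              ; assoc = λ x y z c → cong (λ s → coefficient s c) (List.++-assoc x y z)
              }
            ; identity = (λ x c → refl) , λ x c → cong (λ s → coefficient s c) (List.++-identityʳ x)
            }
          ; comm = ++-comm
          }
        ; isPreleftSemimodule = record
          { *ₗ-cong      = λ {a} {b} {x} {y} → scale-cong {a} {b} {x} {y}
          ; *ₗ-zeroˡ     = λ x c → refl
          ; *ₗ-distribʳ  = scale-distribʳ
          ; *ₗ-identityˡ = λ x c → refl
          ; *ₗ-assoc     = λ { true b x c → refl ; false b x c → refl }
          ; *ₗ-zeroʳ     = λ { true c → refl ; false c → refl }
          ; *ₗ-distribˡ  = λ { true x y c → refl ; false x y c → refl }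
          }
        }
      ; -ᴹ‿cong    = id
      ; -ᴹ‿inverse = ++-inverse , ++-inverse
      }
    }

  coefficient-combination-∉ : ∀ fs (c : Vector Bool (length fs)) {x} → x ∉ fs →
    coefficient (combination formalSums c (λ i → lookup fs i ∷ [])) x ≡ false
  coefficient-combination-∉ []       c x∉ = refl
  coefficient-combination-∉ (f ∷ fs) c {x} x∉ = trans
    (++-coefficient (scale (c zero) (f ∷ [])) _ x)
    (cong₂ _xor_ (first (c zero)) (coefficient-combination-∉ fs (c ∘ suc) (x∉ ∘ there)))
    where
    first : ∀ a → coefficient (scale a (f ∷ [])) x ≡ false
    first false = refl
    first true rewrite dec-false (f ≟ x) (x∉ ∘ here ∘ sym) = refl

  coefficient-combination-lookup : ∀ {fs} → Unique fs → (c : Vector Bool (length fs)) → ∀ i →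
    coefficient (combination formalSums c (λ i → lookup fs i ∷ [])) (lookup fs i) ≡ c i
  coefficient-combination-lookup {f ∷ fs} u c zero = trans
    (++-coefficient (scale (c zero) (f ∷ [])) _ f)
    (trans (cong₂ _xor_ (first (c zero)) (coefficient-combination-∉ fs (c ∘ suc) (Unique.Unique[x∷xs]⇒x∉xs u)))
      (Bool.xor-identityʳ _))
    where
    first : ∀ a → coefficient (scale a (f ∷ [])) f ≡ a
    first false = refl
    first true rewrite dec-true (f ≟ f) refl = refl
  coefficient-combination-lookup {f ∷ fs} (f∉ ∷ u) c (suc i) = trans
    (++-coefficient (scale (c zero) (f ∷ [])) _ (lookup fs i))
    (cong₂ _xor_ (first (c zero)) (coefficient-combination-lookup u (c ∘ suc) i))
    where
    first : ∀ a → coefficient (scale a (f ∷ [])) (lookup fs i) ≡ false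
    first false = refl
    first true rewrite dec-false (f ≟ lookup fs i) (All.lookup f∉ (∈ₚ.∈-lookup i)) = refl

  module _ {cs : List X} (unique : Unique cs) (complete : ∀ c → c ∈ cs) where

    private
      parity-false : ∀ φ {x} → All (λ c → φ c ≡ false) x → parity φ x ≡ false
      parity-false φ []               = refl
      parity-false φ {c ∷ x} (p ∷ ps) = cong₂ _xor_ {φ c} {false} {parity φ x} {false} p (parity-false φ ps)

      parity-xor : ∀ φ ψ x → parity (λ c → φ c xor ψ c) x ≡ parity φ x xor parity ψ x
      parity-xor φ ψ []      = refl
      parity-xor φ ψ (c ∷ x) = trans (cong ((φ c xor ψ c) xor_) (parity-xor φ ψ x))
        (interchange (φ c) (ψ c) (parity φ x) (parity ψ x))

      parity-cong : ∀ {φ ψ} → φ ≗ ψ → ∀ x → parity φ x ≡ parity ψ x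
      parity-cong eq []      = refl
      parity-cong eq (c ∷ x) = cong₂ _xor_ (eq c) (parity-cong eq x)

      parity-point : ∀ (φ : X → Bool) {c xs} → Unique xs → c ∈ xs →
                     parity (λ c′ → φ c′ ∧ does (c ≟ c′)) xs ≡ φ c
      parity-point φ {c} {_ ∷ xs} (c∉ ∷ u) (here refl) = begin
        (φ c ∧ does (c ≟ c)) xor parity ψ xs
          ≡⟨ cong₂ _xor_ (trans (cong (φ c ∧_) (dec-true (c ≟ c) refl)) (Bool.∧-identityʳ (φ c)))
               (parity-false ψ (All.map off c∉)) ⟩
        φ c xor false ≡⟨ Bool.xor-identityʳ (φ c) ⟩
        φ c           ∎
        where
        open ≡-Reasoning
        ψ = λ c′ → φ c′ ∧ does (c ≟ c′)
        off : ∀ {c′} → c ≢ c′ → ψ c′ ≡ false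
        off {c′} c≢ = trans (cong (φ c′ ∧_) (dec-false (c ≟ c′) c≢)) (Bool.∧-zeroʳ (φ c′))
      parity-point φ {c} {c₀ ∷ xs} (c₀∉ ∷ u) (there c∈) = begin
        (φ c₀ ∧ does (c ≟ c₀)) xor parity ψ xs
          ≡⟨ cong₂ _xor_ (trans (cong (φ c₀ ∧_) (dec-false (c ≟ c₀) (λ eq → All.lookup c₀∉ c∈ (sym eq))))
              (Bool.∧-zeroʳ (φ c₀)))
               (parity-point φ u c∈) ⟩
        φ c ∎
        where
        open ≡-Reasoning
        ψ = λ c′ → φ c′ ∧ does (c ≟ c′)

      -- Expansion of `x` in coordinates: by linearity it reduces to one basis element, and `cs`
      -- lists that element exactly once.
      parity-coefficient : ∀ φ x → parity φ x ≡ parity (λ c → φ c ∧ coefficient x c) cs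
      parity-coefficient φ []      = sym (parity-false _ {cs} (All.tabulate λ {c} _ → Bool.∧-zeroʳ (φ c)))
      parity-coefficient φ (c ∷ x) = sym (begin
        parity (λ c′ → φ c′ ∧ (does (c ≟ c′) xor coefficient x c′)) cs
          ≡⟨ parity-cong (λ c′ → Bool.∧-distribˡ-xor (φ c′) (does (c ≟ c′)) (coefficient x c′)) cs ⟩
        parity (λ c′ → (φ c′ ∧ does (c ≟ c′)) xor (φ c′ ∧ coefficient x c′)) cs
          ≡⟨ parity-xor (λ c′ → φ c′ ∧ does (c ≟ c′)) (λ c′ → φ c′ ∧ coefficient x c′) cs ⟩
        parity (λ c′ → φ c′ ∧ does (c ≟ c′)) cs xor parity (λ c′ → φ c′ ∧ coefficient x c′) cs
          ≡⟨ cong₂ _xor_ (parity-point φ unique (complete c)) (sym (parity-coefficient φ x)) ⟩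
        φ c xor parity φ x ∎)
        where open ≡-Reasoning

    -- A linear extension is computed on a list but depends only on its coefficients. This is what
    -- makes `D` respect equality of formal sums.
    ≈⇒≋ : ∀ {x y} → x ≈ y → x ≋ y
    ≈⇒≋ {x} {y} x≈y φ = trans (parity-coefficient φ x)
      (trans (parity-cong (λ c → cong (φ c ∧_) (x≈y c)) cs) (sym (parity-coefficient φ y)))

  -- The predicate `S` cuts out a subcomplex preserved by the differential; for configurations it
  -- fixes the value of `E`, and `degree` is `Q`.
  module GradedComplex
    (D₀ : X → List X) (degree : X → ℕ) {S : Pred X 0ℓ} (S? : Decidable S)
    (D₀-degree : ∀ c → S c → All (λ c′ → degree c′ ≡ suc (degree c) × S c′) (D₀ c))
    (D₀-square : ∀ c → concatMap D₀ (D₀ c) ≈ [])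
    {cs : List X} (unique : Unique cs) (complete : ∀ c → c ∈ cs)
    where

    InDegreeₛ InPreviousDegreeₛ : ℕ → Pred X 0ℓ
    InDegreeₛ         k c = degree c ≡ k × S c
    InPreviousDegreeₛ k c = suc (degree c) ≡ k × S c

    inDegree? : ∀ k → Decidable (InDegreeₛ k)
    inDegree? k c = (degree c ℕ.≟ k) ×-dec S? c

    module H k = Cohomology _≟_ D₀ {InDegreeₛ k} {InPreviousDegreeₛ k}
    -- The differential does not vary with `k`, so the instance at 0 stands for all degrees.
    open H 0 using (D; coeff-D-++)
    open RelativeDimension formalSums
    open IsSubspace

    D-cong : ∀ {x y} → x ≈ y → D x ≈ D y
    D-cong {x} {y} x≈y c = trans (parity-concatMap _ D₀ x)
      (trans (≈⇒≋ unique complete {x} {y} x≈y _) (sym (parity-concatMap _ D₀ y)))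

    D-add : ∀ x y → D (x ++ y) ≈ D x ++ D y
    D-add x y c = trans (coeff-D-++ x y c) (sym (++-coefficient (D x) (D y) c))

    D-square : ∀ x → D (D x) ≈ []
    D-square []      c = refl
    D-square (x ∷ w) c = trans (D-add (D₀ x) (D w) c)
      (trans (++-coefficient (D (D₀ x)) (D (D w)) c) (cong₂ _xor_ (D₀-square x c) (D-square w c)))

    -- Closed under `_≈_` by definition: a list may represent a homogeneous vector although it
    -- contains cancelling terms of other degrees.
    Chains : ℕ → Pred (List X) 0ℓ
    Chains k x = ∃ λ y → All (InDegreeₛ k) y × x ≈ y

    Cocycles Coboundaries : ℕ → Pred (List X) 0ℓ
    Cocycles       k = Kernel D (Chains k)
    Coboundaries k x = ∃ λ w → All (InPreviousDegreeₛ k) w × D w ≈ x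

    Chains-isSubspace : ∀ k → IsSubspace (Chains k)
    Chains-isSubspace k = record
      { resp  = λ x≈y (z , gr , x≈z) → z , gr , λ c → trans (sym (x≈y c)) (x≈z c)
      ; zero∈ = [] , [] , λ _ → refl
      ; add   = λ {x} {y} (z , gr , x≈z) (z′ , gr′ , y≈z′) →
          z ++ z′ , Allₚ.++⁺ gr gr′ , ++-cong {x} {z} {y} {z′} x≈z y≈z′
      }

    Cocycles-isSubspace : ∀ k → IsSubspace (Cocycles k)
    Cocycles-isSubspace k = record
      { resp  = λ {x} {y} x≈y (x∈ , Dx≈0) → resp (Chains-isSubspace k) {x} {y} x≈y x∈
              , λ c → trans (sym (D-cong {x} {y} x≈y c)) (Dx≈0 c)
      ; zero∈ = zero∈ (Chains-isSubspace k) , λ _ → refl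
      ; add   = λ {x} {y} (x∈ , Dx≈0) (y∈ , Dy≈0) → add (Chains-isSubspace k) {x} {y} x∈ y∈
              , λ c → trans (D-add x y c) (++-cong {D x} {[]} {D y} {[]} Dx≈0 Dy≈0 c)
      }

    Coboundaries-isSubspace : ∀ k → IsSubspace (Coboundaries k)
    Coboundaries-isSubspace k = record
      { resp  = λ x≈y (w , gr , eq) → w , gr , λ c → trans (eq c) (x≈y c)
      ; zero∈ = [] , [] , λ _ → refl
      ; add   = λ {x} {y} (w , gr , eq) (w′ , gr′ , eq′) → w ++ w′ , Allₚ.++⁺ gr gr′
              , λ c → trans (D-add w w′ c) (++-cong {D w} {x} {D w′} {y} eq eq′ c)
      }

    Coboundaries⊆Cocycles : ∀ k → Coboundaries k ⊆ Cocycles k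
    Coboundaries⊆Cocycles k {x} (w , gr , Dw≈x) =
      (D w , graded gr , λ c → sym (Dw≈x c)) ,
      λ c → trans (D-cong {x} {D w} (λ c → sym (Dw≈x c)) c) (D-square w c)
      where
      graded : ∀ {w} → All (InPreviousDegreeₛ k) w → All (InDegreeₛ k) (D w)
      graded []                         = []
      graded {c ∷ _} ((eq , Sc) ∷ gr) = Allₚ.++⁺
        (All.map (λ (eq′ , Sc′) → trans eq′ eq , Sc′) (D₀-degree c Sc)) (graded gr)

    previous? : ∀ k → Decidable (InPreviousDegreeₛ k)
    previous? k c = (suc (degree c) ℕ.≟ k) ×-dec S? c

    -- The generators are the values of `D₀` on the basis elements one degree below: `D w` is by
    -- construction the sum of such values.
    Coboundaries-basis : ∀ k → ∃ (RelativeBasis (Coboundaries k) Zero)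
    Coboundaries-basis k = basis-of-span (H._≈?_ 0 (inDegree? 0) (previous? 0) cs complete)
      {Coboundaries k} {List.map D₀ (filter (previous? k) cs)}
      (Allₚ.map⁺ (All.map single (Allₚ.all-filter (previous? k) cs)))
      (λ {W} W-sub gs∈ (w , gr , eq) → resp W-sub eq (generated W-sub (Allₚ.map⁻ gs∈) gr))
      where
      single : ∀ {c} → InPreviousDegreeₛ k c → Coboundaries k (D₀ c)
      single {c} p = c ∷ [] , p ∷ [] , λ x → cong (λ y → coefficient y x) (List.++-identityʳ (D₀ c))
      generated : ∀ {W w} → IsSubspace W → All (W ∘ D₀) (filter (previous? k) cs) →
                  All (InPreviousDegreeₛ k) w → W (D w)
      generated         W-sub gs∈ []       = zero∈ W-sub
      generated {w = c ∷ w} W-sub gs∈ (p ∷ ps) = add W-sub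
        (All.lookup gs∈ (∈ₚ.∈-filter⁺ (previous? k) (complete c) p)) (generated W-sub gs∈ ps)

    -- The rank of the differential arriving in degree `k`.
    rank : ℕ → ℕ
    rank k = proj₁ (Coboundaries-basis k)

    -- Nothing lies in the degree before 0, which ends the cancellation of ranks at the lower end.
    rank-zero : rank 0 ≡ 0
    rank-zero = dimension-unique (Coboundaries-isSubspace 0) Zero-isSubspace
      (proj₂ (Coboundaries-basis 0)) record
        { vector      = Vector.[]
        ; inside      = λ ()
        ; independent = λ _ _ ()
        ; spanning    = λ { {u} ([] , [] , eq) → 
              Vector.[] , ++-cong {u} {[]} {comb Vector.[] Vector.[]} {[]} (λ c → sym (eq c)) (comb-empty _ _)
                          ; ((_ ∷ _) , ((() , _) ∷ _) , _) }
        }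

    number : ℕ → ℕ
    number k = length (filter (inDegree? k) cs)

    Chains-basis : ∀ k → RelativeBasis (Chains k) Zero (number k)
    Chains-basis k = record
      { vector      = λ i → lookup fs i ∷ []
      ; inside      = λ i → _ , All.lookup (Allₚ.all-filter (inDegree? k) cs) (∈ₚ.∈-lookup i) ∷ [] , λ _ → refl
      ; independent = λ c eq i → trans (sym (coefficient-combination-lookup fs-unique c i))
          (trans (cong (λ x → coefficient x (lookup fs i)) (sym (comb-def c _))) (eq (lookup fs i)))
      ; spanning    = λ {u} (y , gr , u≈y) → let c = λ i → coefficient u (lookup fs i) in
          c , λ x → trans (++-coefficient u _ x) (trans
            (cong (λ z → coefficient u x xor coefficient z x) (comb-def c _))
            (trans (cong (coefficient u x xor_) (spans u y gr u≈y x)) (Bool.xor-same (coefficient u x))))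
      }
      where
      fs = filter (inDegree? k) cs
      fs-unique : Unique fs
      fs-unique = Unique.filter⁺ (inDegree? k) unique

      vanish : ∀ {y x} → All (InDegreeₛ k) y → ¬ InDegreeₛ k x → coefficient y x ≡ false
      vanish []                ¬p = refl
      vanish {c ∷ y} {x} (p ∷ ps) ¬p
        rewrite dec-false (c ≟ x) (λ { refl → ¬p p }) = vanish ps ¬p

      spans : ∀ u y → All (InDegreeₛ k) y → u ≈ y → ∀ x →
        coefficient (combination formalSums (λ i → coefficient u (lookup fs i)) (λ i → lookup fs i ∷ [])) x
            ≡ coefficient u x
      spans u y gr u≈y x with inDegree? k x
      ... | no ¬p = trans
        (coefficient-combination-∉ fs _ (λ x∈ → ¬p (proj₂ (∈ₚ.∈-filter⁻ (inDegree? k) {xs = cs} x∈))))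
        (sym (trans (u≈y x) (vanish gr ¬p)))
      ... | yes p = subst
        (λ z → coefficient (combination formalSums (λ i → coefficient u (lookup fs i))
            (λ i → lookup fs i ∷ [])) z ≡ coefficient u z)
        (sym (Anyₚ.lookup-index x∈)) (coefficient-combination-lookup fs-unique _ (index x∈))
        where x∈ = ∈ₚ.∈-filter⁺ (inDegree? k) (complete x) p

    -- Equality of classes in `H.space k` is congruence modulo coboundaries, and the operations on
    -- cocycles are those of formal sums. A basis of the cohomology space is therefore a relative
    -- basis once the proofs carried by the cocycles are forgotten.
    Cohomology-basis : ∀ {k d} → HasDimension (H.space k) d →
                       RelativeBasis (Cocycles k) (Coboundaries k) d
    Cohomology-basis {k} {d} (b , isBasis) = record
      { vector      = cochain ∘ b
      ; inside      = λ i → (cochain (b i) , graded (b i) , λ _ → refl) , closed (b i)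
      ; independent = λ c (w , gr , eq) → IsBasis.independent isBasis c (w , gr , λ x → trans (eq x)
          (cong (λ y → coefficient y x)
            (trans (comb-def c _) (trans (sym (cochain-combination c b)) (sym (List.++-identityʳ _))))))
      ; spanning    = λ {u} ((y , gr , u≈y) , Du≈0) →
          let v = cocycle y gr λ x → trans (sym (D-cong {u} {y} u≈y x)) (Du≈0 x)
              c , w , gr′ , eq = IsBasis.spanning isBasis v
          in c , w , gr′ , λ x → trans (eq x) (trans (++-comm (cochain (combination (H.space k) c b)) y x)
             (++-cong {y} {u} {cochain (combination (H.space k) c b)} {comb c (cochain ∘ b)} (λ x → sym (u≈y x))
               (λ x → cong (λ z → coefficient z x) (trans (cochain-combination c b) (sym (comb-def c _)))) x))
      }
      where
      open H k using (cocycle; module Cocycle)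
      open Cocycle
      cochain-combination : ∀ {d} (c : Vector Bool d) b →
        cochain (combination (H.space k) c b) ≡ combination formalSums c (cochain ∘ b)
      cochain-combination {zero}  c b = refl
      cochain-combination {suc d} c b = cong (scale (c zero) (cochain (b zero)) ++_)
          (cochain-combination (c ∘ suc) (b ∘ suc))

    RelativeBasis-resp : ∀ {U U′ W d} → U ⊆ U′ → U′ ⊆ U → RelativeBasis U W d → RelativeBasis U′ W d
    RelativeBasis-resp U⊆U′ U′⊆U b = record
      { vector = vector ; inside = U⊆U′ ∘ inside ; independent = independent ; spanning = spanning ∘ U′⊆U }
      where open RelativeBasis b

    -- Along 0 ⊆ coboundaries ⊆ cocycles ⊆ chains the successive quotients have dimensions `rank k`,
    -- `h` and `rank (suc k)`. The last one is the coimage of `D`, whose image is the space of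
    -- coboundaries one degree up. The basis elements of degree `k` give the dimension of all
    -- chains.
    dimensions : ∀ {k h} → HasDimension (H.space k) h → rank (suc k) ℕ.+ (h ℕ.+ rank k) ≡ number k
    dimensions {k} H-dimension = dimension-unique (Chains-isSubspace k) Zero-isSubspace
      (tower (Cocycles-isSubspace k) Zero-isSubspace proj₁
          (λ {x} → Zero⊆ (Cocycles-isSubspace k) {x})
        (coimage {D} (λ {x} {y} → D-cong {x} {y}) (λ _ → refl) D-add (Chains-isSubspace k)
          (RelativeBasis-resp (λ {x} → Coboundaries⇒Image {x}) (λ {x} → Image⇒Coboundaries {x})
              (proj₂ (Coboundaries-basis (suc k)))))
        (tower (Coboundaries-isSubspace k) Zero-isSubspace (λ {x} → Coboundaries⊆Cocycles k {x})
          (λ {x} → Zero⊆ (Coboundaries-isSubspace k) {x})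
          (Cohomology-basis H-dimension) (proj₂ (Coboundaries-basis k))))
      (Chains-basis k)
      where
      Coboundaries⇒Image : Coboundaries (suc k) ⊆ Image D (Chains k)
      Coboundaries⇒Image (w , gr , eq) =
        w , (w , All.map (λ (p , s) → ℕ.suc-injective p , s) gr , λ _ → refl) , eq
      Image⇒Coboundaries : Image D (Chains k) ⊆ Coboundaries (suc k)
      Image⇒Coboundaries (w , (y , gr , w≈y) , eq) =
        y , All.map (λ (p , s) → cong suc p , s) gr , λ c → trans (sym (D-cong {w} {y} w≈y c)) (eq c)

-- Leaves of acyclic graphs

lookup-injective : ∀ {A : Set} {xs : List A} → Unique xs → Injective _≡_ _≡_ (lookup xs)
lookup-injective (x∉ ∷ u) {zero}  {zero}  eq = refl
lookup-injective (x∉ ∷ u) {zero}  {suc j} eq = contradiction eq (All.lookup x∉ (∈ₚ.∈-lookup j))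
lookup-injective (x∉ ∷ u) {suc i} {zero}  eq = contradiction (sym eq) (All.lookup x∉ (∈ₚ.∈-lookup i))
lookup-injective (x∉ ∷ u) {suc i} {suc j} eq = cong suc (lookup-injective u eq)

unique-length : ∀ {n} {xs : List (Fin n)} → Unique xs → length xs ≤ n
unique-length u = Fin.injective⇒≤ (lookup-injective u)

module _ {A : Set} where
  -- The elements after x up to and including z; empty if z is x itself.
  prefix : ∀ {x : A} {xs z} → z ∈ x ∷ xs → List A
  prefix (here _)                = []
  prefix {xs = y ∷ _} (there z∈) = y ∷ prefix z∈

  lookup-prefix-last : ∀ {x : A} {xs z} (z∈ : z ∈ x ∷ xs) →
                       lookup (x ∷ prefix z∈) (fromℕ (length (prefix z∈))) ≡ z
  lookup-prefix-last (here z≡x)                = sym z≡x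
  lookup-prefix-last {xs = y ∷ _} (there z∈) = lookup-prefix-last z∈

  prefix-All : ∀ {P : A → Set} {x xs z} (z∈ : z ∈ x ∷ xs) → All P (x ∷ xs) → All P (x ∷ prefix z∈)
  prefix-All (here _)                (p ∷ _)  = p ∷ []
  prefix-All {xs = y ∷ _} (there z∈) (p ∷ ps) = p ∷ prefix-All z∈ ps

  prefix-Unique : ∀ {x : A} {xs z} (z∈ : z ∈ x ∷ xs) → Unique (x ∷ xs) → Unique (x ∷ prefix z∈)
  prefix-Unique (here _)                _        = [] ∷ []
  prefix-Unique {xs = y ∷ _} (there z∈) (x∉ ∷ u) = prefix-All z∈ x∉ ∷ prefix-Unique z∈ u

  prefix-Linked : ∀ {R : A → A → Set} {x xs z} (z∈ : z ∈ x ∷ xs) →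
                  Linked R (x ∷ xs) → Linked R (x ∷ prefix z∈)
  prefix-Linked (here _)                _       = [-]
  prefix-Linked {xs = y ∷ _} (there z∈) (r ∷ l) = r ∷ prefix-Linked z∈ l

  lookup-Linked : ∀ {R : A → A → Set} {x xs} → Linked R (x ∷ xs) →
                  ∀ i → R (lookup (x ∷ xs) (inject₁ i)) (lookup (x ∷ xs) (suc i))
  lookup-Linked (r ∷ l) zero    = r
  lookup-Linked (r ∷ l) (suc i) = lookup-Linked l i

module _ {n} (G : Graph n) (acyclic : ∀ {k} c → ¬ IsCycle G {k} c) where
  open Graph G

  -- Such a `z` lies beyond `y` on the path, so the initial segment from `x` to `z` has at least
  -- three vertices and would close up to a cycle.
  no-chord : ∀ {x y xs z} → Linked _~_ (x ∷ y ∷ xs) → Unique (x ∷ y ∷ xs) → z ∈ xs → ¬ (z ~ x)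
  no-chord {x} {y} {x′ ∷ xs} (x~y ∷ y~x′ ∷ l) ((x≢y ∷ x∉) ∷ (y∉ ∷ u)) z∈ z~x = acyclic
    (lookup (x ∷ y ∷ x′ ∷ prefix z∈))
    ( lookup-injective ((x≢y ∷ prefix-All z∈ x∉) ∷ prefix-All z∈ y∉ ∷ prefix-Unique z∈ u)
    , lookup-Linked (x~y ∷ y~x′ ∷ prefix-Linked z∈ l)
    , subst (_~ x) (sym (lookup-prefix-last z∈)) z~x)

  EdgeList : List (Fin n × Fin n) → Set
  EdgeList es = All (λ (u , v) → u <ᶠ v × u ~ v) es × Unique es

  -- A leaf relative to the edges that remain in `es`, not relative to `G`.
  IsLeafOf : List (Fin n × Fin n) → Fin n → Fin n → Set
  IsLeafOf es v w = Joined es v w × (∀ {e} → e ∈ es → Incident v e → e ≡ (v , w) ⊎ e ≡ (w , v))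

  module _ {es : List (Fin n × Fin n)} (edgeList : EdgeList es) where

    joined-adjacent : ∀ {x y} → Joined es x y → x ~ y
    joined-adjacent (inj₁ e∈) = proj₂ (All.lookup (proj₁ edgeList) e∈)
    joined-adjacent (inj₂ e∈) = symmetric (proj₂ (All.lookup (proj₁ edgeList) e∈))

    isStep? : ∀ (x y : Fin n) (e : Fin n × Fin n) → Dec (e ≡ (x , y) ⊎ e ≡ (y , x))
    isStep? x y e = (e ≟ (x , y)) ⊎-dec (e ≟ (y , x))
      where _≟_ = Product.≡-dec Fin._≟_ Fin._≟_

    -- A walk without backtracking cannot close up, so it ends in a leaf.
    leaf : ∀ fuel {x y xs} → Joined es x y → Linked _~_ (x ∷ y ∷ xs) → Unique (x ∷ y ∷ xs) →
           n ≤ fuel ℕ.+ length (x ∷ y ∷ xs) → ∃₂ (IsLeafOf es)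
    leaf fuel {x} {y} {xs} xy l u n≤ with any? (λ e → incident? x e ×-dec ¬? (isStep? x y e)) es
    ... | no ¬exit = x , y , xy , λ {e} e∈ x∈e → decide (isStep? x y e) e∈ x∈e
      where
      decide : ∀ {e} → Dec (e ≡ (x , y) ⊎ e ≡ (y , x)) → e ∈ es → Incident x e → e ≡ (x , y) ⊎ e ≡ (y , x)
      decide (yes step) _  _   = step
      decide (no ¬step) e∈ x∈e = contradiction
        (lose {P = λ e → Incident x e × ¬ (e ≡ (x , y) ⊎ e ≡ (y , x))} e∈ (x∈e , ¬step)) ¬exit
    ... | yes exit with find exit
    ... | (a , b) , e∈ , x∈e , e≢ = extend fuel n≤ (other x∈e)
      where
      other : Incident x (a , b) → ∃ λ z → Joined es z x × z ≢ y
      other (inj₁ refl) = b , inj₂ e∈ , λ { refl → e≢ (inj₁ refl) }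
      other (inj₂ refl) = a , inj₁ e∈ , λ { refl → e≢ (inj₂ refl) }

      extend : ∀ fuel → n ≤ fuel ℕ.+ length (x ∷ y ∷ xs) → (∃ λ z → Joined es z x × z ≢ y) → ∃₂ (IsLeafOf es)
      extend fuel n≤ (z , zx , z≢y) = continue fuel n≤
        where
        z~x = joined-adjacent zx
        -- The new vertex differs from `x` by irreflexivity, from `y` because the walk does not turn
        -- back, and from the rest because there is no chord.
        u′ : Unique (z ∷ x ∷ y ∷ xs)
        u′ = ((λ z≡x → irreflexive z≡x z~x) ∷ z≢y ∷
              All.tabulate (λ z′∈ z≡z′ → no-chord l u (subst (_∈ xs) (sym z≡z′) z′∈) z~x)) ∷ u
        continue : ∀ fuel → n ≤ fuel ℕ.+ length (x ∷ y ∷ xs) → ∃₂ (IsLeafOf es)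
        -- Without fuel the path already has `n` vertices, so the extended one would have more
        -- distinct vertices than there are.
        continue zero       n≤ = contradiction (ℕ.≤-trans (unique-length u′) n≤) ℕ.1+n≰n
        continue (suc fuel) n≤ = leaf fuel zx (z~x ∷ l) u′
          (subst (n ≤_) (sym (ℕ.+-suc fuel (length (x ∷ y ∷ xs)))) n≤)

  -- Removing a leaf edge leaves again a list of edges of `G`, so acyclicity of `G` serves at every
  -- stage. The bound `m` makes the recursion structural, as `es′` is only a permuted part of `es`.
  edgeList-peelable : ∀ m es → length es ≤ m → EdgeList es → Peelable es
  edgeList-peelable m       []                 _         _       = []
  edgeList-peelable (suc m) es@((x , y) ∷ es₀) (s≤s len) edgeList
    with leaf {es} edgeList n {x} {y} {[]} (inj₁ (here refl)) (x~y ∷ [-])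
           (((λ x≡y → irreflexive x≡y x~y) ∷ []) ∷ ([] ∷ [])) (ℕ.m≤m+n n 2)
    where x~y = proj₂ (All.head (proj₁ edgeList))
  ... | v , w , vw , only = remove vw
    where
    v~w = joined-adjacent {es} edgeList vw
    v≢w : v ≢ w
    v≢w v≡w = irreflexive v≡w v~w

    split-at : ∀ {e} → e ∈ es → ∃ λ es′ → es ↭ e ∷ es′ × length es′ ≤ m × EdgeList (e ∷ es′)
    split-at {e} e∈ with ∈ₚ.∈-∃++ e∈
    ... | ys , zs , eq = ys ++ zs , p
        , ℕ.≤-pred (subst (_≤ suc m) (↭ₚ.↭-length p) (s≤s len))
        , ↭ₚ.All-resp-↭ p (proj₁ edgeList) , ↭ₛ.Unique-resp-↭ (setoid _) (↭⇒↭ₛ p) (proj₂ edgeList)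
      where
      p : es ↭ e ∷ ys ++ zs
      p = subst (_↭ e ∷ ys ++ zs) (sym eq) (↭ₚ.shift e ys zs)

    -- Edges are listed with the smaller end first; so no second edge at the leaf can hide as the
    -- reversed pair.
    reversed : ∀ {es′ a b} → EdgeList ((a , b) ∷ es′) → (b , a) ∉ es′
    reversed ((a<b , _) ∷ all , _) e∈ = ℕ.<-asym a<b (proj₁ (All.lookup all e∈))

    remove : Joined es v w → Peelable es
    remove (inj₁ e∈) with split-at e∈
    ... | es′ , p , len′ , good@(_ ∷ all , new ∷ u) = peel v≢w (inj₁ p) (All.tabulate free)
        (edgeList-peelable m es′ len′ (all , u))
      where
      free : ∀ {e} → e ∈ es′ → ¬ Incident v e
      free e∈ v∈ with only (↭ₚ.∈-resp-↭ (↭.↭-sym p) (there e∈)) v∈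
      ... | inj₁ refl = All.lookup new e∈ refl
      ... | inj₂ refl = reversed good e∈
    remove (inj₂ e∈) with split-at e∈
    ... | es′ , p , len′ , good@(_ ∷ all , new ∷ u) = peel v≢w (inj₂ p) (All.tabulate free)
        (edgeList-peelable m es′ len′ (all , u))
      where
      free : ∀ {e} → e ∈ es′ → ¬ Incident v e
      free e∈ v∈ with only (↭ₚ.∈-resp-↭ (↭.↭-sym p) (there e∈)) v∈
      ... | inj₁ refl = reversed good e∈
      ... | inj₂ refl = All.lookup new e∈ refl

  edges-peelable : Peelable (edges G)
  edges-peelable = edgeList-peelable _ (edges G) ℕ.≤-refl
    ( Allₚ.all-filter isEdge? (List.cartesianProduct (allFin n) (allFin n))
    , Unique.filter⁺ isEdge? (Unique.cartesianProduct⁺ (Unique.allFin⁺ n) (Unique.allFin⁺ n)))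
    where
    isEdge? = λ ((u , v) : Fin n × Fin n) → (u Fin.<? v) ×-dec (u ~? v)

-- The ring ℤ[t]

module _ where
  open ℤ-Solver.+-*-Solver using (solve; _:=_; _:*_; _:+_)

  infix 4 _≈ᵖ_
  _≈ᵖ_ : Polynomial → Polynomial → Set
  p ≈ᵖ q = toSeries p ≗ toSeries q

  coefficient-+ : ∀ p q m → toSeries (p +ᵖ q) m ≡ toSeries p m ℤ.+ toSeries q m
  coefficient-+ []      q       m       = sym (ℤ.+-identityˡ _)
  coefficient-+ (a ∷ p) []      zero    = sym (ℤ.+-identityʳ _)
  coefficient-+ (a ∷ p) []      (suc m) = sym (ℤ.+-identityʳ _)
  coefficient-+ (a ∷ p) (b ∷ q) zero    = refl
  coefficient-+ (a ∷ p) (b ∷ q) (suc m) = coefficient-+ p q m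

  coefficient-neg : ∀ p m → toSeries (-ᵖ p) m ≡ ℤ.- toSeries p m
  coefficient-neg []      m       = refl
  coefficient-neg (a ∷ p) zero    = refl
  coefficient-neg (a ∷ p) (suc m) = coefficient-neg p m

  coefficient-scale : ∀ a p m → toSeries (List.map (a ℤ.*_) p) m ≡ a ℤ.* toSeries p m
  coefficient-scale a []      m       = sym (ℤ.*-zeroʳ a)
  coefficient-scale a (b ∷ p) zero    = refl
  coefficient-scale a (b ∷ p) (suc m) = coefficient-scale a p m

  coefficient-*-zero : ∀ a p q → toSeries ((a ∷ p) *ᵖ q) 0 ≡ a ℤ.* toSeries q 0
  coefficient-*-zero a p q = begin
    toSeries ((a ∷ p) *ᵖ q) 0                      ≡⟨ coefficient-+ (List.map (a ℤ.*_) q) _ 0 ⟩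
    toSeries (List.map (a ℤ.*_) q) 0 ℤ.+ 0ℤ        ≡⟨ ℤ.+-identityʳ _ ⟩
    toSeries (List.map (a ℤ.*_) q) 0               ≡⟨ coefficient-scale a q 0 ⟩
    a ℤ.* toSeries q 0                             ∎
    where open ≡-Reasoning

  coefficient-*-suc : ∀ a p q m →
    toSeries ((a ∷ p) *ᵖ q) (suc m) ≡ a ℤ.* toSeries q (suc m) ℤ.+ toSeries (p *ᵖ q) m
  coefficient-*-suc a p q m = trans (coefficient-+ (List.map (a ℤ.*_) q) _ (suc m))
    (cong (ℤ._+ toSeries (p *ᵖ q) m) (coefficient-scale a q (suc m)))

  coefficient-*-zeroʳ : ∀ p b q → toSeries (p *ᵖ (b ∷ q)) 0 ≡ b ℤ.* toSeries p 0
  coefficient-*-zeroʳ []      b q = sym (ℤ.*-zeroʳ b)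
  coefficient-*-zeroʳ (a ∷ p) b q = trans (coefficient-*-zero a p (b ∷ q)) (ℤ.*-comm a b)

  -- Multiplication recurses on the left factor only. This mirror recursion on the right factor
  -- yields commutativity, and through it congruence and distributivity on the other side.
  coefficient-*-sucʳ : ∀ p b q m →
    toSeries (p *ᵖ (b ∷ q)) (suc m) ≡ b ℤ.* toSeries p (suc m) ℤ.+ toSeries (p *ᵖ q) m
  coefficient-*-sucʳ []      b q m       = sym (trans (ℤ.+-identityʳ _) (ℤ.*-zeroʳ b))
  coefficient-*-sucʳ (a ∷ p) b q zero    = begin
    toSeries ((a ∷ p) *ᵖ (b ∷ q)) 1 ≡⟨ coefficient-*-suc a p (b ∷ q) 0 ⟩
    a ℤ.* toSeries q 0 ℤ.+ toSeries (p *ᵖ (b ∷ q)) 0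
      ≡⟨ cong₂ ℤ._+_ (sym (coefficient-*-zero a p q)) (coefficient-*-zeroʳ p b q) ⟩
    toSeries ((a ∷ p) *ᵖ q) 0 ℤ.+ b ℤ.* toSeries p 0 ≡⟨ ℤ.+-comm (toSeries ((a ∷ p) *ᵖ q) 0) _ ⟩
    b ℤ.* toSeries p 0 ℤ.+ toSeries ((a ∷ p) *ᵖ q) 0 ∎
    where open ≡-Reasoning
  coefficient-*-sucʳ (a ∷ p) b q (suc m) = begin
    toSeries ((a ∷ p) *ᵖ (b ∷ q)) (2 ℕ.+ m) ≡⟨ coefficient-*-suc a p (b ∷ q) (suc m) ⟩
    x ℤ.+ toSeries (p *ᵖ (b ∷ q)) (suc m)   ≡⟨ cong (ℤ._+_ x) (coefficient-*-sucʳ p b q m) ⟩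
    x ℤ.+ (y ℤ.+ z)                         ≡⟨ solve 3 (λ x y z → x :+ (y :+ z) := y :+ (x :+ z)) refl x y z ⟩
    y ℤ.+ (x ℤ.+ z)                         ≡⟨ cong (ℤ._+_ y) (coefficient-*-suc a p q m) ⟨
    y ℤ.+ toSeries ((a ∷ p) *ᵖ q) (suc m)   ∎
    where
    open ≡-Reasoning
    x = a ℤ.* toSeries q (suc m)
    y = b ℤ.* toSeries p (suc m)
    z = toSeries (p *ᵖ q) m

  *ᵖ-zeroʳ : ∀ p → p *ᵖ [] ≈ᵖ []
  *ᵖ-zeroʳ []      m       = refl
  *ᵖ-zeroʳ (a ∷ p) zero    = refl
  *ᵖ-zeroʳ (a ∷ p) (suc m) = *ᵖ-zeroʳ p m

  *ᵖ-comm : ∀ p q → p *ᵖ q ≈ᵖ q *ᵖ p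
  *ᵖ-comm []      q m       = sym (*ᵖ-zeroʳ q m)
  *ᵖ-comm (a ∷ p) q zero    = trans (coefficient-*-zero a p q) (sym (coefficient-*-zeroʳ q a p))
  *ᵖ-comm (a ∷ p) q (suc m) = trans (coefficient-*-suc a p q m)
    (trans (cong (ℤ._+_ (a ℤ.* toSeries q (suc m))) (*ᵖ-comm p q m)) (sym (coefficient-*-sucʳ q a p m)))

  *ᵖ-congˡ : ∀ p {q r} → q ≈ᵖ r → p *ᵖ q ≈ᵖ p *ᵖ r
  *ᵖ-congˡ []      q≈r m       = refl
  *ᵖ-congˡ (a ∷ p) {q} {r} q≈r zero = trans (coefficient-*-zero a p q)
    (trans (cong (a ℤ.*_) (q≈r 0)) (sym (coefficient-*-zero a p r)))
  *ᵖ-congˡ (a ∷ p) {q} {r} q≈r (suc m) = trans (coefficient-*-suc a p q m)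
    (trans (cong₂ (λ x y → a ℤ.* x ℤ.+ y) (q≈r (suc m)) (*ᵖ-congˡ p {q} {r} q≈r m))
        (sym (coefficient-*-suc a p r m)))

  *ᵖ-cong : ∀ {p p′ q q′} → p ≈ᵖ p′ → q ≈ᵖ q′ → p *ᵖ q ≈ᵖ p′ *ᵖ q′
  *ᵖ-cong {p} {p′} {q} {q′} p≈ q≈ m = begin
    toSeries (p *ᵖ q) m   ≡⟨ *ᵖ-congˡ p {q} {q′} q≈ m ⟩
    toSeries (p *ᵖ q′) m  ≡⟨ *ᵖ-comm p q′ m ⟩
    toSeries (q′ *ᵖ p) m  ≡⟨ *ᵖ-congˡ q′ {p} {p′} p≈ m ⟩
    toSeries (q′ *ᵖ p′) m ≡⟨ *ᵖ-comm q′ p′ m ⟩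
    toSeries (p′ *ᵖ q′) m ∎
    where open ≡-Reasoning

  +ᵖ-cong : ∀ {p p′ q q′} → p ≈ᵖ p′ → q ≈ᵖ q′ → p +ᵖ q ≈ᵖ p′ +ᵖ q′
  +ᵖ-cong {p} {p′} {q} {q′} p≈ q≈ m = trans (coefficient-+ p q m)
    (trans (cong₂ ℤ._+_ (p≈ m) (q≈ m)) (sym (coefficient-+ p′ q′ m)))

  *ᵖ-distribʳ : ∀ r p q → (p +ᵖ q) *ᵖ r ≈ᵖ p *ᵖ r +ᵖ q *ᵖ r
  *ᵖ-distribʳ r []      q  m = refl
  *ᵖ-distribʳ r (a ∷ p) [] m =
    sym (trans (coefficient-+ ((a ∷ p) *ᵖ r) [] m) (ℤ.+-identityʳ _))
  *ᵖ-distribʳ r (a ∷ p) (b ∷ q) zero = begin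
    toSeries ((a ℤ.+ b ∷ p +ᵖ q) *ᵖ r) 0     ≡⟨ coefficient-*-zero (a ℤ.+ b) (p +ᵖ q) r ⟩
    (a ℤ.+ b) ℤ.* toSeries r 0               ≡⟨ ℤ.*-distribʳ-+ (toSeries r 0) a b ⟩
    a ℤ.* toSeries r 0 ℤ.+ b ℤ.* toSeries r 0
      ≡⟨ cong₂ ℤ._+_ (coefficient-*-zero a p r) (coefficient-*-zero b q r) ⟨
    toSeries ((a ∷ p) *ᵖ r) 0 ℤ.+ toSeries ((b ∷ q) *ᵖ r) 0 ≡⟨ coefficient-+ ((a ∷ p) *ᵖ r) ((b ∷ q) *ᵖ r) 0 ⟨
    toSeries ((a ∷ p) *ᵖ r +ᵖ (b ∷ q) *ᵖ r) 0 ∎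
    where open ≡-Reasoning
  *ᵖ-distribʳ r (a ∷ p) (b ∷ q) (suc m) = begin
    toSeries ((a ℤ.+ b ∷ p +ᵖ q) *ᵖ r) (suc m) ≡⟨ coefficient-*-suc (a ℤ.+ b) (p +ᵖ q) r m ⟩
    (a ℤ.+ b) ℤ.* x ℤ.+ toSeries ((p +ᵖ q) *ᵖ r) m
      ≡⟨ cong (ℤ._+_ ((a ℤ.+ b) ℤ.* x)) (trans (*ᵖ-distribʳ r p q m) (coefficient-+ (p *ᵖ r) (q *ᵖ r) m)) ⟩
    (a ℤ.+ b) ℤ.* x ℤ.+ (y ℤ.+ z)
      ≡⟨ solve 5 (λ a b x y z → (a :+ b) :* x :+ (y :+ z) := (a :* x :+ y) :+ (b :* x :+ z)) refl a b x y z ⟩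
    (a ℤ.* x ℤ.+ y) ℤ.+ (b ℤ.* x ℤ.+ z) ≡⟨ cong₂ ℤ._+_ (coefficient-*-suc a p r m) (coefficient-*-suc b q r m) ⟨
    toSeries ((a ∷ p) *ᵖ r) (suc m) ℤ.+ toSeries ((b ∷ q) *ᵖ r) (suc m)
      ≡⟨ coefficient-+ ((a ∷ p) *ᵖ r) ((b ∷ q) *ᵖ r) (suc m) ⟨
    toSeries ((a ∷ p) *ᵖ r +ᵖ (b ∷ q) *ᵖ r) (suc m) ∎
    where
    open ≡-Reasoning
    x = toSeries r (suc m)
    y = toSeries (p *ᵖ r) m
    z = toSeries (q *ᵖ r) m

  *ᵖ-distribˡ : ∀ r p q → r *ᵖ (p +ᵖ q) ≈ᵖ r *ᵖ p +ᵖ r *ᵖ q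
  *ᵖ-distribˡ r p q m = begin
    toSeries (r *ᵖ (p +ᵖ q)) m      ≡⟨ *ᵖ-comm r (p +ᵖ q) m ⟩
    toSeries ((p +ᵖ q) *ᵖ r) m      ≡⟨ *ᵖ-distribʳ r p q m ⟩
    toSeries (p *ᵖ r +ᵖ q *ᵖ r) m
      ≡⟨ +ᵖ-cong {p *ᵖ r} {r *ᵖ p} {q *ᵖ r} {r *ᵖ q} (*ᵖ-comm p r) (*ᵖ-comm q r) m ⟩
    toSeries (r *ᵖ p +ᵖ r *ᵖ q) m   ∎
    where open ≡-Reasoning

  scale-*ᵖ : ∀ a p q m → toSeries (List.map (a ℤ.*_) p *ᵖ q) m ≡ a ℤ.* toSeries (p *ᵖ q) m
  scale-*ᵖ a []      q m    = sym (ℤ.*-zeroʳ a)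
  scale-*ᵖ a (b ∷ p) q zero = begin
    toSeries ((a ℤ.* b ∷ List.map (a ℤ.*_) p) *ᵖ q) 0 ≡⟨ coefficient-*-zero (a ℤ.* b) (List.map (a ℤ.*_) p) q ⟩
    a ℤ.* b ℤ.* toSeries q 0   ≡⟨ ℤ.*-assoc a b _ ⟩
    a ℤ.* (b ℤ.* toSeries q 0) ≡⟨ cong (a ℤ.*_) (coefficient-*-zero b p q) ⟨
    a ℤ.* toSeries ((b ∷ p) *ᵖ q) 0 ∎
    where open ≡-Reasoning
  scale-*ᵖ a (b ∷ p) q (suc m) = begin
    toSeries ((a ℤ.* b ∷ List.map (a ℤ.*_) p) *ᵖ q) (suc m)
      ≡⟨ coefficient-*-suc (a ℤ.* b) (List.map (a ℤ.*_) p) q m ⟩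
    a ℤ.* b ℤ.* x ℤ.+ toSeries (List.map (a ℤ.*_) p *ᵖ q) m ≡⟨ cong (ℤ._+_ (a ℤ.* b ℤ.* x)) (scale-*ᵖ a p q m) ⟩
    a ℤ.* b ℤ.* x ℤ.+ a ℤ.* y
      ≡⟨ solve 4 (λ a b x y → a :* b :* x :+ a :* y := a :* (b :* x :+ y)) refl a b x y ⟩
    a ℤ.* (b ℤ.* x ℤ.+ y) ≡⟨ cong (a ℤ.*_) (coefficient-*-suc b p q m) ⟨
    a ℤ.* toSeries ((b ∷ p) *ᵖ q) (suc m) ∎
    where
    open ≡-Reasoning
    x = toSeries q (suc m)
    y = toSeries (p *ᵖ q) m

  shift-*ᵖ : ∀ p q → (0ℤ ∷ p) *ᵖ q ≈ᵖ 0ℤ ∷ p *ᵖ q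
  shift-*ᵖ p q zero    = trans (coefficient-*-zero 0ℤ p q) (ℤ.*-zeroˡ (toSeries q 0))
  shift-*ᵖ p q (suc m) = trans (coefficient-*-suc 0ℤ p q m)
    (trans (cong (ℤ._+ toSeries (p *ᵖ q) m) (ℤ.*-zeroˡ (toSeries q (suc m)))) (ℤ.+-identityˡ _))

  *ᵖ-assoc : ∀ p q r → (p *ᵖ q) *ᵖ r ≈ᵖ p *ᵖ (q *ᵖ r)
  *ᵖ-assoc []      q r m = refl
  *ᵖ-assoc (a ∷ p) q r m = begin
    toSeries ((List.map (a ℤ.*_) q +ᵖ (0ℤ ∷ p *ᵖ q)) *ᵖ r) m ≡⟨ *ᵖ-distribʳ r (List.map (a ℤ.*_) q) _ m ⟩
    toSeries (List.map (a ℤ.*_) q *ᵖ r +ᵖ (0ℤ ∷ p *ᵖ q) *ᵖ r) m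
      ≡⟨ coefficient-+ (List.map (a ℤ.*_) q *ᵖ r) _ m ⟩
    toSeries (List.map (a ℤ.*_) q *ᵖ r) m ℤ.+ toSeries ((0ℤ ∷ p *ᵖ q) *ᵖ r) m
      ≡⟨ cong₂ ℤ._+_ (trans (scale-*ᵖ a q r m) (sym (coefficient-scale a (q *ᵖ r) m)))
          (trans (shift-*ᵖ (p *ᵖ q) r m) (shifted m)) ⟩
    toSeries (List.map (a ℤ.*_) (q *ᵖ r)) m ℤ.+ toSeries (0ℤ ∷ p *ᵖ (q *ᵖ r)) m
      ≡⟨ coefficient-+ (List.map (a ℤ.*_) (q *ᵖ r)) _ m ⟨
    toSeries (List.map (a ℤ.*_) (q *ᵖ r) +ᵖ (0ℤ ∷ p *ᵖ (q *ᵖ r))) m ∎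
    where
    open ≡-Reasoning
    shifted : 0ℤ ∷ (p *ᵖ q) *ᵖ r ≈ᵖ 0ℤ ∷ p *ᵖ (q *ᵖ r)
    shifted zero    = refl
    shifted (suc m) = *ᵖ-assoc p q r m

  *ᵖ-identityˡ : ∀ p → (1ℤ ∷ []) *ᵖ p ≈ᵖ p
  *ᵖ-identityˡ p zero    = trans (coefficient-*-zero 1ℤ [] p) (ℤ.*-identityˡ _)
  *ᵖ-identityˡ p (suc m) = trans (coefficient-*-suc 1ℤ [] p m)
    (trans (ℤ.+-identityʳ _) (ℤ.*-identityˡ _))

  +ᵖ-assoc : ∀ p q r → (p +ᵖ q) +ᵖ r ≈ᵖ p +ᵖ (q +ᵖ r)
  +ᵖ-assoc p q r m rewrite coefficient-+ (p +ᵖ q) r m | coefficient-+ p q m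
    | coefficient-+ p (q +ᵖ r) m | coefficient-+ q r m = ℤ.+-assoc (toSeries p m) _ _

  +ᵖ-comm : ∀ p q → p +ᵖ q ≈ᵖ q +ᵖ p
  +ᵖ-comm p q m rewrite coefficient-+ p q m | coefficient-+ q p m = ℤ.+-comm (toSeries p m) _

  +ᵖ-inverseˡ : ∀ p → (-ᵖ p) +ᵖ p ≈ᵖ []
  +ᵖ-inverseˡ p m rewrite coefficient-+ (-ᵖ p) p m | coefficient-neg p m = ℤ.+-inverseˡ (toSeries p m)

  polynomialRing : CommutativeRing 0ℓ 0ℓ
  polynomialRing = record
    { Carrier = Polynomial
    ; _≈_ = _≈ᵖ_
    ; _+_ = _+ᵖ_
    ; _*_ = _*ᵖ_
    ; -_  = -ᵖ_
    ; 0#  = []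
    ; 1#  = 1ℤ ∷ []
    ; isCommutativeRing = record
      { isRing = record
        { +-isAbelianGroup = record
          { isGroup = record
            { isMonoid = record
              { isSemigroup = record
                { isMagma = record
                  { isEquivalence = record
                    { refl  = λ _ → refl
                    ; sym   = λ eq m → sym (eq m)
                    ; trans = λ eq eq′ m → trans (eq m) (eq′ m)
                    }
                  ; ∙-cong = λ {p} {p′} {q} {q′} → +ᵖ-cong {p} {p′} {q} {q′}
                  }
                ; assoc = +ᵖ-assoc
                }
              ; identity = (λ p m → refl) , λ p m → trans (coefficient-+ p [] m) (ℤ.+-identityʳ _)
              }
            ; inverse = +ᵖ-inverseˡ , λ p m → trans (+ᵖ-comm p (-ᵖ p) m) (+ᵖ-inverseˡ p m)
            ; ⁻¹-cong = λ {p} {q} eq m → trans (coefficient-neg p m)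
                (trans (cong ℤ.-_ (eq m)) (sym (coefficient-neg q m)))
            }
          ; comm = +ᵖ-comm
          }
        ; *-cong = λ {p} {p′} {q} {q′} → *ᵖ-cong {p} {p′} {q} {q′}
        ; *-assoc = *ᵖ-assoc
        ; *-identity = *ᵖ-identityˡ , λ p m → trans (*ᵖ-comm p (1ℤ ∷ []) m) (*ᵖ-identityˡ p m)
        ; distrib = *ᵖ-distribˡ , *ᵖ-distribʳ
        }
      ; *-comm = *ᵖ-comm
      }
    }

-- The differential on configurations

module _ where
  open CommutativeSemigroupProperties (CommutativeRing.+-commutativeSemigroup 𝔽₂) using (interchange)

  -- Like `parity`, but over any index type, as D² is summed over edges as well as over
  -- configurations.
  ⨁ : ∀ {A : Set} → (A → Bool) → List A → Bool
  ⨁ φ []       = false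
  ⨁ φ (x ∷ xs) = φ x xor ⨁ φ xs

  module _ {A : Set} where
    ⨁-cong : ∀ {φ ψ : A → Bool} → φ ≗ ψ → ∀ xs → ⨁ φ xs ≡ ⨁ ψ xs
    ⨁-cong eq []       = refl
    ⨁-cong eq (x ∷ xs) = cong₂ _xor_ (eq x) (⨁-cong eq xs)

    ⨁-++ : ∀ (φ : A → Bool) xs ys → ⨁ φ (xs ++ ys) ≡ ⨁ φ xs xor ⨁ φ ys
    ⨁-++ φ []       ys = refl
    ⨁-++ φ (x ∷ xs) ys = trans (cong (φ x xor_) (⨁-++ φ xs ys)) (sym (Bool.xor-assoc (φ x) _ _))

    ⨁-concatMap : ∀ {B : Set} (φ : A → Bool) (f : B → List A) xs →
                  ⨁ φ (concatMap f xs) ≡ ⨁ (λ x → ⨁ φ (f x)) xs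
    ⨁-concatMap φ f []       = refl
    ⨁-concatMap φ f (x ∷ xs) = trans (⨁-++ φ (f x) _) (cong (⨁ φ (f x) xor_) (⨁-concatMap φ f xs))

    ⨁-xor : ∀ (φ ψ : A → Bool) xs → ⨁ (λ x → φ x xor ψ x) xs ≡ ⨁ φ xs xor ⨁ ψ xs
    ⨁-xor φ ψ []       = refl
    ⨁-xor φ ψ (x ∷ xs) = trans (cong ((φ x xor ψ x) xor_) (⨁-xor φ ψ xs)) (interchange (φ x) (ψ x) _ _)

    -- In characteristic 2 the terms at (x, y) and (y, x) cancel, and the diagonal contributes
    -- nothing.
    ⨁-alternating : ∀ (f : A → A → Bool) → (∀ x y → f x y ≡ f y x) → (∀ x → f x x ≡ false) →
                    ∀ xs → ⨁ (λ x → ⨁ (f x) xs) xs ≡ false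
    ⨁-alternating f symm alt []       = refl
    ⨁-alternating f symm alt (x ∷ xs) = begin
      (f x x xor ⨁ (f x) xs) xor ⨁ (λ y → f y x xor ⨁ (f y) xs) xs
        ≡⟨ cong₂ _xor_ (cong (_xor ⨁ (f x) xs) (alt x)) (⨁-xor (λ y → f y x) (λ y → ⨁ (f y) xs) xs) ⟩
      ⨁ (f x) xs xor (⨁ (λ y → f y x) xs xor ⨁ (λ y → ⨁ (f y) xs) xs)
        ≡⟨ cong₂ (λ a b → ⨁ (f x) xs xor (a xor b)) (⨁-cong (λ y → symm y x) xs) (⨁-alternating f symm alt xs) ⟩
      ⨁ (f x) xs xor (⨁ (f x) xs xor false) ≡⟨ cong (⨁ (f x) xs xor_) (Bool.xor-identityʳ _) ⟩
      ⨁ (f x) xs xor ⨁ (f x) xs             ≡⟨ Bool.xor-same (⨁ (f x) xs) ⟩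
      false                                 ∎
      where open ≡-Reasoning

  ⨁-false : ∀ {A : Set} (xs : List A) → ⨁ (λ _ → false) xs ≡ false
  ⨁-false []       = refl
  ⨁-false (x ∷ xs) = ⨁-false xs

  ⨁-swap : ∀ {A B : Set} (f : A → B → Bool) xs ys →
           ⨁ (λ x → ⨁ (f x) ys) xs ≡ ⨁ (λ y → ⨁ (λ x → f x y) xs) ys
  ⨁-swap f []       ys = sym (⨁-false ys)
  ⨁-swap f (x ∷ xs) ys = trans
    (cong (⨁ (f x) ys xor_) (⨁-swap f xs ys))
    (sym (⨁-xor (f x) (λ y → ⨁ (λ x → f x y) xs) ys))

-- Minuses and red edges of a split configuration

∣p-x∣ : ∀ {n} {p : Subset n} {x} → x ∈ˢ p → suc ∣ p ∖ x ∣ ≡ ∣ p ∣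
∣p-x∣ {p = true Vec.∷ p}  Vec.here        = cong suc (cong ∣_∣ (Subset.p─⊥≡p p))
∣p-x∣ {p = true Vec.∷ p}  (Vec.there x∈) = cong suc (∣p-x∣ x∈)
∣p-x∣ {p = false Vec.∷ p} (Vec.there x∈) = ∣p-x∣ x∈

Unique-concatMap : ∀ {A B : Set} {f : A → List B} → (∀ x → Unique (f x)) →
                   (∀ {x y z} → z ∈ f x → z ∈ f y → x ≡ y) → ∀ {xs} → Unique xs → Unique (concatMap f xs)
Unique-concatMap {f = f} unique disjoint {xs} xs! = Unique.concat⁺
  (Allₚ.map⁺ (All.tabulate λ {x} _ → unique x))
  (AllPairsₚ.map⁺ (AllPairs.map (λ x≢y {_} (z∈x , z∈y) → x≢y (disjoint z∈x z∈y)) xs!))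

minus? : (m : Maybe Sign) → Dec (m ≡ just Sign.-)
minus? m = Maybe.≡-dec Sign._≟_ m (just Sign.-)

minusWeight : Maybe Sign → ℕ
minusWeight m = if does (minus? m) then 1 else 0

count-∷ : ∀ {n} m (ms : Vec (Maybe Sign) n) → count minus? (m Vec.∷ ms) ≡ minusWeight m ℕ.+ count minus? ms
count-∷ m ms with does (minus? m)
... | true  = refl
... | false = refl

-- Stated additively, with the overwritten mark on the left, to avoid subtraction of natural
-- numbers.
count-update : ∀ {n} (ms : Vec (Maybe Sign) n) i m →
  count minus? (ms [ i ]≔ m) ℕ.+ minusWeight (Vec.lookup ms i) ≡ count minus? ms ℕ.+ minusWeight m
count-update (m₀ Vec.∷ ms) zero m
  rewrite count-∷ m ms | count-∷ m₀ ms =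
  solve 3 (λ a b c → (a :+ b) :+ c := (c :+ b) :+ a) refl (minusWeight m) (count minus? ms) (minusWeight m₀)
  where open ℕ-Solver.+-*-Solver
count-update (m₀ Vec.∷ ms) (suc i) m
  rewrite count-∷ m₀ (ms [ i ]≔ m) | count-∷ m₀ ms =
  trans (ℕ.+-assoc (minusWeight m₀) _ _)
    (trans (cong (minusWeight m₀ ℕ.+_) (count-update ms i m)) (sym (ℕ.+-assoc (minusWeight m₀) _ _)))

count-mark : ∀ {n} (ms : Vec (Maybe Sign) n) {i} m → Vec.lookup ms i ≡ nothing →
             count minus? (ms [ i ]≔ m) ≡ count minus? ms ℕ.+ minusWeight m
count-mark ms {i} m eq = trans (sym (ℕ.+-identityʳ _))
  (trans (cong (λ x → count minus? (ms [ i ]≔ m) ℕ.+ minusWeight x) (sym eq)) (count-update ms i m))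

module _ {n} (G : Graph n) where
  open Graph G
  open Configuration

  end₁<end₂ : ∀ e → end₁ G e <ᶠ end₂ G e
  end₁<end₂ e = proj₁ (All.lookup (Allₚ.all-filter (λ ((u , v) : Fin n × Fin n) → (u Fin.<? v) ×-dec (u ~? v))
    (cartesianProduct (allFin n) (allFin n))) (∈ₚ.∈-lookup e))

  end₁≢end₂ : ∀ e → end₁ G e ≢ end₂ G e
  end₁≢end₂ e eq = ℕ.<-irrefl (cong toℕ eq) (end₁<end₂ e)

  -- The field `valid` is irrelevant and cannot be inspected; decidability of validity recovers a
  -- usable proof.
  valid′ : ∀ (C : Configuration G) → IsConfiguration G (marks C) (red C)
  valid′ (configuration m r valid) = recompute (isConfiguration? G m r) valid

  marks-nothing : ∀ (C : Configuration G) {v e} → IsRedEndOf G (red C) v e → Vec.lookup (marks C) v ≡ nothing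
  marks-nothing C {v} {e} v∈e with valid′ C v
  ... | inj₁ (_ , none) = contradiction v∈e (none e)
  ... | inj₂ (eq , _)   = eq

  unique-end : ∀ (C : Configuration G) {v e e′} → IsRedEndOf G (red C) v e → IsRedEndOf G (red C) v e′ → e ≡ e′
  unique-end C {v} {e} {e′} v∈e v∈e′ with valid′ C v
  ... | inj₁ (_ , none)           = contradiction v∈e (none e)
  ... | inj₂ (_ , _ , _ , unique) = trans (sym (unique v∈e)) (unique v∈e′)

  -- Both ends of a red edge are unmarked, and exactly one of the two opposite signs is a minus.
  #minus-split : ∀ (C : Configuration G) e (e∈ : e ∈ˢ red C) s → #minus G (split G C e e∈ s) ≡ suc (#minus G C)
  #minus-split C e e∈ s = begin
    count minus? ((m [ end₁ G e ]≔ just s) [ end₂ G e ]≔ just (opposite s))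
      ≡⟨ count-mark (m [ end₁ G e ]≔ just s) (just (opposite s))
           -- The ends of an edge are distinct, so marking the first leaves the second unmarked.
           (trans (Vec.lookup∘update′ (end₁≢end₂ e ∘ sym) m (just s)) (marks-nothing C (e∈ , inj₂ refl))) ⟩
    count minus? (m [ end₁ G e ]≔ just s) ℕ.+ minusWeight (just (opposite s))
      ≡⟨ cong (ℕ._+ minusWeight (just (opposite s)))
          (count-mark m (just s) (marks-nothing C (e∈ , inj₁ refl))) ⟩
    (count minus? m ℕ.+ minusWeight (just s)) ℕ.+ minusWeight (just (opposite s))
      ≡⟨ ℕ.+-assoc (count minus? m) _ _ ⟩
    count minus? m ℕ.+ (minusWeight (just s) ℕ.+ minusWeight (just (opposite s)))
      ≡⟨ cong (count minus? m ℕ.+_) (oneMinus s) ⟩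
    count minus? m ℕ.+ 1 ≡⟨ ℕ.+-comm _ 1 ⟩
    suc (count minus? m) ∎
    where
    open ≡-Reasoning
    m = marks C
    oneMinus : ∀ s → minusWeight (just s) ℕ.+ minusWeight (just (opposite s)) ≡ 1
    oneMinus Sign.+ = refl
    oneMinus Sign.- = refl

  -- A red edge is traded for a minus.
  E-split : ∀ (C : Configuration G) e (e∈ : e ∈ˢ red C) s → E G (split G C e e∈ s) ≡ E G C
  E-split C e e∈ s = begin
    #minus G (split G C e e∈ s) ℕ.+ ∣ red C ∖ e ∣ ≡⟨ cong (ℕ._+ ∣ red C ∖ e ∣) (#minus-split C e e∈ s) ⟩
    suc (#minus G C) ℕ.+ ∣ red C ∖ e ∣            ≡⟨ ℕ.+-suc (#minus G C) _ ⟨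
    #minus G C ℕ.+ suc ∣ red C ∖ e ∣              ≡⟨ cong (#minus G C ℕ.+_) (∣p-x∣ e∈) ⟩
    #minus G C ℕ.+ ∣ red C ∣                      ∎
    where open ≡-Reasoning

  D₀-degree : ∀ {m} (C : Configuration G) → E G C ≡ m → All (λ C′ → Q G C′ ≡ suc (Q G C) × E G C′ ≡ m) (D₀ G C)
  D₀-degree C refl = Allₚ.concat⁺ (Allₚ.map⁺ {xs = allFin _} (All.tabulate λ {e} _ → step e))
    where
    step : ∀ e → All (λ C′ → Q G C′ ≡ suc (Q G C) × E G C′ ≡ E G C) (splits G C e)
    step e with e Subset.∈? red C
    ... | yes e∈ = (#minus-split C e e∈ Sign.+ , E-split C e e∈ Sign.+) ∷
        (#minus-split C e e∈ Sign.- , E-split C e e∈ Sign.-) ∷ []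
    ... | no  _  = []

  configuration-≡ : ∀ {C C′ : Configuration G} → marks C ≡ marks C′ → red C ≡ red C′ → C ≡ C′
  configuration-≡ refl refl = refl

  splits-∈ : ∀ (C : Configuration G) {e} (e∈ : e ∈ˢ red C) →
             splits G C e ≡ split G C e e∈ Sign.+ ∷ split G C e e∈ Sign.- ∷ []
  splits-∈ C {e} e∈ with e Subset.∈? red C
  ... | yes _  = refl
  ... | no e∉ = contradiction e∈ e∉

  splits-∉ : ∀ (C : Configuration G) {e} → e ∉ˢ red C → splits G C e ≡ []
  splits-∉ C {e} e∉ with e Subset.∈? red C
  ... | yes e∈ = contradiction e∈ e∉
  ... | no _   = refl

  -- Every vertex has at most one red edge, so two different red edges share no end and the four
  -- updates of marks commute. Membership proofs are arbitrary, and validity is irrelevant for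
  -- equality.
  split-comm : ∀ (C : Configuration G) {e e′} (e∈ : e ∈ˢ red C) (e′∈ : e′ ∈ˢ red C) → e ≢ e′ → ∀ s s′ p p′ →
               split G (split G C e e∈ s) e′ p s′ ≡ split G (split G C e′ e′∈ s′) e p′ s
  split-comm C {e} {e′} e∈ e′∈ e≢e′ s s′ p p′ = configuration-≡ commute (Subset.p─q─r≡p─r─q (red C) _ _)
    where
    open ≡-Reasoning
    m = marks C
    a = end₁ G e ; b = end₂ G e ; a′ = end₁ G e′ ; b′ = end₂ G e′
    distinct : ∀ {v v′} → IsEnd G v e → IsEnd G v′ e′ → v ≢ v′
    distinct v∈ v′∈ refl = e≢e′ (unique-end C (e∈ , v∈) (e′∈ , v′∈))
    commute : setEnds G (setEnds G m e s) e′ s′ ≡ setEnds G (setEnds G m e′ s′) e s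
    commute = begin
      (((m [ a ]≔ just s) [ b ]≔ just (opposite s)) [ a′ ]≔ just s′) [ b′ ]≔ just (opposite s′)
        ≡⟨ cong (_[ b′ ]≔ just (opposite s′))
            (Vec.[]≔-commutes (m [ a ]≔ just s) b a′ (distinct (inj₂ refl) (inj₁ refl))) ⟩
      (((m [ a ]≔ just s) [ a′ ]≔ just s′) [ b ]≔ just (opposite s)) [ b′ ]≔ just (opposite s′)
        ≡⟨ Vec.[]≔-commutes ((m [ a ]≔ just s) [ a′ ]≔ just s′) b b′ (distinct (inj₂ refl) (inj₂ refl)) ⟩
      (((m [ a ]≔ just s) [ a′ ]≔ just s′) [ b′ ]≔ just (opposite s′)) [ b ]≔ just (opposite s)
        ≡⟨ cong (λ x → (x [ b′ ]≔ just (opposite s′)) [ b ]≔ just (opposite s))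
            (Vec.[]≔-commutes m a a′ (distinct (inj₁ refl) (inj₁ refl))) ⟩
      (((m [ a′ ]≔ just s′) [ a ]≔ just s) [ b′ ]≔ just (opposite s′)) [ b ]≔ just (opposite s)
        ≡⟨ cong (_[ b ]≔ just (opposite s)) (Vec.[]≔-commutes (m [ a′ ]≔ just s′) a b′
            (distinct (inj₁ refl) (inj₂ refl))) ⟩
      (((m [ a′ ]≔ just s′) [ b′ ]≔ just (opposite s′)) [ a ]≔ just s) [ b ]≔ just (opposite s) ∎

  module _ (φ : Configuration G → Bool) (C : Configuration G) where
    private
      -- The part of D² that splits first `e` and then `e′`, tested against `φ`. It is symmetric by
      -- `split-comm`, and zero on the diagonal since `e` is not red any more after its own
      -- splitting.
      T : Edge G → Edge G → Bool
      T e e′ = ⨁ (λ C′ → ⨁ φ (splits G C′ e′)) (splits G C e)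

      stays : ∀ {e e′} → e′ ∈ˢ red C → e′ ≢ e → e′ ∈ˢ (red C ∖ e)
      stays = Subset.x∈p∧x≢y⇒x∈p-y

      T-∉ˡ : ∀ {e} e′ → e ∉ˢ red C → T e e′ ≡ false
      T-∉ˡ e′ e∉ = cong (⨁ _) (splits-∉ C e∉)

      T-vanish : ∀ {e} e′ → e′ ∉ˢ (red C ∖ e) → T e e′ ≡ false
      T-vanish {e} e′ e′∉ with e Subset.∈? red C
      ... | no _   = refl
      ... | yes e∈ = cong₂ (λ x y → ⨁ φ x xor (⨁ φ y xor false))
        (splits-∉ (split G C e e∈ Sign.+) {e′} e′∉) (splits-∉ (split G C e e∈ Sign.-) {e′} e′∉)

      T-∈ : ∀ {e e′} (e∈ : e ∈ˢ red C) (e′∈ : e′ ∈ˢ (red C ∖ e)) →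
        let c = λ s s′ → φ (split G (split G C e e∈ s) e′ e′∈ s′) in
        T e e′ ≡ (c Sign.+ Sign.+ xor (c Sign.+ Sign.- xor false)) xor
            ((c Sign.- Sign.+ xor (c Sign.- Sign.- xor false)) xor false)
      T-∈ {e} {e′} e∈ e′∈ = trans (cong (⨁ _) (splits-∈ C e∈))
        (cong₂ (λ x y → ⨁ φ x xor (⨁ φ y xor false))
          (splits-∈ (split G C e e∈ Sign.+) e′∈) (splits-∈ (split G C e e∈ Sign.-) e′∈))

      -- Interchanges the middle terms, that is, the order of summation over the two signs; each
      -- `false` is the end of a two-element list.
      shuffle : ∀ a b c d → (a xor (b xor false)) xor ((c xor (d xor false)) xor false) ≡
                            (a xor (c xor false)) xor ((b xor (d xor false)) xor false)
      shuffle true  true  true  d     = refl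
      shuffle true  true  false true  = refl
      shuffle true  true  false false = refl
      shuffle true  false true  true  = refl
      shuffle true  false true  false = refl
      shuffle true  false false d     = refl
      shuffle false true  true  d     = refl
      shuffle false true  false true  = refl
      shuffle false true  false false = refl
      shuffle false false true  true  = refl
      shuffle false false true  false = refl
      shuffle false false false d     = refl

      T-diagonal : ∀ e → T e e ≡ false
      T-diagonal e = T-vanish e (x∉p-x G (red C) e)

      T-symmetric : ∀ e e′ → T e e′ ≡ T e′ e
      T-symmetric e e′ = go (e Fin.≟ e′) (e Subset.∈? red C) (e′ Subset.∈? red C)
        where
        go : Dec (e ≡ e′) → Dec (e ∈ˢ red C) → Dec (e′ ∈ˢ red C) → T e e′ ≡ T e′ e
        go (yes refl) _        _         = refl
        go (no _)     (no e∉)  _         = trans (T-∉ˡ {e} e′ e∉)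
            (sym (T-vanish {e′} e (e∉ ∘ Subset.p─q⊆p (red C) _)))
        go (no _)     (yes _)  (no e′∉)  = trans (T-vanish {e} e′ (e′∉ ∘ Subset.p─q⊆p (red C) _))
            (sym (T-∉ˡ {e′} e e′∉))
        go (no e≢e′)  (yes e∈) (yes e′∈) = begin
          T e e′ ≡⟨ T-∈ e∈ p ⟩
          (c Sign.+ Sign.+ xor (c Sign.+ Sign.- xor false)) xor
              ((c Sign.- Sign.+ xor (c Sign.- Sign.- xor false)) xor false)
            ≡⟨ shuffle (c Sign.+ Sign.+) (c Sign.+ Sign.-) (c Sign.- Sign.+) (c Sign.- Sign.-) ⟩
          (c Sign.+ Sign.+ xor (c Sign.- Sign.+ xor false)) xor
              ((c Sign.+ Sign.- xor (c Sign.- Sign.- xor false)) xor false)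
            ≡⟨ cong₂ (λ x y → x xor (y xor false))
                 (cong₂ (λ x y → x xor (y xor false)) (same Sign.+ Sign.+) (same Sign.- Sign.+))
                 (cong₂ (λ x y → x xor (y xor false)) (same Sign.+ Sign.-) (same Sign.- Sign.-)) ⟩
          (c′ Sign.+ Sign.+ xor (c′ Sign.+ Sign.- xor false)) xor
              ((c′ Sign.- Sign.+ xor (c′ Sign.- Sign.- xor false)) xor false)
            ≡⟨ T-∈ e′∈ p′ ⟨
          T e′ e ∎
          where
          open ≡-Reasoning
          p  = stays e′∈ (e≢e′ ∘ sym)
          p′ = stays e∈ e≢e′
          c  = λ s s′ → φ (split G (split G C e e∈ s) e′ p s′)
          c′ = λ s′ s → φ (split G (split G C e′ e′∈ s′) e p′ s)
          same : ∀ s s′ → c s s′ ≡ c′ s′ s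
          same s s′ = cong φ (split-comm C e∈ e′∈ e≢e′ s s′ p p′)

    ⨁-D₀-square : ⨁ φ (concatMap (D₀ G) (D₀ G C)) ≡ false
    ⨁-D₀-square = begin
      ⨁ φ (concatMap (D₀ G) (D₀ G C)) ≡⟨ ⨁-concatMap φ (D₀ G) (D₀ G C) ⟩
      ⨁ (λ C′ → ⨁ φ (D₀ G C′)) (D₀ G C) ≡⟨ ⨁-concatMap _ (splits G C) es ⟩
      ⨁ (λ e → ⨁ (λ C′ → ⨁ φ (D₀ G C′)) (splits G C e)) es
        ≡⟨ ⨁-cong (λ e → trans
             (⨁-cong (λ C′ → ⨁-concatMap φ (splits G C′) es) (splits G C e))
             (⨁-swap (λ C′ e′ → ⨁ φ (splits G C′ e′)) (splits G C e) es)) es ⟩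
      ⨁ (λ e → ⨁ (T e) es) es ≡⟨ ⨁-alternating T T-symmetric T-diagonal es ⟩
      false ∎
      where
      open ≡-Reasoning
      es = allFin _

  open FormalSum (_≟ᶜ_ G) using (parity; _≈_)

  D₀-square : ∀ (C : Configuration G) → concatMap (D₀ G) (D₀ G C) ≈ []
  D₀-square C C″ = trans (parity-⨁ _ (concatMap (D₀ G) (D₀ G C))) (⨁-D₀-square _ C)
    where
    parity-⨁ : ∀ φ x → parity φ x ≡ ⨁ φ x
    parity-⨁ φ []      = refl
    parity-⨁ φ (c ∷ x) = cong (φ c xor_) (parity-⨁ φ x)

  vecs-unique : ∀ {A : Set} {as : List A} → Unique as → ∀ k → Unique (vecs G as k)
  vecs-unique u zero    = [] ∷ []
  vecs-unique u (suc k) = Unique.cartesianProductWith⁺ Vec._∷_ Vec.∷-injective u (vecs-unique u k)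

  configurations-unique : Unique (configurations G)
  configurations-unique = Unique-concatMap atMostOne
      (λ {x} {y} z∈x z∈y → trans (origin x z∈x) (sym (origin y z∈y)))
    (Unique.cartesianProduct⁺
      (vecs-unique (((λ ()) ∷ (λ ()) ∷ []) ∷ ((λ ()) ∷ []) ∷ [] ∷ []) n)
      (vecs-unique (((λ ()) ∷ []) ∷ [] ∷ []) (List.length (edges G))))
    where
    atMostOne : ∀ x → Unique (fromPair G x)
    atMostOne (m , r) with isConfiguration? G m r
    ... | yes _ = [] ∷ []
    ... | no  _ = []
    origin : ∀ x {C} → C ∈ fromPair G x → x ≡ (marks C , red C)
    origin (m , r) C∈ with isConfiguration? G m r | C∈
    ... | yes _ | here refl = refl

-- Alternating sums and the final comparison

alternating : (ℕ → ℕ) → ℕ → ℤ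
alternating f j = List.foldr ℤ._+_ 0ℤ (applyUpTo (λ k → -1ℤ ℤ.^ k ℤ.* ℤ.+ f k) j)

module _ where
  open ≡-Reasoning
  open ℤ-Solver.+-*-Solver using (solve; _:=_; _:*_; _:+_; con; :-_; _:-_)

  private
    sum-neg : ∀ (g h : ℕ → ℤ) j → (∀ k → h k ≡ ℤ.- g k) →
              List.foldr ℤ._+_ 0ℤ (applyUpTo h j) ≡ ℤ.- List.foldr ℤ._+_ 0ℤ (applyUpTo g j)
    sum-neg g h zero    eq = refl
    sum-neg g h (suc j) eq = trans (cong₂ ℤ._+_ (eq 0) (sum-neg (g ∘ suc) (h ∘ suc) j (eq ∘ suc)))
      (sym (ℤ.neg-distrib-+ (g 0) _))

  -- Splitting off the term at 0 and shifting the index reverses all later signs; the other facts on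
  -- alternating sums recurse through this form.
  alternating-suc : ∀ f j → alternating f (suc j) ≡ ℤ.+ f 0 ℤ.- alternating (f ∘ suc) j
  alternating-suc f j = cong₂ ℤ._+_ (ℤ.*-identityˡ (ℤ.+ f 0))
    (sum-neg _ _ j λ k → solve 2 (λ s x → (con -1ℤ :* s) :* x := :- (s :* x)) refl (-1ℤ ℤ.^ k) (ℤ.+ f (suc k)))

  alternating-cong : ∀ {f g} → f ≗ g → alternating f ≗ alternating g
  alternating-cong f≗g zero    = refl
  alternating-cong {f} {g} f≗g (suc j) = begin
    alternating f (suc j)                   ≡⟨ alternating-suc f j ⟩
    ℤ.+ f 0 ℤ.- alternating (f ∘ suc) j
      ≡⟨ cong₂ (λ x y → ℤ.+ x ℤ.- y) (f≗g 0) (alternating-cong (f≗g ∘ suc) j) ⟩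
    ℤ.+ g 0 ℤ.- alternating (g ∘ suc) j     ≡⟨ alternating-suc g j ⟨
    alternating g (suc j)                   ∎

  alternating-0 : ∀ j → alternating (λ _ → 0) j ≡ 0ℤ
  alternating-0 zero    = refl
  alternating-0 (suc j) = trans (alternating-suc (λ _ → 0) j) (cong (λ x → 0ℤ ℤ.- x) (alternating-0 j))

  alternating-+ : ∀ f g j → alternating (λ k → f k ℕ.+ g k) j ≡ alternating f j ℤ.+ alternating g j
  alternating-+ f g zero    = refl
  alternating-+ f g (suc j) = begin
    alternating (λ k → f k ℕ.+ g k) (suc j) ≡⟨ alternating-suc (λ k → f k ℕ.+ g k) j ⟩
    ℤ.+ (f 0 ℕ.+ g 0) ℤ.- alternating (λ k → f (suc k) ℕ.+ g (suc k)) j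
      ≡⟨ cong₂ ℤ._-_ (ℤ.pos-+ (f 0) (g 0)) (alternating-+ (f ∘ suc) (g ∘ suc) j) ⟩
    (ℤ.+ f 0 ℤ.+ ℤ.+ g 0) ℤ.- (alternating (f ∘ suc) j ℤ.+ alternating (g ∘ suc) j)
      ≡⟨ solve 4 (λ a b x y → (a :+ b) :- (x :+ y) := (a :- x) :+ (b :- y)) refl (ℤ.+ f 0) (ℤ.+ g 0)
          (alternating (f ∘ suc) j) (alternating (g ∘ suc) j) ⟩
    (ℤ.+ f 0 ℤ.- alternating (f ∘ suc) j) ℤ.+ (ℤ.+ g 0 ℤ.- alternating (g ∘ suc) j)
      ≡⟨ cong₂ ℤ._+_ (alternating-suc f j) (alternating-suc g j) ⟨
    alternating f (suc j) ℤ.+ alternating g (suc j) ∎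

  alternating-indicator : ∀ {q j} → q < j → alternating (λ k → if does (q ℕ.≟ k) then 1 else 0) j ≡ -1ℤ ℤ.^ q
  alternating-indicator {zero}  {suc j} _ = trans (alternating-suc (λ k → if does (0 ℕ.≟ k) then 1 else 0) j)
    (cong (λ x → 1ℤ ℤ.- x) (alternating-0 j))
  alternating-indicator {suc q} {suc j} (s≤s q<j) = begin
    alternating (λ k → if does (suc q ℕ.≟ k) then 1 else 0) (suc j)
      ≡⟨ alternating-suc (λ k → if does (suc q ℕ.≟ k) then 1 else 0) j ⟩
    0ℤ ℤ.- alternating (λ k → if does (q ℕ.≟ k) then 1 else 0) j
      ≡⟨ cong (λ x → 0ℤ ℤ.- x) (alternating-indicator q<j) ⟩
    0ℤ ℤ.- -1ℤ ℤ.^ q ≡⟨ solve 1 (λ x → con 0ℤ :- x := con -1ℤ :* x) refl (-1ℤ ℤ.^ q) ⟩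
    -1ℤ ℤ.* -1ℤ ℤ.^ q ∎

  -- Each `r k` enters the alternating sum of `N` twice with opposite signs, except for `r 0` and
  -- `r j` at the ends. Keeping `r 0` next to `h` makes the hypothesis for the shifted sequences
  -- supply `r 1`.
  alternating-telescope : ∀ (h r N : ℕ → ℕ) → (∀ k → r (suc k) ℕ.+ (h k ℕ.+ r k) ≡ N k) → ∀ j →
    alternating h j ℤ.+ ℤ.+ r 0 ≡ alternating N j ℤ.+ -1ℤ ℤ.^ j ℤ.* ℤ.+ r j
  alternating-telescope h r N eq zero    = cong (λ x → 0ℤ ℤ.+ x) (sym (ℤ.*-identityˡ (ℤ.+ r 0)))
  alternating-telescope h r N eq (suc j) = begin
    alternating h (suc j) ℤ.+ ℤ.+ r 0 ≡⟨ cong (ℤ._+ ℤ.+ r 0) (alternating-suc h j) ⟩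
    (ℤ.+ h 0 ℤ.- H) ℤ.+ ℤ.+ r 0
      ≡⟨ solve 4 (λ h H r r′ → (h :- H) :+ r := (r′ :+ (h :+ r)) :- (H :+ r′)) refl (ℤ.+ h 0) H (ℤ.+ r 0)
          (ℤ.+ r 1) ⟩
    (ℤ.+ r 1 ℤ.+ (ℤ.+ h 0 ℤ.+ ℤ.+ r 0)) ℤ.- (H ℤ.+ ℤ.+ r 1)
      ≡⟨ cong₂ ℤ._-_
           (trans (cong (ℤ._+_ (ℤ.+ r 1)) (sym (ℤ.pos-+ (h 0) (r 0))))
               (trans (sym (ℤ.pos-+ (r 1) _)) (cong ℤ.+_ (eq 0))))
           (alternating-telescope (h ∘ suc) (r ∘ suc) (N ∘ suc) (eq ∘ suc) j) ⟩
    ℤ.+ N 0 ℤ.- (alternating (N ∘ suc) j ℤ.+ -1ℤ ℤ.^ j ℤ.* ℤ.+ r (suc j))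
      ≡⟨ solve 4 (λ N A s r → N :- (A :+ s :* r) := (N :- A) :+ (con -1ℤ :* s) :* r) refl (ℤ.+ N 0)
          (alternating (N ∘ suc) j) (-1ℤ ℤ.^ j) (ℤ.+ r (suc j)) ⟩
    (ℤ.+ N 0 ℤ.- alternating (N ∘ suc) j) ℤ.+ -1ℤ ℤ.^ suc j ℤ.* ℤ.+ r (suc j)
      ≡⟨ cong (ℤ._+ -1ℤ ℤ.^ suc j ℤ.* ℤ.+ r (suc j)) (alternating-suc N j) ⟨
    alternating N (suc j) ℤ.+ -1ℤ ℤ.^ suc j ℤ.* ℤ.+ r (suc j) ∎
    where H = alternating (h ∘ suc) j

#configurations : ∀ {n} → Graph n → ℕ → ℕ → ℕ
#configurations G m k = length (filter (λ C → (Q G C ℕ.≟ k) ×-dec (E G C ℕ.≟ m)) (configurations G))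

χ≡alternating : ∀ {n} (G : Graph n) m → χ G m ≡ alternating (#configurations G m) (suc m)
χ≡alternating G m = begin
  χ G m ≡⟨ ℤ.+-identityʳ _ ⟨
  χ G m ℤ.+ 0ℤ ≡⟨ cong (λ x → χ G m ℤ.+ ℤ.+ x) rank-zero ⟨
  χ G m ℤ.+ ℤ.+ rank 0 ≡⟨ alternating-telescope (λ k → dimSH G k m) rank (#configurations G m) dims (suc m) ⟩
  alternating (#configurations G m) (suc m) ℤ.+ -1ℤ ℤ.^ suc m ℤ.* ℤ.+ rank (suc m)
    ≡⟨ cong (λ x → alternating (#configurations G m) (suc m) ℤ.+ -1ℤ ℤ.^ suc m ℤ.* ℤ.+ x) rank-top ⟩
  alternating (#configurations G m) (suc m) ℤ.+ -1ℤ ℤ.^ suc m ℤ.* 0ℤ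
    ≡⟨ trans (cong (ℤ._+_ (alternating (#configurations G m) (suc m))) (ℤ.*-zeroʳ (-1ℤ ℤ.^ suc m)))
        (ℤ.+-identityʳ _) ⟩
  alternating (#configurations G m) (suc m) ∎
  where
  open ≡-Reasoning
  open GradedComplex (_≟ᶜ_ G) (D₀ G) (Q G) {λ C → E G C ≡ m} (λ C → E G C ℕ.≟ m)
    (D₀-degree G) (D₀-square G) (configurations-unique G) (∈-configurations G)

  dims : ∀ k → rank (suc k) ℕ.+ (dimSH G k m ℕ.+ rank k) ≡ #configurations G m k
  dims k = dimensions (proj₂ (SH-finiteDimensional G k m))

  -- A configuration with `Q` equal to m + 1 has `E` above m.
  top-empty : #configurations G m (suc m) ≡ 0
  top-empty = cong length (List.filter-none _ (All.tabulate {xs = configurations G} λ {C} _ (q , e) →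
    ℕ.1+n≰n (ℕ.≤-trans (ℕ.≤-reflexive (sym q)) (ℕ.≤-trans (ℕ.m≤m+n (Q G C) _) (ℕ.≤-reflexive e)))))

  -- The upper end of the cancellation: there are no chains in degree m + 1, and this rank is a
  -- summand of their dimension.
  rank-top : rank (suc m) ≡ 0
  rank-top = ℕ.m+n≡0⇒n≡0 (dimSH G (suc m) m) (ℕ.m+n≡0⇒n≡0 (rank (2 ℕ.+ m)) (trans (dims (suc m)) top-empty))

-- Coefficients of the state sum

module ℤ[t] = CommutativeRing polynomialRing
open Exp ℤ[t].semiring using (_^_)
open ConfigurationSum polynomialRing t using (∑ˡ; markWeight; weight; ∑-configurations)
open MatchingSum polynomialRing t using (∏; ∏-empty; ∏-suc; Z; Z-relabel; local; Compatible; det≈Z)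

monomial : ℤ → ℕ → Polynomial
monomial a zero    = a ∷ []
monomial a (suc e) = 0ℤ ∷ monomial a e

coefficient-monomial : ∀ a e m → toSeries (monomial a e) m ≡ (if does (e ℕ.≟ m) then a else 0ℤ)
coefficient-monomial a zero    zero    = refl
coefficient-monomial a zero    (suc m) = refl
coefficient-monomial a (suc e) zero    = refl
coefficient-monomial a (suc e) (suc m) = coefficient-monomial a e m

t-* : ∀ p → t *ᵖ p ≈ᵖ 0ℤ ∷ p
t-* p m = trans (shift-*ᵖ (1ℤ ∷ []) p m) (shifted m)
  where
  shifted : 0ℤ ∷ (1ℤ ∷ []) *ᵖ p ≈ᵖ 0ℤ ∷ p
  shifted zero    = refl
  shifted (suc m) = *ᵖ-identityˡ p m

t^-monomial : ∀ k {a e p} → p ≈ᵖ monomial a e → (t ^ k) *ᵖ p ≈ᵖ monomial a (k ℕ.+ e)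
t^-monomial zero    {p = p} p≈ m = trans (*ᵖ-identityˡ p m) (p≈ m)
t^-monomial (suc k) {a} {e} {p} p≈ m = begin
  toSeries ((t *ᵖ t ^ k) *ᵖ p) m ≡⟨ *ᵖ-assoc t (t ^ k) p m ⟩
  toSeries (t *ᵖ (t ^ k *ᵖ p)) m ≡⟨ *ᵖ-congˡ t {t ^ k *ᵖ p} {monomial a (k ℕ.+ e)} (t^-monomial k p≈) m ⟩
  toSeries (t *ᵖ monomial a (k ℕ.+ e)) m ≡⟨ t-* (monomial a (k ℕ.+ e)) m ⟩
  toSeries (0ℤ ∷ monomial a (k ℕ.+ e)) m ∎
  where open ≡-Reasoning

-t-monomial : ∀ {a e p} → p ≈ᵖ monomial a e → (-ᵖ t) *ᵖ p ≈ᵖ monomial (-1ℤ ℤ.* a) (suc e)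
-t-monomial {a} {e} {p} p≈ m = begin
  toSeries ((-ᵖ t) *ᵖ p) m ≡⟨ -‿distribˡ-* t p m ⟨
  toSeries (-ᵖ (t *ᵖ p)) m ≡⟨ coefficient-neg (t *ᵖ p) m ⟩
  ℤ.- toSeries (t *ᵖ p) m  ≡⟨ cong ℤ.-_ (*ᵖ-congˡ t {p} {monomial a e} p≈ m) ⟩
  ℤ.- toSeries (t *ᵖ monomial a e) m ≡⟨ cong ℤ.-_ (t-* (monomial a e) m) ⟩
  ℤ.- toSeries (monomial a (suc e)) m ≡⟨ negate (suc e) m ⟩
  toSeries (monomial (-1ℤ ℤ.* a) (suc e)) m ∎
  where
  open ≡-Reasoning
  open RingProperties ℤ[t].ring using (-‿distribˡ-*)
  negate : ∀ e m → ℤ.- toSeries (monomial a e) m ≡ toSeries (monomial (-1ℤ ℤ.* a) e) m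
  negate zero    zero    = sym (ℤ.-1*i≡-i a)
  negate zero    (suc m) = refl
  negate (suc e) zero    = refl
  negate (suc e) (suc m) = negate e m

∏-markWeight : ∀ {n} (ms : Vec (Maybe Sign) n) → let q = count minus? ms in
      ∏ (λ v → markWeight (Vec.lookup ms v)) ≈ᵖ monomial (-1ℤ ℤ.^ q) q
∏-markWeight Vec.[]         = ∏-empty _
∏-markWeight (a Vec.∷ ms) m = trans (∏-suc _ m) (step a m)
  where
  p = ∏ (λ v → markWeight (Vec.lookup ms v))
  step : ∀ a → let q = count minus? (a Vec.∷ ms) in markWeight a *ᵖ p ≈ᵖ monomial (-1ℤ ℤ.^ q) q
  step nothing         m = trans (*ᵖ-identityˡ p m) (∏-markWeight ms m)
  step (just Sign.+) m = trans (*ᵖ-identityˡ p m) (∏-markWeight ms m)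
  step (just Sign.-) m = -t-monomial {p = p} (∏-markWeight ms) m

-- Red edges give a power of `t` and minuses a power of `- t`; together this is the monomial (-1)^Q
-- t^E.
coefficient-weight : ∀ {n} (G : Graph n) C m →
  toSeries (weight G C) m ≡ (if does (E G C ℕ.≟ m) then -1ℤ ℤ.^ Q G C else 0ℤ)
coefficient-weight G C m = begin
  toSeries (weight G C) m
    ≡⟨ t^-monomial (#red G C) {p = ∏ (λ v → markWeight (Vec.lookup (Configuration.marks C) v))}
        (∏-markWeight (Configuration.marks C)) m ⟩
  toSeries (monomial s (#red G C ℕ.+ Q G C)) m
    ≡⟨ cong (λ e → toSeries (monomial s e) m) (ℕ.+-comm (#red G C) (Q G C)) ⟩
  toSeries (monomial s (E G C)) m ≡⟨ coefficient-monomial s (E G C) m ⟩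
  (if does (E G C ℕ.≟ m) then s else 0ℤ) ∎
  where
  open ≡-Reasoning
  s = -1ℤ ℤ.^ Q G C

-- Taken over an arbitrary list, for induction: a single configuration adds its sign to both sides
-- if its `E` is `m`, and zero otherwise.
alternating-count : ∀ {n} (G : Graph n) m cs →
  alternating (λ k → length (filter (λ C → (Q G C ℕ.≟ k) ×-dec (E G C ℕ.≟ m)) cs)) (suc m) ≡
  toSeries (∑ˡ (weight G) cs) m
alternating-count G m []       = alternating-0 (suc m)
alternating-count G m (C ∷ cs) = begin
  alternating (λ k → length (filter (P? k) (C ∷ cs))) (suc m) ≡⟨ alternating-cong split-off (suc m) ⟩
  alternating (λ k → (if does (P? k C) then 1 else 0) ℕ.+ length (filter (P? k) cs)) (suc m)
    ≡⟨ alternating-+ (λ k → if does (P? k C) then 1 else 0) (λ k → length (filter (P? k) cs)) (suc m) ⟩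
  alternating (λ k → if does (P? k C) then 1 else 0) (suc m) ℤ.+
    alternating (λ k → length (filter (P? k) cs)) (suc m)
    ≡⟨ cong₂ ℤ._+_ (trans (indicator (E G C ℕ.≟ m)) (sym (coefficient-weight G C m)))
        (alternating-count G m cs) ⟩
  toSeries (weight G C) m ℤ.+ toSeries (∑ˡ (weight G) cs) m ≡⟨ coefficient-+ (weight G C) _ m ⟨
  toSeries (∑ˡ (weight G) (C ∷ cs)) m ∎
  where
  open ≡-Reasoning
  P? = λ k C → (Q G C ℕ.≟ k) ×-dec (E G C ℕ.≟ m)
  split-off : ∀ k → length (filter (P? k) (C ∷ cs)) ≡
                    (if does (P? k C) then 1 else 0) ℕ.+ length (filter (P? k) cs)
  split-off k with does (P? k C)
  ... | true  = refl
  ... | false = refl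
  indicator : (e? : Dec (E G C ≡ m)) →
    alternating (λ k → if does ((Q G C ℕ.≟ k) ×-dec e?) then 1 else 0) (suc m) ≡
        (if does e? then -1ℤ ℤ.^ Q G C else 0ℤ)
  indicator (yes refl) = trans
    (alternating-cong (λ k → cong (if_then 1 else 0) (Bool.∧-identityʳ (does (Q G C ℕ.≟ k)))) (suc m))
    -- The degree `Q G C` is at most `E G C`, so it lies in the range of summation.
    (alternating-indicator {Q G C} (s≤s (ℕ.m≤m+n (Q G C) (#red G C))))
  indicator (no _) = trans
    (alternating-cong (λ k → cong (if_then 1 else 0) (Bool.∧-zeroʳ (does (Q G C ℕ.≟ k)))) (suc m))
    (alternating-0 (suc m))

-- The Seifert matrix of an enumeration

module _ {n} (G : Graph n) (σ : Permutation′ n) where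
  open Graph G
  private
    S = seifertMatrix G σ

  -- Row `i` of the matrix belongs to the vertex `σ ⟨$⟩ʳ i`; the inverse of `σ` carries the edges
  -- over to row indices.
  relabelledEdges : List (Fin n × Fin n)
  relabelledEdges = List.map (mapEnds (σ ⟨$⟩ˡ_)) (edges G)

  private
    entry : ℤ → ℤ → Polynomial
    entry a b = t *ᵖ const a +ᵖ (-ᵖ const b)

    S-diagonal : ∀ i → S i i ≡ -1ℤ
    S-diagonal i rewrite dec-true (i Fin.≟ i) refl = refl

    S-edge : ∀ {i j} → i <ᶠ j → (σ ⟨$⟩ʳ i) ~ (σ ⟨$⟩ʳ j) → S i j ≡ 1ℤ
    S-edge {i} {j} i<j i~j rewrite dec-false (i Fin.≟ j) (λ i≡j → ℕ.<-irrefl (cong toℕ i≡j) i<j)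
      | dec-true ((i Fin.<? j) ×-dec ((σ ⟨$⟩ʳ i) ~? (σ ⟨$⟩ʳ j))) (i<j , i~j) = refl

    S-other : ∀ {i j} → i ≢ j → ¬ (i <ᶠ j × (σ ⟨$⟩ʳ i) ~ (σ ⟨$⟩ʳ j)) → S i j ≡ 0ℤ
    S-other {i} {j} i≢j ¬edge rewrite dec-false (i Fin.≟ j) i≢j
      | dec-false ((i Fin.<? j) ×-dec ((σ ⟨$⟩ʳ i) ~? (σ ⟨$⟩ʳ j))) ¬edge = refl

    isEdge? = λ ((u , v) : Fin n × Fin n) → (u Fin.<? v) ×-dec (u ~? v)

    ∈-edges : ∀ {u v} → u <ᶠ v → u ~ v → (u , v) ∈ edges G
    ∈-edges u<v u~v = ∈ₚ.∈-filter⁺ isEdge? (∈ₚ.∈-cartesianProduct⁺ (∈ₚ.∈-allFin _) (∈ₚ.∈-allFin _)) (u<v , u~v)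

    relabelled : ∀ {i j} → (σ ⟨$⟩ʳ i , σ ⟨$⟩ʳ j) ∈ edges G → (i , j) ∈ relabelledEdges
    relabelled {i} {j} e∈ = subst (_∈ relabelledEdges)
      (cong₂ _,_ (Permutation.inverseˡ σ) (Permutation.inverseˡ σ)) (∈ₚ.∈-map⁺ (mapEnds (σ ⟨$⟩ˡ_)) e∈)

    adjacent : ∀ {i j} → (i , j) ∈ relabelledEdges → (σ ⟨$⟩ʳ i) ~ (σ ⟨$⟩ʳ j)
    adjacent ij∈ with ∈ₚ.∈-map⁻ (mapEnds (σ ⟨$⟩ˡ_)) ij∈
    ... | (u , v) , uv∈ , refl = subst₂ _~_ (sym (Permutation.inverseʳ σ)) (sym (Permutation.inverseʳ σ))
      (proj₂ (proj₂ (∈ₚ.∈-filter⁻ isEdge? {xs = cartesianProduct (allFin n) (allFin n)} uv∈)))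

    joined-adjacent′ : ∀ {i j} → Joined relabelledEdges i j → (σ ⟨$⟩ʳ i) ~ (σ ⟨$⟩ʳ j)
    joined-adjacent′ (inj₁ e∈) = adjacent e∈
    joined-adjacent′ (inj₂ e∈) = symmetric (adjacent e∈)

    adjacent-joined : ∀ {i j} → (σ ⟨$⟩ʳ i) ~ (σ ⟨$⟩ʳ j) → Joined relabelledEdges i j
    adjacent-joined {i} {j} i~j with Fin.<-cmp (σ ⟨$⟩ʳ i) (σ ⟨$⟩ʳ j)
    ... | tri< i<j _ _ = inj₁ (relabelled (∈-edges i<j i~j))
    ... | tri≈ _ i≡j _ = contradiction i~j (irreflexive i≡j)
    ... | tri> _ _ j<i = inj₂ (relabelled (∈-edges j<i (symmetric i~j)))

    forward : entry 1ℤ 0ℤ *ᵖ entry 0ℤ 1ℤ ≈ᵖ -ᵖ t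
    forward 0                   = refl
    forward 1                   = refl
    forward 2                   = refl
    forward (suc (suc (suc _))) = refl

    backward : entry 0ℤ 1ℤ *ᵖ entry 1ℤ 0ℤ ≈ᵖ -ᵖ t
    backward 0                   = refl
    backward 1                   = refl
    backward 2                   = refl
    backward (suc (suc (suc _))) = refl

    vanishing : entry 0ℤ 0ℤ ≈ᵖ []
    vanishing 0             = refl
    vanishing 1             = refl
    vanishing (suc (suc _)) = refl

  -- The diagonal entries are -t + 1. For adjacent vertices with i before j the entry at (i, j) is
  -- `t` and the one at (j, i) is -1, so the product is `- t` whatever the enumeration.
  seifert-compatible : Compatible (t ∙ᴹ S -ᴹ S ᵀ) relabelledEdges (λ _ → 0)
  seifert-compatible = record
    { diagonal = λ i m → cong (λ p → toSeries p m) (cong₂ entry (S-diagonal i) (S-diagonal i))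
    ; joined   = λ {i} {j} ij _ _ → product (joined-adjacent′ ij)
    ; separate = λ {i} {j} i≢j ¬ij m → trans
        (cong (λ p → toSeries p m) (cong₂ entry
          (S-other i≢j λ (_ , i~j) → ¬ij (adjacent-joined i~j , refl , refl))
          (S-other (i≢j ∘ sym) λ (_ , j~i) → ¬ij (adjacent-joined (symmetric j~i) , refl , refl))))
        (vanishing m)
    }
    where
    product : ∀ {i j} → (σ ⟨$⟩ʳ i) ~ (σ ⟨$⟩ʳ j) → entry (S i j) (S j i) *ᵖ entry (S j i) (S i j) ≈ᵖ -ᵖ t
    product {i} {j} i~j m with Fin.<-cmp i j
    ... | tri≈ _ refl _   = contradiction i~j (irreflexive refl)
    ... | tri< i<j i≢j j≮i = trans (cong (λ p → toSeries p m) (cong₂ (λ a b → entry a b *ᵖ entry b a)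
      (S-edge i<j i~j) (S-other (i≢j ∘ sym) λ (j<i , _) → j≮i j<i))) (forward m)
    ... | tri> i≮j i≢j j<i = trans (cong (λ p → toSeries p m) (cong₂ (λ a b → entry a b *ᵖ entry b a)
      (S-other i≢j λ (i<j , _) → i≮j i<j) (S-edge j<i (symmetric i~j)))) (backward m)

theorem2 : ∀ {n} (T : Graph n) → IsTree T → (σ : Permutation′ n) →
    let S = seifertMatrix T σ in
    generatingFunction T ≗ toSeries (det (t ∙ᴹ S -ᴹ S ᵀ))
theorem2 T tree σ m = begin
  χ T m ≡⟨ χ≡alternating T m ⟩
  alternating (#configurations T m) (suc m) ≡⟨ alternating-count T m (configurations T) ⟩
  toSeries (∑ˡ (weight T) (configurations T)) m ≡⟨ ∑-configurations T m ⟩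
  -- The relabelling uses the inverse of `σ`, hence the flipped permutation; the zero initial
  -- degrees are unaffected by it.
  toSeries (Z (edges T) (λ _ → 0)) m ≡⟨ Z-relabel (Permutation.flip σ) (edges T) (λ _ → 0) m ⟨
  toSeries (Z (relabelledEdges T σ) (λ _ → 0)) m
    ≡⟨ det≈Z (Peelable-map (Injection.injective (↔⇒↣ (Permutation.flip σ)))
        (edges-peelable T (IsTree.acyclic tree)))
         (seifert-compatible T σ) (λ _ → z≤n) m ⟨
  toSeries (det (t ∙ᴹ seifertMatrix T σ -ᴹ seifertMatrix T σ ᵀ)) m ∎
  where open ≡-Reasoning
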